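{- Let $H=\mathrm{Homeo}_+([0,1])$ be the group of order-preserving homeomorphisms of $[0,1]$. Then every two-dimensional topological similarity class in $H$ is meager in $H\times H$.
   Context: $H$ carries the topology with basic open sets $U(f;a_1,\dots,a_n;\varepsilon)=\{g\in H: |g(a_i)-f(a_i)|<\varepsilon \text{ for } i=1,\dots,n\}$, for $f\in H$, $a_1,\dots,a_n\in[0,1]$, $\varepsilon>0$; this makes $H$ a Polish group. For a topological group $K$, a pair $(g_1,g_2)\in K^2$ is topologically similar to $(f_1,f_2)\in K^2$ if the map $g_i\mapsto f_i$ ($i=1,2$) extends to a group isomorphism $\langle g_1,g_2\rangle\to\langle f_1,f_2\rangle$ that is a homeomorphism with respect to the subspace topologies. Its equivalence classes are the two-dimensional topological similarity classes. -}

module Defs where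

open import Level using (0ℓ)
open import Algebra.Bundles using (Group; RawGroup)
open import Algebra.Morphism.Structures using (IsGroupIsomorphism)
open import Data.List.Base using (List)
open import Data.List.Relation.Unary.All using (All)
open import Data.Nat.Base as ℕ using (ℕ)
import Data.Nat.Properties as ℕ
open import Data.Product.Base using (Σ; Σ-syntax; ∃; ∃-syntax; _×_; _,_; proj₁; proj₂)
open import Data.Product.Relation.Binary.Pointwise.NonDependent using (×-setoid)
open import Data.Rational.Base as ℚ using (ℚ; 0ℚ; 1ℚ; ½)
import Data.Rational.Properties as ℚ
open import Data.Rational.Solver using (module +-*-Solver)
open import Data.Sum.Base using (inj₁; inj₂)
open import Function.Bundles using (Inverse)
import Function.Construct.Composition as Composition
import Function.Construct.Identity as Identity
import Function.Construct.Symmetry as Symmetry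
open import Relation.Binary.Bundles using (Setoid)
import Relation.Binary.Construct.On as On
open import Relation.Binary.PropositionalEquality
  using (_≡_; refl; sym; trans; cong; cong₂; subst; subst₂)
open import Relation.Nullary.Decidable.Core using (Dec; yes; no)
open import Relation.Nullary.Negation.Core using (¬_; contradiction)
open import Relation.Unary using (Pred)

------------------------------------------------------------------------
-- Rational arithmetic

private

  half+half : ∀ p → ½ ℚ.* p ℚ.+ ½ ℚ.* p ≡ p
  half+half p = trans (sym (ℚ.*-distribʳ-+ p ½ ½)) (ℚ.*-identityˡ p)

  half>0 : ∀ {p} → 0ℚ ℚ.< p → 0ℚ ℚ.< ½ ℚ.* p
  half>0 {p} 0<p =
    subst (ℚ._< ½ ℚ.* p) (ℚ.*-zeroʳ ½) (ℚ.*-monoʳ-<-pos ½ 0<p)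

  -- the triangle inequality through halves of ε
  halves : ∀ {p q r ε} → p ℚ.≤ q ℚ.+ r →
           q ℚ.< ½ ℚ.* ε → r ℚ.< ½ ℚ.* ε → p ℚ.< ε
  halves {ε = ε} p≤ q< r< =
    ℚ.≤-<-trans p≤ (subst (_ ℚ.<_) (half+half ε) (ℚ.+-mono-< q< r<))

  ∣p-q∣≡∣q-p∣ : ∀ p q → ℚ.∣ p ℚ.- q ∣ ≡ ℚ.∣ q ℚ.- p ∣
  ∣p-q∣≡∣q-p∣ p q = trans (sym (ℚ.∣-p∣≡∣p∣ (p ℚ.- q))) (cong ℚ.∣_∣ lemma)
    where
    open +-*-Solver
    lemma : ℚ.- (p ℚ.- q) ≡ q ℚ.- p
    lemma = solve 2 (λ p q → :- (p :- q) := q :- p) refl p q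

  triangle : ∀ p q r →
             ℚ.∣ p ℚ.- r ∣ ℚ.≤ ℚ.∣ p ℚ.- q ∣ ℚ.+ ℚ.∣ q ℚ.- r ∣
  triangle p q r = subst (λ z → ℚ.∣ z ∣ ℚ.≤ ℚ.∣ p ℚ.- q ∣ ℚ.+ ℚ.∣ q ℚ.- r ∣)
    lemma (ℚ.∣p+q∣≤∣p∣+∣q∣ (p ℚ.- q) (q ℚ.- r))
    where
    open +-*-Solver
    lemma : (p ℚ.- q) ℚ.+ (q ℚ.- r) ≡ p ℚ.- r
    lemma = solve 3 (λ p q r → (p :- q) :+ (q :- r) := p :- r) refl p q r

  -‿triangle : ∀ p q r s →
    ℚ.∣ (p ℚ.- q) ℚ.- (r ℚ.- s) ∣ ℚ.≤ ℚ.∣ p ℚ.- r ∣ ℚ.+ ℚ.∣ q ℚ.- s ∣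
  -‿triangle p q r s =
    subst (λ z → ℚ.∣ z ∣ ℚ.≤ ℚ.∣ p ℚ.- r ∣ ℚ.+ ℚ.∣ q ℚ.- s ∣)
    lemma (ℚ.∣p-q∣≤∣p∣+∣q∣ (p ℚ.- r) (q ℚ.- s))
    where
    open +-*-Solver
    lemma : (p ℚ.- r) ℚ.- (q ℚ.- s) ≡ (p ℚ.- q) ℚ.- (r ℚ.- s)
    lemma = solve 4
      (λ p q r s → (p :- r) :- (q :- s) := (p :- q) :- (r :- s)) refl p q r s

  ∣p∣-∣q∣≤∣p-q∣ : ∀ p q → ℚ.∣ p ∣ ℚ.- ℚ.∣ q ∣ ℚ.≤ ℚ.∣ p ℚ.- q ∣
  ∣p∣-∣q∣≤∣p-q∣ p q = subst₂ ℚ._≤_ refl (cancel ℚ.∣ p ℚ.- q ∣ ℚ.∣ q ∣)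
    (ℚ.+-monoˡ-≤ (ℚ.- ℚ.∣ q ∣)
      (subst (λ z → ℚ.∣ z ∣ ℚ.≤ ℚ.∣ p ℚ.- q ∣ ℚ.+ ℚ.∣ q ∣) lemma
        (ℚ.∣p+q∣≤∣p∣+∣q∣ (p ℚ.- q) q)))
    where
    open +-*-Solver
    lemma : (p ℚ.- q) ℚ.+ q ≡ p
    lemma = solve 2 (λ p q → (p :- q) :+ q := p) refl p q
    cancel : ∀ a b → (a ℚ.+ b) ℚ.- b ≡ a
    cancel = solve 2 (λ a b → (a :+ b) :- b := a) refl

  ∣∣p∣-∣q∣∣≤∣p-q∣ : ∀ p q → ℚ.∣ ℚ.∣ p ∣ ℚ.- ℚ.∣ q ∣ ∣ ℚ.≤ ℚ.∣ p ℚ.- q ∣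
  ∣∣p∣-∣q∣∣≤∣p-q∣ p q with ℚ.∣p∣≡p∨∣p∣≡-p (ℚ.∣ p ∣ ℚ.- ℚ.∣ q ∣)
  ... | inj₁ eq = subst (ℚ._≤ ℚ.∣ p ℚ.- q ∣) (sym eq) (∣p∣-∣q∣≤∣p-q∣ p q)
  ... | inj₂ eq = subst₂ ℚ._≤_ (sym (trans eq lemma)) (∣p-q∣≡∣q-p∣ q p)
                    (∣p∣-∣q∣≤∣p-q∣ q p)
    where
    open +-*-Solver
    lemma : ℚ.- (ℚ.∣ p ∣ ℚ.- ℚ.∣ q ∣) ≡ ℚ.∣ q ∣ ℚ.- ℚ.∣ p ∣
    lemma = solve 2 (λ p q → :- (p :- q) := q :- p) refl ℚ.∣ p ∣ ℚ.∣ q ∣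

  ∣p-p∣<ε : ∀ p {ε} → 0ℚ ℚ.< ε → ℚ.∣ p ℚ.- p ∣ ℚ.< ε
  ∣p-p∣<ε p 0<ε =
    subst (ℚ._< _) (sym (cong ℚ.∣_∣ (ℚ.+-inverseʳ p))) 0<ε

  p-q<r⇒p<q+r : ∀ {p q r} → p ℚ.- q ℚ.< r → p ℚ.< q ℚ.+ r
  p-q<r⇒p<q+r {p} {q} {r} p-q<r =
    subst (ℚ._< q ℚ.+ r) (lemma p q) (ℚ.+-monoʳ-< q p-q<r)
    where
    open +-*-Solver
    lemma : ∀ p q → q ℚ.+ (p ℚ.- q) ≡ p
    lemma = solve 2 (λ p q → q :+ (p :- q) := p) refl

  p<q+r⇒p-q<r : ∀ {p q r} → p ℚ.< q ℚ.+ r → p ℚ.- q ℚ.< r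
  p<q+r⇒p-q<r {p} {q} {r} p<q+r =
    subst (p ℚ.- q ℚ.<_) (lemma q r) (ℚ.+-monoˡ-< (ℚ.- q) p<q+r)
    where
    open +-*-Solver
    lemma : ∀ q r → (q ℚ.+ r) ℚ.- q ≡ r
    lemma = solve 2 (λ q r → (q :+ r) :- q := r) refl

  p<p+ε : ∀ p {ε} → 0ℚ ℚ.< ε → p ℚ.< p ℚ.+ ε
  p<p+ε p {ε} 0<ε = subst (ℚ._< p ℚ.+ ε) (ℚ.+-identityʳ p) (ℚ.+-monoʳ-< p 0<ε)

  half<id : ∀ {ε} → 0ℚ ℚ.< ε → ½ ℚ.* ε ℚ.< ε
  half<id {ε} 0<ε =
    subst (½ ℚ.* ε ℚ.<_) (half+half ε) (p<p+ε (½ ℚ.* ε) (half>0 0<ε))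

  p≤∣p∣ : ∀ p → p ℚ.≤ ℚ.∣ p ∣
  p≤∣p∣ p with ℚ.≤-total 0ℚ p
  ... | inj₁ 0≤p = ℚ.≤-reflexive (sym (ℚ.0≤p⇒∣p∣≡p 0≤p))
  ... | inj₂ p≤0 = ℚ.≤-trans p≤0 (ℚ.0≤∣p∣ p)

  ∣p-q∣<ε⇒p<q+ε : ∀ {p q ε} → ℚ.∣ p ℚ.- q ∣ ℚ.< ε → p ℚ.< q ℚ.+ ε
  ∣p-q∣<ε⇒p<q+ε {p} {q} = λ lt →
    p-q<r⇒p<q+r (ℚ.≤-<-trans (p≤∣p∣ (p ℚ.- q)) lt)

  p<q+ε∧q<p+ε⇒∣p-q∣<ε : ∀ {p q ε} →
    p ℚ.< q ℚ.+ ε → q ℚ.< p ℚ.+ ε → ℚ.∣ p ℚ.- q ∣ ℚ.< ε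
  p<q+ε∧q<p+ε⇒∣p-q∣<ε {p} {q} p< q< with ℚ.∣p∣≡p∨∣p∣≡-p (p ℚ.- q)
  ... | inj₁ eq = subst (ℚ._< _) (sym eq) (p<q+r⇒p-q<r p<)
  ... | inj₂ eq = subst (ℚ._< _) (sym (trans eq (lemma p q))) (p<q+r⇒p-q<r q<)
    where
    open +-*-Solver
    lemma : ∀ p q → ℚ.- (p ℚ.- q) ≡ q ℚ.- p
    lemma = solve 2 (λ p q → :- (p :- q) := q :- p) refl

------------------------------------------------------------------------
-- The real numbers: Cauchy sequences of rationals, equal when their
-- difference tends to 0

Eventually : Pred ℕ 0ℓ → Set
Eventually P = ∃[ N ] ∀ n → N ℕ.≤ n → P n

private

  eventually₂ : ∀ {P Q R : Pred ℕ 0ℓ} → (∀ n → P n → Q n → R n) →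
                Eventually P → Eventually Q → Eventually R
  eventually₂ f (M , p) (N , q) = M ℕ.⊔ N , λ n M⊔N≤n →
    f n (p n (ℕ.m⊔n≤o⇒m≤o M N M⊔N≤n)) (q n (ℕ.m⊔n≤o⇒n≤o M N M⊔N≤n))

Cauchy : (ℕ → ℚ) → Set
Cauchy x = ∀ ε → 0ℚ ℚ.< ε →
  ∃[ N ] ∀ m n → N ℕ.≤ m → N ℕ.≤ n → ℚ.∣ x m ℚ.- x n ∣ ℚ.< ε

record ℝ : Set where
  constructor mkℝ
  field
    seq    : ℕ → ℚ
    cauchy : Cauchy seq

open ℝ public

infix 4 _≃_ _≤_ _<_
infixl 6 _-_

-- The three relations are records so that x and y can be inferred.

record _≃_ (x y : ℝ) : Set where
  constructor mk≃
  field
    at≃ : ∀ ε → 0ℚ ℚ.< ε → Eventually λ n → ℚ.∣ seq x n ℚ.- seq y n ∣ ℚ.< ε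

record _≤_ (x y : ℝ) : Set where
  constructor mk≤
  field
    at≤ : ∀ ε → 0ℚ ℚ.< ε → Eventually λ n → seq x n ℚ.< seq y n ℚ.+ ε

record _<_ (x y : ℝ) : Set where
  constructor mk<
  field
    gap : ∃[ ε ] 0ℚ ℚ.< ε × Eventually λ n → seq x n ℚ.+ ε ℚ.< seq y n

open _≃_ public
open _≤_ public
open _<_ public

ℝ-setoid : Setoid 0ℓ 0ℓ
ℝ-setoid = record
  { Carrier = ℝ
  ; _≈_ = _≃_
  ; isEquivalence = record
    { refl  = λ {x} → mk≃ λ ε 0<ε → 0 , λ n _ → ∣p-p∣<ε (seq x n) 0<ε
    ; sym   = λ {x} {y} x≃y → mk≃ λ ε 0<ε →
        let N , x≈y = at≃ x≃y ε 0<ε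
        in N , λ n N≤n →
             subst (ℚ._< ε) (∣p-q∣≡∣q-p∣ (seq x n) (seq y n)) (x≈y n N≤n)
    ; trans = λ {x} {y} {z} x≃y y≃z → mk≃ λ ε 0<ε →
        eventually₂ (λ n → halves (triangle (seq x n) (seq y n) (seq z n)))
          (at≃ x≃y (½ ℚ.* ε) (half>0 0<ε)) (at≃ y≃z (½ ℚ.* ε) (half>0 0<ε))
    }
  }

fromℚ : ℚ → ℝ
fromℚ p = mkℝ (λ _ → p) λ ε 0<ε → 0 , λ _ _ _ _ → ∣p-p∣<ε p 0<ε

0ℝ 1ℝ : ℝ
0ℝ = fromℚ 0ℚ
1ℝ = fromℚ 1ℚ

_-_ : ℝ → ℝ → ℝ
x - y = mkℝ (λ n → seq x n ℚ.- seq y n) λ ε 0<ε →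
  let M , p = cauchy x (½ ℚ.* ε) (half>0 0<ε)
      N , q = cauchy y (½ ℚ.* ε) (half>0 0<ε)
  in M ℕ.⊔ N , λ m n k≤m k≤n →
       halves (-‿triangle (seq x m) (seq y m) (seq x n) (seq y n))
         (p m n (ℕ.m⊔n≤o⇒m≤o M N k≤m) (ℕ.m⊔n≤o⇒m≤o M N k≤n))
         (q m n (ℕ.m⊔n≤o⇒n≤o M N k≤m) (ℕ.m⊔n≤o⇒n≤o M N k≤n))

<⇒≤ : ∀ {x y} → x < y → x ≤ y
<⇒≤ {x} {y} (mk< (δ , 0<δ , N , x+δ<y)) = mk≤ λ ε 0<ε → N , λ n N≤n →
  ℚ.<-trans (p<p+ε (seq x n) 0<δ)
    (ℚ.<-trans (x+δ<y n N≤n) (p<p+ε (seq y n) 0<ε))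

<⇒≱ : ∀ {x y} → x < y → ¬ (y ≤ x)
<⇒≱ (mk< (δ , 0<δ , M , x+δ<y)) y≤x =
  let N , y<x+δ = at≤ y≤x δ 0<δ
  in ℚ.<-asym (x+δ<y (M ℕ.⊔ N) (ℕ.m≤m⊔n M N))
              (y<x+δ (M ℕ.⊔ N) (ℕ.m≤n⊔m M N))

≮⇒≥ : ∀ {x y} → ¬ (x < y) → y ≤ x
≮⇒≥ {x} {y} x≮y = mk≤ λ ε 0<ε → Split.split ε 0<ε
  where
  module Split (ε : ℚ) (0<ε : 0ℚ ℚ.< ε) where
    z : ℕ → ℚ
    z = seq (y - x)
    δ = ½ ℚ.* (½ ℚ.* ε)
    0<δ : 0ℚ ℚ.< δ
    0<δ = half>0 (half>0 0<ε)
    N = proj₁ (cauchy (y - x) δ 0<δ)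
    z≈ : ∀ m n → N ℕ.≤ m → N ℕ.≤ n → z m ℚ.< z n ℚ.+ δ
    z≈ m n N≤m N≤n =
      ∣p-q∣<ε⇒p<q+ε (proj₂ (cauchy (y - x) δ 0<δ) m n N≤m N≤n)
    split : Eventually λ n → seq y n ℚ.< seq x n ℚ.+ ε
    split with z N ℚ.<? ½ ℚ.* ε
    ... | yes zN< = N , λ n N≤n → p-q<r⇒p<q+r
      (ℚ.<-trans (z≈ n N N≤n ℕ.≤-refl)
        (subst (z N ℚ.+ δ ℚ.<_) (half+half ε)
          (ℚ.+-mono-< zN< (half<id (half>0 0<ε)))))
    ... | no zN≮ = contradiction (mk< (δ , 0<δ , N , bound)) x≮y
      where
      bound : ∀ n → N ℕ.≤ n → seq x n ℚ.+ δ ℚ.< seq y n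
      bound n N≤n = subst (seq x n ℚ.+ δ ℚ.<_) (cancel (seq x n) (seq y n))
        (ℚ.+-monoʳ-< (seq x n) δ<z)
        where
        open +-*-Solver
        cancel : ∀ p q → p ℚ.+ (q ℚ.- p) ≡ q
        cancel = solve 2 (λ p q → p :+ (q :- p) := q) refl
        δ+δ<z+δ : δ ℚ.+ δ ℚ.< z n ℚ.+ δ
        δ+δ<z+δ = subst (ℚ._< z n ℚ.+ δ) (sym (half+half (½ ℚ.* ε)))
          (ℚ.≤-<-trans (ℚ.≮⇒≥ zN≮) (z≈ N n ℕ.≤-refl N≤n))
        δ<z : δ ℚ.< z n
        δ<z = subst₂ ℚ._<_ (minus δ δ) (minus (z n) δ)
                (ℚ.+-monoˡ-< (ℚ.- δ) δ+δ<z+δ)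
          where
          minus : ∀ p q → (p ℚ.+ q) ℚ.- q ≡ p
          minus = solve 2 (λ p q → (p :+ q) :- q := p) refl

≤-reflexive : ∀ {x y} → x ≃ y → x ≤ y
≤-reflexive x≃y = mk≤ λ ε 0<ε →
  let N , x≈y = at≃ x≃y ε 0<ε
  in N , λ n N≤n → ∣p-q∣<ε⇒p<q+ε (x≈y n N≤n)

≤-trans : ∀ {x y z} → x ≤ y → y ≤ z → x ≤ z
≤-trans {x} {y} {z} x≤y y≤z = mk≤ λ ε 0<ε →
  eventually₂ (λ n x<y+ y<z+ → subst (seq x n ℚ.<_) (lemma (seq z n) ε)
      (ℚ.<-trans x<y+ (ℚ.+-monoˡ-< (½ ℚ.* ε) y<z+)))
    (at≤ x≤y (½ ℚ.* ε) (half>0 0<ε)) (at≤ y≤z (½ ℚ.* ε) (half>0 0<ε))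
  where
  lemma : ∀ p ε → (p ℚ.+ ½ ℚ.* ε) ℚ.+ ½ ℚ.* ε ≡ p ℚ.+ ε
  lemma p ε = trans (ℚ.+-assoc p _ _) (cong (p ℚ.+_) (half+half ε))

≤-antisym : ∀ {x y} → x ≤ y → y ≤ x → x ≃ y
≤-antisym x≤y y≤x = mk≃ λ ε 0<ε →
  eventually₂ (λ n → p<q+ε∧q<p+ε⇒∣p-q∣<ε) (at≤ x≤y ε 0<ε) (at≤ y≤x ε 0<ε)

∣_∣ : ℝ → ℝ
∣ x ∣ = mkℝ (λ n → ℚ.∣ seq x n ∣) λ ε 0<ε →
  let N , p = cauchy x ε 0<ε
  in N , λ m n N≤m N≤n →
       ℚ.≤-<-trans (∣∣p∣-∣q∣∣≤∣p-q∣ (seq x m) (seq x n)) (p m n N≤m N≤n)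

------------------------------------------------------------------------
-- Topological spaces, presented by a basis

-- B is meant to be a basis of a topology on the quotient of the setoid by
-- its equality.  The basis axioms are not fields because no definition
-- below refers to them.

record Space : Set₁ where
  field
    setoid : Setoid 0ℓ 0ℓ
  open Setoid setoid public using (Carrier; _≈_)
  field
    Index : Set
    B     : Index → Pred Carrier 0ℓ

  Interior : Pred Carrier 0ℓ → Pred Carrier 0ℓ
  Interior A x = ∃[ i ] B i x × (∀ y → B i y → A y)

  Open : Pred Carrier 0ℓ → Set
  Open A = ∀ x → A x → Interior A x

  Closure : Pred Carrier 0ℓ → Pred Carrier 0ℓ
  Closure A x = ∀ i → B i x → ∃[ y ] B i y × A y

  NowhereDense : Pred Carrier 0ℓ → Set
  NowhereDense A = ∀ x → ¬ Interior (Closure A) x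

  Meager : Pred Carrier 0ℓ → Set₁
  Meager A = Σ[ N ∈ (ℕ → Pred Carrier 0ℓ) ]
    (∀ n → NowhereDense (N n)) × (∀ x → A x → ∃[ n ] N n x)

open Space using (Carrier; Index; B; Open; Meager)

Continuous : (X Y : Space) → (Carrier X → Carrier Y) → Set
Continuous X Y f = ∀ j → Open X (λ x → B Y j (f x))

record Homeomorphism (X Y : Space) : Set where
  field
    inverse         : Inverse (Space.setoid X) (Space.setoid Y)
  open Inverse inverse public
    using (to; from; to-cong; from-cong; strictlyInverseˡ; strictlyInverseʳ)
  field
    to-continuous   : Continuous X Y to
    from-continuous : Continuous Y X from

infixr 2 _×ₛ_

_×ₛ_ : Space → Space → Space
X ×ₛ Y = record
  { setoid = ×-setoid (Space.setoid X) (Space.setoid Y)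
  ; Index  = Index X × Index Y
  ; B      = λ (i , j) (x , y) → B X i x × B Y j y
  }

Subspace : (X : Space) → Pred (Carrier X) 0ℓ → Space
Subspace X P = record
  { setoid = On.setoid {B = Σ (Carrier X) P} (Space.setoid X) proj₁
  ; Index  = Index X
  ; B      = λ i x → B X i (proj₁ x)
  }

private

  id-continuous : ∀ X → Continuous X X (λ x → x)
  id-continuous X j x x∈ = j , x∈ , λ _ y∈ → y∈

  ∘-continuous : ∀ X Y Z g f → Continuous Y Z g → Continuous X Y f →
                 Continuous X Z (λ x → g (f x))
  ∘-continuous X Y Z g f g-cont f-cont k x gfx∈ =
    let j , fx∈ , j⊆ = g-cont k (f x) gfx∈
        i , x∈  , i⊆ = f-cont j x fx∈
    in i , x∈ , λ y y∈ → j⊆ (f y) (i⊆ y y∈)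

------------------------------------------------------------------------
-- Topological similarity of pairs

-- The topology of the group K is given by the basis B on its carrier.

module TopologicalSimilarity
  (K : Group 0ℓ 0ℓ) (Index : Set) (B : Index → Pred (Group.Carrier K) 0ℓ)
  where

  open Group K using (_≈_; _∙_; ε; _⁻¹) renaming (Carrier to |K|)

  space : Space
  space = record { setoid = Group.setoid K ; Index = Index ; B = B }

  data ⟨_,_⟩ (g₁ g₂ : |K|) : Pred |K| 0ℓ where
    gen₁ : ⟨ g₁ , g₂ ⟩ g₁
    gen₂ : ⟨ g₁ , g₂ ⟩ g₂
    unit : ⟨ g₁ , g₂ ⟩ ε
    mult : ∀ {h k} → ⟨ g₁ , g₂ ⟩ h → ⟨ g₁ , g₂ ⟩ k → ⟨ g₁ , g₂ ⟩ (h ∙ k)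
    inv  : ∀ {h} → ⟨ g₁ , g₂ ⟩ h → ⟨ g₁ , g₂ ⟩ (h ⁻¹)
    resp : ∀ {h k} → h ≈ k → ⟨ g₁ , g₂ ⟩ h → ⟨ g₁ , g₂ ⟩ k

  generated : |K| × |K| → RawGroup 0ℓ 0ℓ
  generated (g₁ , g₂) = record
    { Carrier = Σ |K| ⟨ g₁ , g₂ ⟩
    ; _≈_     = λ h k → proj₁ h ≈ proj₁ k
    ; _∙_     = λ (h , p) (k , q) → h ∙ k , mult p q
    ; ε       = ε , unit
    ; _⁻¹     = λ (h , p) → h ⁻¹ , inv p
    }

  generatedSpace : |K| × |K| → Space
  generatedSpace (g₁ , g₂) = Subspace space ⟨ g₁ , g₂ ⟩

  record TopologicallySimilar (g f : |K| × |K|) : Set where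
    field
      homeomorphism : Homeomorphism (generatedSpace g) (generatedSpace f)
    open Homeomorphism homeomorphism public using (to)
    field
      isGroupIsomorphism : IsGroupIsomorphism (generated g) (generated f) to
      extends₁ : proj₁ (to (proj₁ g , gen₁)) ≈ proj₁ f
      extends₂ : proj₁ (to (proj₂ g , gen₂)) ≈ proj₂ f

  SimilarityClass : |K| × |K| → Pred (|K| × |K|) 0ℓ
  SimilarityClass f g = TopologicallySimilar g f

------------------------------------------------------------------------
-- Homeo₊([0,1])

ℝ-space : Space
ℝ-space = record
  { setoid = ℝ-setoid
  ; Index  = ℝ × ℝ
  ; B      = λ (a , b) x → a < x × x < b
  }

[0,1] : Space
[0,1] = Subspace ℝ-space (λ x → 0ℝ ≤ x × x ≤ 1ℝ)

I : Set
I = Carrier [0,1]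

record Homeo₊ : Set where
  field
    homeomorphism : Homeomorphism [0,1] [0,1]
  open Homeomorphism homeomorphism public
  field
    monotone : ∀ x y → proj₁ x ≤ proj₁ y → proj₁ (to x) ≤ proj₁ (to y)

infixl 8 _⟨$⟩_

_⟨$⟩_ : Homeo₊ → I → ℝ
f ⟨$⟩ x = proj₁ (Homeo₊.to f x)

private
  module ℝₛ = Setoid ℝ-setoid

id₊ : Homeo₊
id₊ = record
  { homeomorphism = record
    { inverse         = Identity.inverse (Space.setoid [0,1])
    ; to-continuous   = id-continuous [0,1]
    ; from-continuous = id-continuous [0,1]
    }
  ; monotone = λ _ _ x≤y → x≤y
  }

infixr 9 _∘₊_

_∘₊_ : Homeo₊ → Homeo₊ → Homeo₊
f ∘₊ g = record
  { homeomorphism = record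
    { inverse         = Composition.inverse G.inverse F.inverse
    ; to-continuous   =
        ∘-continuous [0,1] [0,1] [0,1] F.to G.to F.to-continuous G.to-continuous
    ; from-continuous =
        ∘-continuous [0,1] [0,1] [0,1] G.from F.from
          G.from-continuous F.from-continuous
    }
  ; monotone = λ x y x≤y → F.monotone (G.to x) (G.to y) (G.monotone x y x≤y)
  }
  where
  module F = Homeo₊ f
  module G = Homeo₊ g

infix 10 _⁻¹₊

_⁻¹₊ : Homeo₊ → Homeo₊
f ⁻¹₊ = record
  { homeomorphism = record
    { inverse         = Symmetry.inverse F.inverse
    ; to-continuous   = F.from-continuous
    ; from-continuous = F.to-continuous
    }
  ; monotone = λ x y x≤y → ≮⇒≥ λ f⁻¹y<f⁻¹x →
      <⇒≱ f⁻¹y<f⁻¹x (≤-reflexive (F.from-cong {x} {y} (≤-antisym x≤y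
        (≤-trans (≤-reflexive (ℝₛ.sym (F.strictlyInverseˡ y)))
          (≤-trans (F.monotone (F.from y) (F.from x) (<⇒≤ f⁻¹y<f⁻¹x))
            (≤-reflexive (F.strictlyInverseˡ x)))))))
  }
  where module F = Homeo₊ f

H : Group 0ℓ 0ℓ
H = record
  { Carrier = Homeo₊
  ; _≈_     = λ f g → ∀ x → f ⟨$⟩ x ≃ g ⟨$⟩ x
  ; _∙_     = _∘₊_
  ; ε       = id₊
  ; _⁻¹     = _⁻¹₊
  ; isGroup = record
    { isMonoid = record
      { isSemigroup = record
        { isMagma = record
          { isEquivalence = record
            { refl  = λ {f} x → ℝₛ.refl
            ; sym   = λ {f} {g} f≈g x → ℝₛ.sym (f≈g x)
            ; trans = λ {f} {g} {h} f≈g g≈h x →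
                ℝₛ.trans (f≈g x) (g≈h x)
            }
          ; ∙-cong = λ {f} {f′} {g} {g′} f≈f′ g≈g′ x →
              ℝₛ.trans
                (Homeo₊.to-cong f {Homeo₊.to g x} {Homeo₊.to g′ x} (g≈g′ x))
                (f≈f′ (Homeo₊.to g′ x))
          }
        ; assoc = λ _ _ _ _ → ℝₛ.refl
        }
      ; identity = (λ _ _ → ℝₛ.refl) , (λ _ _ → ℝₛ.refl)
      }
    ; inverse = Homeo₊.strictlyInverseʳ , Homeo₊.strictlyInverseˡ
    ; ⁻¹-cong = λ {f} {g} f≈g x →
        let module F = Homeo₊ f
            module G = Homeo₊ g
        in ℝₛ.trans
             (ℝₛ.sym
               (G.strictlyInverseʳ (F.from x)))
             (G.from-cong {G.to (F.from x)} {x}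
               (ℝₛ.trans
                 (ℝₛ.sym (f≈g (F.from x)))
                 (F.strictlyInverseˡ x)))
    }
  }

U : Homeo₊ → List I → ℝ → Pred Homeo₊ 0ℓ
U f as ε g = All (λ a → ∣ g ⟨$⟩ a - f ⟨$⟩ a ∣ < ε) as

H-Index : Set
H-Index = Homeo₊ × List I × Σ[ ε ∈ ℝ ] 0ℝ < ε

H-basis : H-Index → Pred Homeo₊ 0ℓ
H-basis (f , as , ε , _) = U f as ε

open TopologicalSimilarity H H-Index H-basis public
  using (SimilarityClass) renaming (space to H-space)

{-# OPTIONS --safe #-}
module Submission where

{-
Let t range over the words f^± g^± ⋯ f^± g^±, and consider the conjugates t f t⁻¹.
At the given pair F either the conjugates with long t stay outside a neighbourhood
of 1, or they accumulate at 1.  In the first case, there are m and L such that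
the conjugates with t of length ≥ L stay outside the m-th dyadic neighbourhood of
1 at a pair G similar to F, where L depends only on F.  In the second case there
is n such that w(G)(½) ≤ ¾ for all words w with w(F) in the n-th neighbourhood.
It remains to see that, for fixed m or n, such pairs G are nowhere dense.

Any two homeomorphisms can be perturbed so that on a fine grid the nodes climb:
at the odd nodes one of g, g⁻¹ and at the even nodes one of f, f⁻¹ moves the node
at least to the next one.  Then some t carries the first node to the last but
one.  If moreover f is the identity on the first cell, t f t⁻¹ is the identity
outside the last cell, which settles the first case.  In the second case take a
long u, with u f u⁻¹ so close to 1 at F that t u f u⁻¹ t⁻¹ is in the n-th
neighbourhood.  Cut the first cell so finely that u f u⁻¹ can be made to climb
through it, while t, being shorter, does not carry its lowest nodes out of it;
then t u f u⁻¹ t⁻¹ moves ½ beyond ¾.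
-}

open import Level using (0ℓ)
open import Axiom.ExcludedMiddle using (ExcludedMiddle)
open import Algebra.Bundles using (Group)
open import Algebra.Morphism.Structures using (IsGroupIsomorphism)
open import Data.Bool.Base using (Bool; true; false; not; if_then_else_)
open import Data.Integer.Base as ℤ using (+_; -[1+_])
import Data.Integer.Properties as ℤ
open import Data.List.Base using (List; []; _∷_; _++_; _∷ʳ_; length; map; applyUpTo)
import Data.List.Properties as List
open import Data.List.Relation.Binary.Subset.Propositional using (_⊆_)
import Data.List.Relation.Binary.Subset.Propositional.Properties as ⊆
open import Data.List.Relation.Unary.All using (All; []; _∷_)
import Data.List.Relation.Unary.All as All
import Data.List.Relation.Unary.All.Properties as All
open import Data.Nat.Base as ℕ using (ℕ; zero; suc; z≤n; s≤s; ⌊_/2⌋; ⌈_/2⌉; _<ᵇ_)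
import Data.Nat.Properties as ℕ
open import Data.Nat.Solver using () renaming (module +-*-Solver to ℕ-Solver)
open import Data.Product.Base
  using (Σ; ∃-syntax; _×_; _,_; proj₁; proj₂)
open import Data.Rational.Base as ℚ using (ℚ; 0ℚ; 1ℚ; ½; mkℚ; toℚᵘ)
import Data.Rational.Properties as ℚ
import Algebra.Properties.Monoid.Mult ℚ.+-0-monoid as Mult
open import Data.Rational.Solver using (module +-*-Solver)
open import Data.Rational.Unnormalised.Base as ℚᵘ using (mkℚᵘ; *≡*; *≤*)
import Data.Rational.Unnormalised.Properties as ℚᵘ
open import Data.Sum.Base using (_⊎_; inj₁; inj₂)
open import Relation.Binary.Bundles using (Setoid)
open import Relation.Binary.PropositionalEquality
  using (_≡_; refl; sym; trans; cong; cong₂; subst; subst₂)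
open import Relation.Nullary.Decidable.Core using (Dec; yes; no; toWitness)
open import Relation.Nullary.Negation.Core using (¬_; contradiction)
open import Relation.Nullary.Reflects using (Reflects; ofʸ; ofⁿ)
open import Relation.Unary using (Pred)
open import Defs

open +-*-Solver using (solve; _:=_; _:+_; _:*_; _:-_; :-_; con)
open ℕ-Solver using () renaming
  (solve to solveℕ; _:=_ to _⊜_; _:+_ to _⊕_; _:*_ to _⊗_; con to κ)
open TopologicalSimilarity H H-Index H-basis
  using (⟨_,_⟩; gen₁; gen₂; unit; mult; inv; generatedSpace; TopologicallySimilar)
open Mult using () renaming (_×_ to infixr 8 _×ℚ_)

-- Rational inequalities

-- The climbing rests on parity. For g the nodes are grouped into couples 2i+1, 2i+2, and a couple
-- is sent into a cell between nodes 2b and 2b+1; for f the couples are 2i+2, 2i+3 and the cells lie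
-- between 2a+1 and 2a+2. Such a cell is never the interval spanned by its couple, so the couple
-- moves up or down as a whole, and the map or its inverse carries its lower node at least to its
-- upper one. Rounding a homeomorphism to such cells costs little on a fine grid, but the resulting
-- signs are not under control.
--
-- This makes the order of choices in the second case delicate. The word t is dictated by the signs
-- of the rounded homeomorphisms, and only then can u be requested from the accumulation at F, since
-- the neighbourhood of 1 is pulled back by t. So u has to be accommodated afterwards without
-- changing t or spoiling the approximation. It gets room inside the first cell, where values can be
-- chosen next to the diagonal: there either sign can be prescribed, while no letter raises a node
-- by more than two places.

lin< : ∀ {a b p q} → a ℚ.< b → p ℚ.+ b ≡ q ℚ.+ a → p ℚ.< q
lin< {p = p} {q} a<b eq with p ℚ.<? q
... | yes p<q = p<q
... | no  p≮q = contradiction (sym eq)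
  (ℚ.<⇒≢ (ℚ.+-mono-≤-< (ℚ.≮⇒≥ p≮q) a<b))

-- Like `lin<`, this reduces a linear inequality to a known one and an identity, most often left to
-- the ring solver: if the conclusion failed, adding the known inequality would contradict the
-- identity.
lin≤ : ∀ {a b p q} → a ℚ.≤ b → p ℚ.+ b ≡ q ℚ.+ a → p ℚ.≤ q
lin≤ {p = p} {q} a≤b eq with q ℚ.<? p
... | no  q≮p = ℚ.≮⇒≥ q≮p
... | yes q<p = contradiction (sym eq) (ℚ.<⇒≢ (ℚ.+-mono-<-≤ q<p a≤b))

½*-pos : ∀ {p} → 0ℚ ℚ.< p → 0ℚ ℚ.< ½ ℚ.* p
½*-pos {p} 0<p =
  subst (ℚ._< ½ ℚ.* p) (ℚ.*-zeroʳ ½) (ℚ.*-monoʳ-<-pos ½ 0<p)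

½+½ : ∀ p → ½ ℚ.* p ℚ.+ ½ ℚ.* p ≡ p
½+½ p = trans (sym (ℚ.*-distribʳ-+ p ½ ½)) (ℚ.*-identityˡ p)

½*-≤ : ∀ {p} → 0ℚ ℚ.< p → ½ ℚ.* p ℚ.≤ p
½*-≤ {p} 0<p = lin≤ (ℚ.<⇒≤ (½*-pos 0<p))
  (trans (½+½ p) (sym (ℚ.+-identityʳ p)))

p<p+q : ∀ p {q} → 0ℚ ℚ.< q → p ℚ.< p ℚ.+ q
p<p+q p {q} 0<q = lin< 0<q (sym (ℚ.+-identityʳ (p ℚ.+ q)))

∣p-q∣<r⇒p<q+r : ∀ p q {r} → ℚ.∣ p ℚ.- q ∣ ℚ.< r → p ℚ.< q ℚ.+ r
∣p-q∣<r⇒p<q+r p q {r} lt with ℚ.≤-total 0ℚ (p ℚ.- q)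
... | inj₁ 0≤ = lin< (subst (ℚ._< r) (ℚ.0≤p⇒∣p∣≡p 0≤) lt)
  (solve 3 (λ p q r → p :+ r := q :+ r :+ (p :- q)) refl p q r)
... | inj₂ ≤0 = lin< (ℚ.+-mono-≤-< ≤0 (ℚ.≤-<-trans (ℚ.0≤∣p∣ (p ℚ.- q)) lt))
  (solve 3 (λ p q r → p :+ (con 0ℚ :+ r) := q :+ r :+ (p :- q :+ con 0ℚ)) refl p q r)

∣p-q∣≡∣q-p∣ : ∀ p q → ℚ.∣ p ℚ.- q ∣ ≡ ℚ.∣ q ℚ.- p ∣
∣p-q∣≡∣q-p∣ p q = trans (sym (ℚ.∣-p∣≡∣p∣ (p ℚ.- q)))
  (cong ℚ.∣_∣ (solve 2 (λ p q → :- (p :- q) := q :- p) refl p q))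

∣p-q∣<r⇒q<p+r : ∀ p q {r} → ℚ.∣ p ℚ.- q ∣ ℚ.< r → q ℚ.< p ℚ.+ r
∣p-q∣<r⇒q<p+r p q lt =
  ∣p-q∣<r⇒p<q+r q p (subst (ℚ._< _) (∣p-q∣≡∣q-p∣ p q) lt)

p<q+r∧q<p+r⇒∣p-q∣<r : ∀ {p q r} →
  p ℚ.< q ℚ.+ r → q ℚ.< p ℚ.+ r → ℚ.∣ p ℚ.- q ∣ ℚ.< r
p<q+r∧q<p+r⇒∣p-q∣<r {p} {q} {r} p< q< with ℚ.∣p∣≡p∨∣p∣≡-p (p ℚ.- q)
... | inj₁ eq = subst (ℚ._< r) (sym eq)
  (lin< p< (solve 3 (λ p q r → p :- q :+ (q :+ r) := r :+ p) refl p q r))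
... | inj₂ eq = subst (ℚ._< r) (sym eq)
  (lin< q< (solve 3 (λ p q r → :- (p :- q) :+ (p :+ r) := r :+ q) refl p q r))

0≤*0≤ : ∀ {p q} → 0ℚ ℚ.≤ p → 0ℚ ℚ.≤ q → 0ℚ ℚ.≤ p ℚ.* q
0≤*0≤ {p} {q} 0≤p 0≤q = subst (ℚ._≤ p ℚ.* q) (ℚ.*-zeroʳ p)
  (ℚ.*-monoˡ-≤-nonNeg p {{ℚ.nonNegative 0≤p}} 0≤q)

0<*0< : ∀ {p q} → 0ℚ ℚ.< p → 0ℚ ℚ.< q → 0ℚ ℚ.< p ℚ.* q
0<*0< {p} {q} 0<p 0<q = subst (ℚ._< p ℚ.* q) (ℚ.*-zeroʳ p)
  (ℚ.*-monoʳ-<-pos p {{ℚ.positive 0<p}} 0<q)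

p≤q⇒0≤q-p : ∀ {p q} → p ℚ.≤ q → 0ℚ ℚ.≤ q ℚ.- p
p≤q⇒0≤q-p {p} {q} p≤q =
  lin≤ p≤q (solve 2 (λ p q → con 0ℚ :+ q := q :- p :+ p) refl p q)

p<q⇒0<q-p : ∀ {p q} → p ℚ.< q → 0ℚ ℚ.< q ℚ.- p
p<q⇒0<q-p {p} {q} p<q =
  lin< p<q (solve 2 (λ p q → con 0ℚ :+ q := q :- p :+ p) refl p q)

-- Order on the reals

module ℝₛ = Setoid ℝ-setoid

≤-refl : ∀ {x} → x ≤ x
≤-refl = ≤-reflexive ℝₛ.refl

fromℚ-mono-≤ : ∀ {p q} → p ℚ.≤ q → fromℚ p ≤ fromℚ q
fromℚ-mono-≤ p≤q = mk≤ λ ε 0<ε → 0 , λ _ _ → ℚ.≤-<-trans p≤q (p<p+q _ 0<ε)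

fromℚ-mono-< : ∀ {p q} → p ℚ.< q → fromℚ p < fromℚ q
fromℚ-mono-< {p} {q} p<q = mk< (½ ℚ.* (q ℚ.- p) ,
    ½*-pos 0<q-p , 0 , λ _ _ →
    lin< (½*-pos 0<q-p) (trans (cong₂ ℚ._+_ (refl {x = p ℚ.+ ½ ℚ.* (q ℚ.- p)}) refl)
      (trans (ℚ.+-assoc p _ _) (trans (cong (p ℚ.+_) (½+½ (q ℚ.- p)))
        (solve 2 (λ p q → p :+ (q :- p) := q :+ con 0ℚ) refl p q)))))
  where
  0<q-p : 0ℚ ℚ.< q ℚ.- p
  0<q-p = lin< p<q (solve 2 (λ p q → con 0ℚ :+ q := q :- p :+ p) refl p q)

fromℚ-cancel-< : ∀ {p q} → fromℚ p < fromℚ q → p ℚ.< q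
fromℚ-cancel-< (mk< (ε , 0<ε , N , lt)) = ℚ.<-trans (p<p+q _ 0<ε) (lt N ℕ.≤-refl)

fromℚ-cancel-≤ : ∀ {p q} → fromℚ p ≤ fromℚ q → p ℚ.≤ q
fromℚ-cancel-≤ p≤q = ℚ.≮⇒≥ λ q<p → <⇒≱ (fromℚ-mono-< q<p) p≤q

<-≤-trans : ∀ {x y z} → x < y → y ≤ z → x < z
<-≤-trans {x} {y} {z} (mk< (ε , 0<ε , M , x<y)) y≤z = mk< (δ , 0<δ , M ℕ.⊔ N , λ n le →
    lin< (ℚ.+-mono-< (x<y n (ℕ.m⊔n≤o⇒m≤o M N le)) (y<z n (ℕ.m⊔n≤o⇒n≤o M N le)))
      (trans (solve 4 (λ x d y z → x :+ d :+ (y :+ (z :+ d)) := z :+ ((x :+ (d :+ d)) :+ y))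
               refl (seq x n) δ (seq y n) (seq z n))
             (cong (λ e → seq z n ℚ.+ (seq x n ℚ.+ e ℚ.+ seq y n)) (½+½ ε))))
  where
  δ = ½ ℚ.* ε
  0<δ : 0ℚ ℚ.< δ
  0<δ = ½*-pos 0<ε
  N = proj₁ (at≤ y≤z δ 0<δ)
  y<z = proj₂ (at≤ y≤z δ 0<δ)

≤-<-trans : ∀ {x y z} → x ≤ y → y < z → x < z
≤-<-trans {x} {y} {z} x≤y (mk< (ε , 0<ε , M , y<z)) = mk< (δ , 0<δ , M ℕ.⊔ N , λ n le →
    lin< (ℚ.+-mono-< (y<z n (ℕ.m⊔n≤o⇒m≤o M N le)) (x<y n (ℕ.m⊔n≤o⇒n≤o M N le)))
      (trans (solve 4 (λ x d y z → x :+ d :+ (z :+ (y :+ d)) := z :+ ((y :+ (d :+ d)) :+ x))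
               refl (seq x n) δ (seq y n) (seq z n))
             (cong (λ e → seq z n ℚ.+ (seq y n ℚ.+ e ℚ.+ seq x n)) (½+½ ε))))
  where
  δ = ½ ℚ.* ε
  0<δ : 0ℚ ℚ.< δ
  0<δ = ½*-pos 0<ε
  N = proj₁ (at≤ x≤y δ 0<δ)
  x<y = proj₂ (at≤ x≤y δ 0<δ)

<-trans : ∀ {x y z} → x < y → y < z → x < z
<-trans x<y y<z = <-≤-trans x<y (<⇒≤ y<z)

dense : ∀ {x y} → x < y → ∃[ q ] x < fromℚ q × fromℚ q < y
dense {x} {y} (mk< (ε , 0<ε , M , x<y)) = q ,
    mk< (d , 0<d , L , λ n le → lin<
      (∣p-q∣<r⇒p<q+r (seq x n) (seq x L) (near n L (ℕ.m⊔n≤o⇒n≤o M N le) (ℕ.m≤n⊔m M N)))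
      (solve 3 (λ x z d → x :+ d :+ (z :+ d) := z :+ (d :+ d) :+ x)
        refl (seq x n) (seq x L) d)) ,
    mk< (d , 0<d , L , λ n le → lin<
      (ℚ.+-mono-< (∣p-q∣<r⇒q<p+r (seq x n) (seq x L) (near n L (ℕ.m⊔n≤o⇒n≤o M N le) (ℕ.m≤n⊔m M N)))
        (x<y n (ℕ.m⊔n≤o⇒m≤o M N le)))
      (trans
        (solve 4 (λ x y z d → z :+ (d :+ d) :+ d :+ (x :+ d :+ y)
                   := y :+ (z :+ (x :+ ((d :+ d) :+ (d :+ d)))))
          refl (seq x n) (seq y n) (seq x L) d)
        (cong (λ e → seq y n ℚ.+ (seq x L ℚ.+ (seq x n ℚ.+ e)))
          (trans (cong₂ ℚ._+_ (½+½ (½ ℚ.* ε)) (½+½ (½ ℚ.* ε))) (½+½ ε)))))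
  where
  d = ½ ℚ.* (½ ℚ.* ε)
  0<d : 0ℚ ℚ.< d
  0<d = ½*-pos (½*-pos 0<ε)
  N = proj₁ (cauchy x d 0<d)
  near = proj₂ (cauchy x d 0<d)
  L = M ℕ.⊔ N
  q = seq x L ℚ.+ (d ℚ.+ d)

seq≡⇒≃ : ∀ {x y} → (∀ n → seq x n ≡ seq y n) → x ≃ y
seq≡⇒≃ {x} {y} eq = ≤-antisym
  (mk≤ λ ε 0<ε → 0 , λ n _ → subst (λ q → seq x n ℚ.< q ℚ.+ ε) (eq n) (p<p+q (seq x n) 0<ε))
  (mk≤ λ ε 0<ε → 0 , λ n _ → subst (λ q → q ℚ.< seq x n ℚ.+ ε) (eq n) (p<p+q (seq x n) 0<ε))

≥-of-≃ : ∀ {x y} → x ≃ y → y ≤ x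
≥-of-≃ x≃y = ≤-reflexive (ℝₛ.sym x≃y)

-- Closeness of two reals

-- A common rational bracket in place of a bound on an absolute difference: for monotone maps it is
-- obtained from order comparisons alone.
Close : ℚ → ℝ → ℝ → Set
Close δ x y = ∃[ p ] ∃[ q ] q ℚ.< p ℚ.+ δ ×
  (fromℚ p ≤ x × x ≤ fromℚ q) × (fromℚ p ≤ y × y ≤ fromℚ q)

close-∣∣ : ∀ {δ x y} → Close δ x y → Eventually λ n → ℚ.∣ seq x n ℚ.- seq y n ∣ ℚ.< δ
close-∣∣ {δ} {x} {y} (p , q , q<p+δ , (p≤x , x≤q) , (p≤y , y≤q)) =
    K , λ n le →
      let m₁ = ℕ.m⊔n≤o⇒m≤o N₁ (N₂ ℕ.⊔ (N₃ ℕ.⊔ N₄)) le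
          r₁ = ℕ.m⊔n≤o⇒n≤o N₁ (N₂ ℕ.⊔ (N₃ ℕ.⊔ N₄)) le
          m₂ = ℕ.m⊔n≤o⇒m≤o N₂ (N₃ ℕ.⊔ N₄) r₁
          r₂ = ℕ.m⊔n≤o⇒n≤o N₂ (N₃ ℕ.⊔ N₄) r₁
          m₃ = ℕ.m⊔n≤o⇒m≤o N₃ N₄ r₂
          m₄ = ℕ.m⊔n≤o⇒n≤o N₃ N₄ r₂
      in p<q+r∧q<p+r⇒∣p-q∣<r
           (between (seq y n) (seq x n) (proj₂ (at≤ p≤y ε 0<ε) n m₃) (proj₂ (at≤ x≤q ε 0<ε) n m₂))
           (between (seq x n) (seq y n) (proj₂ (at≤ p≤x ε 0<ε) n m₁) (proj₂ (at≤ y≤q ε 0<ε) n m₄))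
  where
  r = p ℚ.+ δ ℚ.- q
  ε = ½ ℚ.* r
  0<r : 0ℚ ℚ.< r
  0<r = lin< q<p+δ
    (solve 3 (λ p q d → con 0ℚ :+ (p :+ d) := p :+ d :- q :+ q) refl p q δ)
  0<ε : 0ℚ ℚ.< ε
  0<ε = ½*-pos 0<r
  N₁ = proj₁ (at≤ p≤x ε 0<ε)
  N₂ = proj₁ (at≤ x≤q ε 0<ε)
  N₃ = proj₁ (at≤ p≤y ε 0<ε)
  N₄ = proj₁ (at≤ y≤q ε 0<ε)
  K = N₁ ℕ.⊔ (N₂ ℕ.⊔ (N₃ ℕ.⊔ N₄))
  between : ∀ u v → p ℚ.< u ℚ.+ ε → v ℚ.< q ℚ.+ ε → v ℚ.< u ℚ.+ δ
  between u v p<u v<q = lin< (ℚ.+-mono-< p<u v<q)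
    (trans (solve 4 (λ u v q e → v :+ (u :+ e :+ (q :+ e)) := u :+ v :+ q :+ (e :+ e)) refl u v q ε)
      (trans (cong (u ℚ.+ v ℚ.+ q ℚ.+_) (½+½ r))
        (solve 5 (λ u v p q d → u :+ v :+ q :+ (p :+ d :- q) := u :+ d :+ (p :+ v)) refl u v p q δ)))

-- The margin of a strict inequality is the tolerance with which `x` may be moved.
gap-close : ∀ x y z e (lt : ∣ x - z ∣ < e) → Close (proj₁ (gap lt)) y x → ∣ y - z ∣ < e
gap-close x y z e (mk< (δ , 0<δ , M , x<)) cl@(p , q , q<p+δ , _) =
  mk< (γ , 0<γ , M ℕ.⊔ N , λ n le → lin<
    (ℚ.+-mono-≤-< (tri (seq x n) (seq y n) (seq z n))
      (ℚ.+-mono-< (x< n (ℕ.m⊔n≤o⇒m≤o M N le)) (y≈ n (ℕ.m⊔n≤o⇒n≤o M N le))))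
    (solve 6 (λ yz g xz e d yx → yz :+ g :+ ((yx :+ xz) :+ (e :+ (d :- g)))
                 := e :+ (yz :+ (xz :+ d :+ yx))) refl
       ℚ.∣ seq y n ℚ.- seq z n ∣ γ ℚ.∣ seq x n ℚ.- seq z n ∣ (seq e n) δ
       ℚ.∣ seq y n ℚ.- seq x n ∣))
  where
  r = p ℚ.+ δ ℚ.- q
  -- The bracket is shorter than δ by `r`. Half of this slack becomes the new margin, the other half
  -- keeps the closeness strict in `cl′`.
  γ = ½ ℚ.* r
  0<r : 0ℚ ℚ.< r
  0<r = lin< q<p+δ (solve 3 (λ p q d → con 0ℚ :+ (p :+ d) := p :+ d :- q :+ q) refl p q δ)
  0<γ : 0ℚ ℚ.< γ
  0<γ = ½*-pos 0<r
  cl′ : Close (δ ℚ.- γ) y x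
  cl′ = p , q , lin< 0<γ
      (trans (solve 2 (λ q g → q :+ g := q :- g :+ (g :+ g)) refl q γ)
        (trans (cong (q ℚ.- γ ℚ.+_) (½+½ r))
          (solve 4 (λ p q d g → q :- g :+ (p :+ d :- q) := p :+ (d :- g) :+ con 0ℚ)
            refl p q δ γ)))
    , proj₂ (proj₂ (proj₂ cl))
  N = proj₁ (close-∣∣ cl′)
  y≈ = proj₂ (close-∣∣ cl′)
  tri : ∀ x y z → ℚ.∣ y ℚ.- z ∣ ℚ.≤ ℚ.∣ y ℚ.- x ∣ ℚ.+ ℚ.∣ x ℚ.- z ∣
  tri x y z = subst (λ u → ℚ.∣ u ∣ ℚ.≤ ℚ.∣ y ℚ.- x ∣ ℚ.+ ℚ.∣ x ℚ.- z ∣)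
    (solve 3 (λ x y z → y :- x :+ (x :- z) := y :- z) refl x y z)
    (ℚ.∣p+q∣≤∣p∣+∣q∣ (y ℚ.- x) (x ℚ.- z))

∣x-x∣<ε : ∀ x {ε} → 0ℚ ℚ.< ε → ∣ x - x ∣ < fromℚ ε
∣x-x∣<ε x {ε} 0<ε = mk< (½ ℚ.* ε , ½*-pos 0<ε , 0 , λ n _ →
  lin< (½*-pos 0<ε) (trans (cong (λ e → e ℚ.+ ½ ℚ.* ε ℚ.+ ½ ℚ.* ε)
      (cong ℚ.∣_∣ (ℚ.+-inverseʳ (seq x n))))
    (trans (cong (ℚ._+ ½ ℚ.* ε) (ℚ.+-identityˡ (½ ℚ.* ε)))
      (trans (½+½ ε) (sym (ℚ.+-identityʳ ε))))))

gap-∣∣-> : ∀ c x y (lt : c < x) → ∣ y - x ∣ < fromℚ (proj₁ (gap lt)) → c < y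
gap-∣∣-> c x y (mk< (ε , 0<ε , M , c<x)) (mk< (δ , 0<δ , N , y≈x)) =
  mk< (δ , 0<δ , M ℕ.⊔ N , λ n le → lin<
    (ℚ.+-mono-< (c<x n (ℕ.m⊔n≤o⇒m≤o M N le))
      (∣p-q∣<r⇒q<p+r (seq y n) (seq x n) (lem n (ℕ.m⊔n≤o⇒n≤o M N le))))
    (solve 5 (λ c x y d e → c :+ d :+ (x :+ (y :+ (e :- d))) := y :+ (c :+ e :+ x)) refl
      (seq c n) (seq x n) (seq y n) δ ε))
  where
  lem : ∀ n → N ℕ.≤ n → ℚ.∣ seq y n ℚ.- seq x n ∣ ℚ.< ε ℚ.- δ
  lem n le = lin< (y≈x n le) (solve 3 (λ a d e → a :+ e := e :- d :+ (a :+ d)) refl ℚ.∣ seq y n ℚ.- seq x n ∣ δ ε)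

gap-∣∣-< : ∀ c x y (lt : x < c) → ∣ y - x ∣ < fromℚ (proj₁ (gap lt)) → y < c
gap-∣∣-< c x y (mk< (ε , 0<ε , M , x<c)) (mk< (δ , 0<δ , N , y≈x)) =
  mk< (δ , 0<δ , M ℕ.⊔ N , λ n le → lin<
    (ℚ.+-mono-< (x<c n (ℕ.m⊔n≤o⇒m≤o M N le))
      (∣p-q∣<r⇒p<q+r (seq y n) (seq x n) (lem n (ℕ.m⊔n≤o⇒n≤o M N le))))
    (solve 5 (λ c x y d e → y :+ d :+ (c :+ (x :+ (e :- d))) := c :+ (x :+ e :+ y)) refl
      (seq c n) (seq x n) (seq y n) δ ε))
  where
  lem : ∀ n → N ℕ.≤ n → ℚ.∣ seq y n ℚ.- seq x n ∣ ℚ.< ε ℚ.- δ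
  lem n le = lin< (y≈x n le) (solve 3 (λ a d e → a :+ e := e :- d :+ (a :+ d)) refl ℚ.∣ seq y n ℚ.- seq x n ∣ δ ε)

close-refl : ∀ x {δ} → 0ℚ ℚ.< δ → Close δ x x
close-refl x {δ} 0<δ = p , q , q<p+δ , (p≤x , x≤q) , (p≤x , x≤q)
  where
  d = ½ ℚ.* (½ ℚ.* δ)
  0<d = ½*-pos (½*-pos 0<δ)
  N = proj₁ (cauchy x d 0<d)
  near = proj₂ (cauchy x d 0<d)
  p = seq x N ℚ.- d
  q = seq x N ℚ.+ d
  q<p+δ : q ℚ.< p ℚ.+ δ
  q<p+δ = lin< (ℚ.+-mono-< 0<d 0<d)
    (trans (solve 2 (λ x d → x :+ d :+ (d :+ d) := x :- d :+ ((d :+ d) :+ (d :+ d))) refl (seq x N) d)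
      (trans (cong (p ℚ.+_) (trans (cong₂ ℚ._+_ (½+½ (½ ℚ.* δ)) (½+½ (½ ℚ.* δ))) (½+½ δ)))
        (solve 2 (λ p d → p :+ d := p :+ d :+ (con 0ℚ :+ con 0ℚ)) refl p δ)))
  p≤x : fromℚ p ≤ x
  p≤x = mk≤ λ ε 0<ε → N , λ n N≤n → lin<
    (ℚ.+-mono-< 0<ε (∣p-q∣<r⇒q<p+r (seq x n) (seq x N) (near n N N≤n ℕ.≤-refl)))
    (solve 4 (λ a b d e → b :- d :+ (e :+ (a :+ d)) := a :+ e :+ (con 0ℚ :+ b)) refl (seq x n) (seq x N) d ε)
  x≤q : x ≤ fromℚ q
  x≤q = mk≤ λ ε 0<ε → N , λ n N≤n → lin<
    (ℚ.+-mono-< 0<ε (∣p-q∣<r⇒p<q+r (seq x n) (seq x N) (near n N N≤n ℕ.≤-refl)))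
    (solve 4 (λ a b d e → a :+ (e :+ (b :+ d)) := b :+ d :+ e :+ (con 0ℚ :+ a)) refl (seq x n) (seq x N) d ε)

close-≃ : ∀ {x y δ} → 0ℚ ℚ.< δ → y ≃ x → Close δ y x
close-≃ {x} 0<δ y≃x =
  let p , q , q< , (p≤x , x≤q) , _ = close-refl x 0<δ
  in p , q , q< , (≤-trans p≤x (≤-reflexive (ℝₛ.sym y≃x)) , ≤-trans (≤-reflexive y≃x) x≤q) , (p≤x , x≤q)

-- Multiples and powers of ½

×ℚ-nonNeg : ∀ n {c} → 0ℚ ℚ.≤ c → 0ℚ ℚ.≤ n ×ℚ c
×ℚ-nonNeg zero    0≤c = ℚ.≤-refl
×ℚ-nonNeg (suc n) 0≤c = ℚ.+-mono-≤ 0≤c (×ℚ-nonNeg n 0≤c)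

×ℚ-monoˡ-≤ : ∀ {m n c} → 0ℚ ℚ.≤ c → m ℕ.≤ n → m ×ℚ c ℚ.≤ n ×ℚ c
×ℚ-monoˡ-≤ {n = n} 0≤c z≤n = ×ℚ-nonNeg n 0≤c
×ℚ-monoˡ-≤ {c = c} 0≤c (s≤s m≤n) = ℚ.+-monoʳ-≤ c (×ℚ-monoˡ-≤ 0≤c m≤n)

×ℚ-monoˡ-< : ∀ {m n c} → 0ℚ ℚ.< c → m ℕ.< n → m ×ℚ c ℚ.< n ×ℚ c
×ℚ-monoˡ-< {m} {c = c} 0<c m<n = ℚ.<-≤-trans
  (lin< 0<c (trans (ℚ.+-comm (m ×ℚ c) c) (sym (ℚ.+-identityʳ (c ℚ.+ m ×ℚ c)))))
  (×ℚ-monoˡ-≤ (ℚ.<⇒≤ 0<c) m<n)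

×ℚ-monoʳ-≤ : ∀ n {p q} → p ℚ.≤ q → n ×ℚ p ℚ.≤ n ×ℚ q
×ℚ-monoʳ-≤ zero    p≤q = ℚ.≤-refl
×ℚ-monoʳ-≤ (suc n) p≤q = ℚ.+-mono-≤ p≤q (×ℚ-monoʳ-≤ n p≤q)

×ℚ-*-assoc : ∀ n p q → n ×ℚ (p ℚ.* q) ≡ (n ×ℚ p) ℚ.* q
×ℚ-*-assoc zero    p q = sym (ℚ.*-zeroˡ q)
×ℚ-*-assoc (suc n) p q = trans (cong (p ℚ.* q ℚ.+_) (×ℚ-*-assoc n p q))
  (sym (ℚ.*-distribʳ-+ q p (n ×ℚ p)))

½^_ : ℕ → ℚ
½^ zero  = 1ℚ
½^ suc k = ½ ℚ.* ½^ k

½^-pos : ∀ k → 0ℚ ℚ.< ½^ k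
½^-pos zero    = ℚ.positive⁻¹ 1ℚ
½^-pos (suc k) = ½*-pos (½^-pos k)

½^-antitone : ∀ {j k} → j ℕ.≤ k → ½^ k ℚ.≤ ½^ j
½^-antitone {k = zero}  z≤n = ℚ.≤-refl
½^-antitone {k = suc k} z≤n = ℚ.≤-trans (½*-≤ (½^-pos k)) (½^-antitone {k = k} z≤n)
½^-antitone (s≤s j≤k) = ℚ.*-monoˡ-≤-nonNeg ½ (½^-antitone j≤k)

double : ∀ n q → (2 ℕ.* n) ×ℚ (½ ℚ.* q) ≡ n ×ℚ q
double n q = trans (cong (_×ℚ (½ ℚ.* q)) (ℕ.*-comm 2 n))
  (trans (sym (Mult.×-assocˡ (½ ℚ.* q) n 2))
    (cong (n ×ℚ_) (trans (cong (½ ℚ.* q ℚ.+_) (ℚ.+-identityʳ (½ ℚ.* q))) (½+½ q))))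

2^×½^ : ∀ k → (2 ℕ.^ k) ×ℚ ½^ k ≡ 1ℚ
2^×½^ zero    = refl
2^×½^ (suc k) = trans (double (2 ℕ.^ k) (½^ k)) (2^×½^ k)

toℚᵘ-×1 : ∀ n → toℚᵘ (n ×ℚ 1ℚ) ℚᵘ.≃ mkℚᵘ (+ n) 0
toℚᵘ-×1 zero    = ℚᵘ.≃-refl
toℚᵘ-×1 (suc n) = ℚᵘ.≃-trans (ℚ.toℚᵘ-homo-+ 1ℚ (n ×ℚ 1ℚ))
  (ℚᵘ.≃-trans (ℚᵘ.+-congʳ (toℚᵘ 1ℚ) (toℚᵘ-×1 n))
    (*≡* (cong (ℤ._* + 1) (cong (ℤ._+_ (+ 1)) (ℤ.*-identityʳ (+ n))))))

≤-×1 : ∀ q → ∃[ n ] q ℚ.≤ n ×ℚ 1ℚ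
≤-×1 q@(mkℚ n d _) = ℤ.∣ n ∣ , ℚ.toℚᵘ-cancel-≤
  (ℚᵘ.≤-respʳ-≃ (ℚᵘ.≃-sym (toℚᵘ-×1 ℤ.∣ n ∣)) (*≤* (bound n)))
  where
  bound : ∀ n → n ℤ.* + 1 ℤ.≤ + ℤ.∣ n ∣ ℤ.* + suc d
  bound (+ n) = ℤ.≤-trans (ℤ.≤-reflexive (sym (ℤ.pos-* n 1)))
    (ℤ.≤-trans (ℤ.+≤+ (ℕ.*-monoʳ-≤ n (s≤s z≤n))) (ℤ.≤-reflexive (ℤ.pos-* n (suc d))))
  bound -[1+ n ] = ℤ.-≤+

n<2^n : ∀ n → n ℕ.< 2 ℕ.^ n
n<2^n zero    = s≤s z≤n
n<2^n (suc n) = ℕ.≤-trans (ℕ.≤-reflexive (ℕ.+-comm 1 (suc n)))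
  (ℕ.+-mono-≤ (n<2^n n) (ℕ.≤-trans (ℕ.m^n>0 2 n) (ℕ.m≤m+n (2 ℕ.^ n) 0)))

abstract

  reciprocal : ∀ {q} → 0ℚ ℚ.< q → ∃[ r ] 0ℚ ℚ.< r × r ℚ.* q ≡ 1ℚ
  reciprocal {q} 0<q = ℚ.1/ q , ℚ.positive⁻¹ _ {{ℚ.1/pos⇒pos q}} , ℚ.*-inverseˡ q
    where instance
    _ : ℚ.Positive q
    _ = ℚ.positive 0<q
    _ : ℚ.NonZero q
    _ = ℚ.pos⇒nonZero q

-- An integer bound `n` of the reciprocal of ε serves as the exponent, because n < 2^n.
½^-archimedean : ∀ {ε} → 0ℚ ℚ.< ε → ∃[ k ] ½^ k ℚ.< ε
½^-archimedean {ε} 0<ε = n , ℚ.≰⇒> λ ε≤½^n → ℚ.<-irrefl refl (ℚ.<-≤-trans 1<2^n×ε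
  (ℚ.≤-trans (×ℚ-monoʳ-≤ (2 ℕ.^ n) ε≤½^n) (ℚ.≤-reflexive (2^×½^ n))))
  where
  r = proj₁ (reciprocal 0<ε)
  r*ε≡1 = proj₂ (proj₂ (reciprocal 0<ε))
  n = proj₁ (≤-×1 r)
  1≤n×ε : 1ℚ ℚ.≤ n ×ℚ ε
  1≤n×ε = subst₂ ℚ._≤_ r*ε≡1
    (trans (sym (×ℚ-*-assoc n 1ℚ ε)) (cong (n ×ℚ_) (ℚ.*-identityˡ ε)))
    (ℚ.*-monoʳ-≤-nonNeg ε {{ℚ.nonNegative (ℚ.<⇒≤ 0<ε)}} (proj₂ (≤-×1 r)))
  1<2^n×ε : 1ℚ ℚ.< (2 ℕ.^ n) ×ℚ ε
  1<2^n×ε = ℚ.≤-<-trans 1≤n×ε (×ℚ-monoˡ-< 0<ε (n<2^n n))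

abstract

  unit-fraction : ∀ n → ∃[ q ] 0ℚ ℚ.< q × suc n ×ℚ q ≡ 1ℚ
  unit-fraction n =
    let r , 0<r , eq = reciprocal (×ℚ-monoˡ-< {0} {suc n} (ℚ.positive⁻¹ 1ℚ) (s≤s z≤n))
    in r , 0<r , trans (cong (suc n ×ℚ_) (sym (ℚ.*-identityˡ r)))
         (trans (×ℚ-*-assoc (suc n) 1ℚ r) (trans (ℚ.*-comm (suc n ×ℚ 1ℚ) r) eq))

module Classical (em : ExcludedMiddle 0ℓ) where

  -- Points of the unit interval

  infix 4 _⊑_ _⊏_

  _⊑_ _⊏_ : I → I → Set
  x ⊑ y = proj₁ x ≤ proj₁ y
  x ⊏ y = proj₁ x < proj₁ y

  -- Truncation makes `⟦_⟧` total, so that grid points and nodes carry no proofs of their bounds.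
  clamp : ℚ → ℚ
  clamp q = 0ℚ ℚ.⊔ (q ℚ.⊓ 1ℚ)

  ⟦_⟧ : ℚ → I
  ⟦ q ⟧ = fromℚ (clamp q) ,
    fromℚ-mono-≤ (ℚ.p≤p⊔q 0ℚ (q ℚ.⊓ 1ℚ)) ,
    fromℚ-mono-≤ (ℚ.⊔-lub (ℚ.<⇒≤ (ℚ.positive⁻¹ 1ℚ)) (ℚ.p⊓q≤q q 1ℚ))

  clamp-id : ∀ {q} → 0ℚ ℚ.≤ q → q ℚ.≤ 1ℚ → clamp q ≡ q
  clamp-id 0≤q q≤1 =
    trans (cong (0ℚ ℚ.⊔_) (ℚ.p≤q⇒p⊓q≡p q≤1)) (ℚ.p≤q⇒p⊔q≡q 0≤q)

  ⟦⟧-mono-≤ : ∀ {p q} → p ℚ.≤ q → ⟦ p ⟧ ⊑ ⟦ q ⟧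
  ⟦⟧-mono-≤ p≤q = fromℚ-mono-≤ (ℚ.⊔-monoʳ-≤ 0ℚ (ℚ.⊓-monoˡ-≤ 1ℚ p≤q))

  ⟦⟧-mono-< : ∀ {p q} → 0ℚ ℚ.≤ p → p ℚ.< q → q ℚ.≤ 1ℚ → ⟦ p ⟧ ⊏ ⟦ q ⟧
  ⟦⟧-mono-< 0≤p p<q q≤1 = fromℚ-mono-< (subst₂ ℚ._<_
    (sym (clamp-id 0≤p (ℚ.≤-trans (ℚ.<⇒≤ p<q) q≤1)))
    (sym (clamp-id (ℚ.≤-trans 0≤p (ℚ.<⇒≤ p<q)) q≤1)) p<q)

  ⊏-dense : ∀ x y → x ⊏ y → ∃[ q ] x ⊏ ⟦ q ⟧ × ⟦ q ⟧ ⊏ y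
  ⊏-dense x y x<y =
    let q , x<q , q<y = dense x<y
        eq = clamp-id
          (ℚ.<⇒≤ (fromℚ-cancel-< (≤-<-trans (proj₁ (proj₂ x)) x<q)))
          (ℚ.<⇒≤ (fromℚ-cancel-< (<-≤-trans q<y (proj₂ (proj₂ y)))))
    in q , subst (λ p → proj₁ x < fromℚ p) (sym eq) x<q ,
       subst (λ p → fromℚ p < proj₁ y) (sym eq) q<y

  ≰⇒> : ∀ {x y} → ¬ (x ≤ y) → y < x
  ≰⇒> {x} {y} x≰y with em {y < x}
  ... | yes y<x = y<x
  ... | no  y≮x = contradiction (≮⇒≥ y≮x) x≰y

  ≤-or-> : ∀ x y → x ≤ y ⊎ y < x
  ≤-or-> x y with em {y < x}
  ... | yes y<x = inj₂ y<x
  ... | no  y≮x = inj₁ (≮⇒≥ y≮x)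

  -- The action of homeomorphisms on the order

  infixr 9 _·_

  _·_ : Homeo₊ → I → I
  f · x = Homeo₊.to f x

  ⁻¹-· : ∀ f x → proj₁ (f ⁻¹₊ · f · x) ≃ proj₁ x
  ⁻¹-· f x = Homeo₊.strictlyInverseʳ f x

  ·-⁻¹ : ∀ f x → proj₁ (f · f ⁻¹₊ · x) ≃ proj₁ x
  ·-⁻¹ f x = Homeo₊.strictlyInverseˡ f x

  mono-≤ : ∀ f x y → x ⊑ y → f · x ⊑ f · y
  mono-≤ = Homeo₊.monotone

  mono-< : ∀ f x y → x ⊏ y → f · x ⊏ f · y
  mono-< f x y x<y = ≰⇒> λ fy≤fx → <⇒≱ x<y
    (≤-trans (≤-reflexive (ℝₛ.sym (⁻¹-· f y)))
      (≤-trans (mono-≤ (f ⁻¹₊) (f · y) (f · x) fy≤fx) (≤-reflexive (⁻¹-· f x))))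

  <⇒⁻¹< : ∀ f c x → c ⊏ f · x → f ⁻¹₊ · c ⊏ x
  <⇒⁻¹< f c x c<fx =
    <-≤-trans (mono-< (f ⁻¹₊) c (f · x) c<fx) (≤-reflexive (⁻¹-· f x))

  ⁻¹<⇒< : ∀ f c x → f ⁻¹₊ · c ⊏ x → c ⊏ f · x
  ⁻¹<⇒< f c x lt =
    ≤-<-trans (≤-reflexive (ℝₛ.sym (·-⁻¹ f c))) (mono-< f (f ⁻¹₊ · c) x lt)

  <⁻¹⇒< : ∀ f c x → x ⊏ f ⁻¹₊ · c → f · x ⊏ c
  <⁻¹⇒< f c x lt = <-≤-trans (mono-< f x (f ⁻¹₊ · c) lt) (≤-reflexive (·-⁻¹ f c))

  <⇒<⁻¹ : ∀ f c x → f · x ⊏ c → x ⊏ f ⁻¹₊ · c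
  <⇒<⁻¹ f c x lt =
    ≤-<-trans (≤-reflexive (ℝₛ.sym (⁻¹-· f x))) (mono-< (f ⁻¹₊) (f · x) c lt)

  ≤⇒⁻¹≤ : ∀ f c x → c ⊑ f · x → f ⁻¹₊ · c ⊑ x
  ≤⇒⁻¹≤ f c x le =
    ≤-trans (mono-≤ (f ⁻¹₊) c (f · x) le) (≤-reflexive (⁻¹-· f x))

  ≤⇒≤⁻¹ : ∀ f c x → f · x ⊑ c → x ⊑ f ⁻¹₊ · c
  ≤⇒≤⁻¹ f c x le =
    ≤-trans (≤-reflexive (ℝₛ.sym (⁻¹-· f x))) (mono-≤ (f ⁻¹₊) (f · x) c le)

  -- Words in the free group on two generators

  Pair : Set
  Pair = Homeo₊ × Homeo₊

  infixl 7 _∙ʷ_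
  infix 8 _⁻¹ʷ

  -- Formal expressions rather than reduced words: a similarity matches the values of each
  -- expression at the two pairs, so no normal form is needed.
  data Word : Set where
    gen₁ gen₂ 1ʷ : Word
    _∙ʷ_ : Word → Word → Word
    _⁻¹ʷ : Word → Word

  eval : Pair → Word → Homeo₊
  eval (f , g) gen₁ = f
  eval (f , g) gen₂ = g
  eval G 1ʷ         = id₊
  eval G (v ∙ʷ w)   = eval G v ∘₊ eval G w
  eval G (w ⁻¹ʷ)    = eval G w ⁻¹₊

  -- Neighbourhoods in the topology of pointwise convergence

  U-≤ : ∀ {f g as δ ε} → δ ℚ.≤ ε → U f as (fromℚ δ) g → U f as (fromℚ ε) g
  U-≤ {f} {g} {δ = δ} {ε} δ≤ε = All.map λ {a} lt →
    <-≤-trans {∣ g ⟨$⟩ a - f ⟨$⟩ a ∣} {fromℚ δ} {fromℚ ε} lt (fromℚ-mono-≤ δ≤ε)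

  -- Abstract, since unification must not unfold inequalities of Cauchy sequences.
  abstract

    Near : Pair → List I → ℚ → Pred Pair 0ℓ
    Near (f , g) as ε (f′ , g′) = U f as (fromℚ ε) f′ × U g as (fromℚ ε) g′

    near⁺ : ∀ {f g as ε f′ g′} → U f as (fromℚ ε) f′ → U g as (fromℚ ε) g′ →
            Near (f , g) as ε (f′ , g′)
    near⁺ f≈ g≈ = f≈ , g≈

    near⁻ : ∀ {f g as ε f′ g′} → Near (f , g) as ε (f′ , g′) →
            U f as (fromℚ ε) f′ × U g as (fromℚ ε) g′
    near⁻ G≈ = G≈

    near-antitone : ∀ {G as bs δ ε G′} → bs ⊆ as → δ ℚ.≤ ε →
                    Near G as δ G′ → Near G bs ε G′
    near-antitone {f , g} {G′ = f′ , g′} bs⊆as δ≤ε (f≈ , g≈) =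
      U-≤ {f} {f′} δ≤ε (⊆.All-resp-⊇ bs⊆as f≈) , U-≤ {g} {g′} δ≤ε (⊆.All-resp-⊇ bs⊆as g≈)

  -- Both coordinates share one list of points and one rational radius, so neighbourhoods intersect
  -- by concatenation and minimum.
  record OpenAt (A : Pred Pair 0ℓ) (G : Pair) : Set where
    constructor openAt
    field
      points   : List I
      {radius} : ℚ
      0<radius : 0ℚ ℚ.< radius
      near     : ∀ G′ → Near G points radius G′ → A G′

  0<p⊓q : ∀ {p q} → 0ℚ ℚ.< p → 0ℚ ℚ.< q → 0ℚ ℚ.< p ℚ.⊓ q
  0<p⊓q {p} {q} 0<p 0<q with ℚ.⊓-sel p q
  ... | inj₁ eq = subst (0ℚ ℚ.<_) (sym eq) 0<p
  ... | inj₂ eq = subst (0ℚ ℚ.<_) (sym eq) 0<q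

  openAt-map : ∀ {A B G} → (∀ G′ → A G′ → B G′) → OpenAt A G → OpenAt B G
  openAt-map A⊆B (openAt as 0<ε near) = openAt as 0<ε λ G′ G≈ → A⊆B G′ (near G′ G≈)

  openAt-∩ : ∀ {A B G} → OpenAt A G → OpenAt B G → OpenAt (λ G′ → A G′ × B G′) G
  openAt-∩ (openAt as {δ} 0<δ near₁) (openAt bs {ε} 0<ε near₂) =
    openAt (as ++ bs) (0<p⊓q 0<δ 0<ε) λ G′ G≈ →
      near₁ G′ (near-antitone (⊆.xs⊆xs++ys as bs) (ℚ.p⊓q≤p δ ε) G≈) ,
      near₂ G′ (near-antitone (⊆.xs⊆ys++xs bs as) (ℚ.p⊓q≤q δ ε) G≈)

  openAt-All : ∀ {X : Set} {A : X → Pred Pair 0ℓ} {G xs} →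
               All (λ x → OpenAt (A x) G) xs → OpenAt (λ G′ → All (λ x → A x G′) xs) G
  openAt-All []       = openAt [] (ℚ.positive⁻¹ 1ℚ) λ _ _ → []
  openAt-All (o ∷ os) = openAt-map (λ _ (p , ps) → p ∷ ps) (openAt-∩ o (openAt-All os))

  fst-> : ∀ f g x c → c ⊏ f · x → OpenAt (λ G → c ⊏ proj₁ G · x) (f , g)
  fst-> f g x c lt = openAt (x ∷ []) (proj₁ (proj₂ (gap lt))) λ (f′ , g′) G≈ →
    gap-∣∣-> (proj₁ c) (f ⟨$⟩ x) (f′ ⟨$⟩ x) lt
      (All.head (proj₁ (near⁻ {f} {g} {x ∷ []} {proj₁ (gap lt)} {f′} {g′} G≈)))

  fst-< : ∀ f g x c → f · x ⊏ c → OpenAt (λ G → proj₁ G · x ⊏ c) (f , g)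
  fst-< f g x c lt = openAt (x ∷ []) (proj₁ (proj₂ (gap lt))) λ (f′ , g′) G≈ →
    gap-∣∣-< (proj₁ c) (f ⟨$⟩ x) (f′ ⟨$⟩ x) lt
      (All.head (proj₁ (near⁻ {f} {g} {x ∷ []} {proj₁ (gap lt)} {f′} {g′} G≈)))

  snd-> : ∀ f g x c → c ⊏ g · x → OpenAt (λ G → c ⊏ proj₂ G · x) (f , g)
  snd-> f g x c lt = openAt (x ∷ []) (proj₁ (proj₂ (gap lt))) λ (f′ , g′) G≈ →
    gap-∣∣-> (proj₁ c) (g ⟨$⟩ x) (g′ ⟨$⟩ x) lt
      (All.head (proj₂ (near⁻ {f} {g} {x ∷ []} {proj₁ (gap lt)} {f′} {g′} G≈)))

  snd-< : ∀ f g x c → g · x ⊏ c → OpenAt (λ G → proj₂ G · x ⊏ c) (f , g)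
  snd-< f g x c lt = openAt (x ∷ []) (proj₁ (proj₂ (gap lt))) λ (f′ , g′) G≈ →
    gap-∣∣-< (proj₁ c) (g ⟨$⟩ x) (g′ ⟨$⟩ x) lt
      (All.head (proj₂ (near⁻ {f} {g} {x ∷ []} {proj₁ (gap lt)} {f′} {g′} G≈)))

  -- For a product, a rational point is inserted between the image of `x` under the inner factor and
  -- the preimage of `c` under the outer one; it separates the condition into one on each factor at
  -- a fixed point. Inverses exchange the two directions, hence the mutual induction.
  eval-> : ∀ w G x c → c ⊏ eval G w · x → OpenAt (λ G′ → c ⊏ eval G′ w · x) G
  eval-< : ∀ w G x c → eval G w · x ⊏ c → OpenAt (λ G′ → eval G′ w · x ⊏ c) G

  eval-> gen₁ (f , g) x c lt = fst-> f g x c lt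
  eval-> gen₂ (f , g) x c lt = snd-> f g x c lt
  eval-> 1ʷ   G x c lt = openAt [] (ℚ.positive⁻¹ 1ℚ) λ _ _ → lt
  eval-> (v ∙ʷ w) G x c lt =
    let q , c<q , q<wx = ⊏-dense (eval G v ⁻¹₊ · c) (eval G w · x)
                           (<⇒⁻¹< (eval G v) c (eval G w · x) lt)
    in openAt-map
         (λ G′ (c<vq , q<wx′) → <-trans c<vq (mono-< (eval G′ v) ⟦ q ⟧ (eval G′ w · x) q<wx′))
         (openAt-∩ (eval-> v G ⟦ q ⟧ c (⁻¹<⇒< (eval G v) c ⟦ q ⟧ c<q))
                   (eval-> w G x ⟦ q ⟧ q<wx))
  eval-> (w ⁻¹ʷ) G x c lt =
    openAt-map (λ G′ → <⇒<⁻¹ (eval G′ w) x c) (eval-< w G c x (<⁻¹⇒< (eval G w) x c lt))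

  eval-< gen₁ (f , g) x c lt = fst-< f g x c lt
  eval-< gen₂ (f , g) x c lt = snd-< f g x c lt
  eval-< 1ʷ   G x c lt = openAt [] (ℚ.positive⁻¹ 1ℚ) λ _ _ → lt
  eval-< (v ∙ʷ w) G x c lt =
    let q , wx<q , q<c = ⊏-dense (eval G w · x) (eval G v ⁻¹₊ · c)
                           (<⇒<⁻¹ (eval G v) c (eval G w · x) lt)
    in openAt-map
         (λ G′ (vq<c , wx<q′) → <-trans (mono-< (eval G′ v) (eval G′ w · x) ⟦ q ⟧ wx<q′) vq<c)
         (openAt-∩ (eval-< v G ⟦ q ⟧ c (<⁻¹⇒< (eval G v) c ⟦ q ⟧ q<c))
                   (eval-< w G x ⟦ q ⟧ wx<q))
  eval-< (w ⁻¹ʷ) G x c lt =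
    openAt-map (λ G′ → <⇒⁻¹< (eval G′ w) x c) (eval-> w G c x (⁻¹<⇒< (eval G w) x c lt))

  -- Uniform closeness and nowhere density

  _≈[_]_ : Homeo₊ → ℚ → Homeo₊ → Set
  f ≈[ δ ] g = ∀ x → Close δ (f ⟨$⟩ x) (g ⟨$⟩ x)

  close-≤ : ∀ {δ ε x y} → δ ℚ.≤ ε → Close δ x y → Close ε x y
  close-≤ δ≤ε (p , q , q<p+δ , rest) =
    p , q , ℚ.<-≤-trans q<p+δ (ℚ.+-monoʳ-≤ p δ≤ε) , rest

  U-uniform : ∀ {f g as ε} → U f as ε g →
              ∃[ δ ] 0ℚ ℚ.< δ × (∀ h → h ≈[ δ ] g → U f as ε h)
  U-uniform []              = 1ℚ , ℚ.positive⁻¹ 1ℚ , λ _ _ → []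
  U-uniform {f} {g} {a ∷ _} {ε} (lt ∷ lts) =
    let δ , 0<δ , near = U-uniform {f} {g} lts
        γ = proj₁ (gap lt)
    in γ ℚ.⊓ δ , 0<p⊓q (proj₁ (proj₂ (gap lt))) 0<δ , λ h h≈g →
         gap-close (g ⟨$⟩ a) (h ⟨$⟩ a) (f ⟨$⟩ a) ε lt (close-≤ (ℚ.p⊓q≤p γ δ) (h≈g a)) ∷
         near h λ x → close-≤ (ℚ.p⊓q≤q γ δ) (h≈g x)

  H² : Space
  H² = H-space ×ₛ H-space

  U-centre : ∀ f as {ε} → 0ℚ ℚ.< ε → U f as (fromℚ ε) f
  U-centre f as 0<ε = All.universal (λ a → ∣x-x∣<ε (f ⟨$⟩ a) 0<ε) as

  ∉closure : ∀ {A f g} → OpenAt (λ G → ¬ A G) (f , g) → ¬ Space.Closure H² A (f , g)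
  ∉closure {A} {f} {g} (openAt as {ε} 0<ε avoid) fg∈Ā =
    let i = as , fromℚ ε , fromℚ-mono-< 0<ε
        (f′ , g′) , (f′∈ , g′∈) , f′g′∈A =
          fg∈Ā ((f , i) , (g , i)) (U-centre f as 0<ε , U-centre g as 0<ε)
    in avoid (f′ , g′) (near⁺ {f} {g} {as} {ε} {f′} {g′} f′∈ g′∈) f′g′∈A

  -- Uniform perturbations suffice, since a basic set contains a uniform ball around each of its
  -- points: by `U-uniform` the radius is the least of finitely many margins.
  nowhereDense : (A : Pred Pair 0ℓ) →
    (∀ f g δ → 0ℚ ℚ.< δ → ∃[ f′ ] ∃[ g′ ]
      f′ ≈[ δ ] f × g′ ≈[ δ ] g × OpenAt (λ G → ¬ A G) (f′ , g′)) →
    Space.NowhereDense H² A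
  nowhereDense A perturb (f , g)
    (((f₀ , as , α , _) , (g₀ , bs , β , _)) , (f∈ , g∈) , B⊆Ā) =
    let γ , 0<γ , near₁ = U-uniform {f₀} {f} {as} {α} f∈
        δ , 0<δ , near₂ = U-uniform {g₀} {g} {bs} {β} g∈
        f′ , g′ , f′≈f , g′≈g , avoid =
          perturb f g (γ ℚ.⊓ δ) (0<p⊓q 0<γ 0<δ)
    in ∉closure avoid (B⊆Ā (f′ , g′)
         ( near₁ f′ (λ x → close-≤ (ℚ.p⊓q≤p γ δ) (f′≈f x))
         , near₂ g′ (λ x → close-≤ (ℚ.p⊓q≤q γ δ) (g′≈g x))))

  -- Order conditions for being near the identity

  module Hₛ = Group H

  -- Conditions on order instead of distance: they are carried through conjugation exactly
  -- (`within-pullback`) and are open for every word (`within-open`).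
  Within : List (I × I) → Pred Homeo₊ 0ℓ
  Within ps h = All (λ (c , a) → c ⊏ h · a × h · c ⊏ a) ps

  Gaps : Pred (List (I × I)) 0ℓ
  Gaps = All (λ (c , a) → c ⊏ a)

  within-resp : ∀ h k ps → h Hₛ.≈ k → Within ps h → Within ps k
  within-resp h k []             h≈k []              = []
  within-resp h k ((c , a) ∷ ps) h≈k ((c< , <a) ∷ w) =
    (<-≤-trans c< (≤-reflexive (h≈k a)) ,
     ≤-<-trans (≤-reflexive (ℝₛ.sym (h≈k c))) <a) ∷ within-resp h k ps h≈k w

  within-basic : ∀ ps → Gaps ps →
    ∃[ as ] ∃[ ε ] 0ℚ ℚ.< ε × (∀ h → U id₊ as (fromℚ ε) h → Within ps h)
  within-basic []             []         = [] , 1ℚ , ℚ.positive⁻¹ 1ℚ , λ _ _ → []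
  within-basic ((c , a) ∷ ps) (lt ∷ lts) =
    let as , ε , 0<ε , inside = within-basic ps lts
        δ = proj₁ (gap lt)
    in c ∷ a ∷ as , δ ℚ.⊓ ε , 0<p⊓q (proj₁ (proj₂ (gap lt))) 0<ε , λ h h∈ →
         let h∈′ = U-≤ {id₊} {h} {c ∷ a ∷ as} (ℚ.p⊓q≤p δ ε) h∈
         in ( gap-∣∣-> (proj₁ c) (id₊ ⟨$⟩ a) (h ⟨$⟩ a) lt (All.head (All.tail h∈′))
            , gap-∣∣-< (proj₁ a) (id₊ ⟨$⟩ c) (h ⟨$⟩ c) lt (All.head h∈′))
            ∷ inside h (U-≤ {id₊} {h} {as} (ℚ.p⊓q≤q δ ε) (All.tail (All.tail h∈)))

  -- Dyadic neighbourhoods of the identity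

  grid : ℕ → ℕ → I
  grid n j = ⟦ j ×ℚ ½^ n ⟧

  dyadic : ℕ → List (I × I)
  dyadic n = applyUpTo (λ j → grid n j , grid n (suc j)) (2 ℕ.^ n)

  grid-mono : ∀ n {i j} → i ℕ.≤ j → grid n i ⊑ grid n j
  grid-mono n i≤j = ⟦⟧-mono-≤ (×ℚ-monoˡ-≤ (ℚ.<⇒≤ (½^-pos n)) i≤j)

  grid-≤ : ∀ n {j} → j ℕ.≤ 2 ℕ.^ n → j ×ℚ ½^ n ℚ.≤ 1ℚ
  grid-≤ n j≤ = ℚ.≤-trans (×ℚ-monoˡ-≤ (ℚ.<⇒≤ (½^-pos n)) j≤) (ℚ.≤-reflexive (2^×½^ n))

  grid-val : ∀ n {j} → j ℕ.≤ 2 ℕ.^ n → clamp (j ×ℚ ½^ n) ≡ j ×ℚ ½^ n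
  grid-val n {j} j≤ = clamp-id (×ℚ-nonNeg j (ℚ.<⇒≤ (½^-pos n))) (grid-≤ n j≤)

  grid-mono-< : ∀ n {i j} → i ℕ.< j → j ℕ.≤ 2 ℕ.^ n → grid n i ⊏ grid n j
  grid-mono-< n {i} i<j j≤ = ⟦⟧-mono-< (×ℚ-nonNeg i (ℚ.<⇒≤ (½^-pos n)))
    (×ℚ-monoˡ-< (½^-pos n) i<j) (grid-≤ n j≤)

  dyadic-gaps : ∀ n → Gaps (dyadic n)
  dyadic-gaps n = All.applyUpTo⁺₁ _ (2 ℕ.^ n) λ j< → grid-mono-< n (ℕ.n<1+n _) j<

  grid-top : ∀ n {j} (x : I) → 2 ℕ.^ n ℕ.≤ j → x ⊑ grid n j
  grid-top n {j} x le = ≤-trans (proj₂ (proj₂ x)) (fromℚ-mono-≤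
    (ℚ.≤-trans (ℚ.≤-reflexive (sym (ℚ.p≥q⇒p⊓q≡q
       (ℚ.≤-trans (ℚ.≤-reflexive (sym (2^×½^ n))) (×ℚ-monoˡ-≤ (ℚ.<⇒≤ (½^-pos n)) le)))))
     (ℚ.p≤q⊔p 0ℚ ((j ×ℚ ½^ n) ℚ.⊓ 1ℚ))))

  locate : (e : ℕ → I) (x : I) → e 0 ⊑ x → ∀ n → x ⊑ e (suc n) →
           ∃[ i ] i ℕ.≤ n × e i ⊑ x × x ⊑ e (suc i)
  locate e x e0≤x zero    x≤ = 0 , z≤n , e0≤x , x≤
  locate e x e0≤x (suc n) x≤ with ≤-or-> (proj₁ x) (proj₁ (e (suc n)))
  ... | inj₁ x≤′ = let i , i≤n , rest = locate e x e0≤x n x≤′ in i , ℕ.m≤n⇒m≤1+n i≤n , rest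
  ... | inj₂ e<x = suc n , ℕ.≤-refl , <⇒≤ e<x , x≤

  grid-0 : ∀ n x → grid n 0 ⊑ x
  grid-0 n x = proj₁ (proj₂ x)

  clamp-≤ : ∀ {q} → 0ℚ ℚ.≤ q → clamp q ℚ.≤ q
  clamp-≤ {q} 0≤q = ℚ.⊔-lub 0≤q (ℚ.p⊓q≤p q 1ℚ)

  suc-pred-2^ : ∀ n → suc (ℕ.pred (2 ℕ.^ n)) ≡ 2 ℕ.^ n
  suc-pred-2^ n = ℕ.suc-pred (2 ℕ.^ n) {{ℕ.m^n≢0 2 n}}

  locate-grid : ∀ n x → ∃[ j ] j ℕ.< 2 ℕ.^ n × grid n j ⊑ x × x ⊑ grid n (suc j)
  locate-grid n x =
    let j , j≤ , rest = locate (grid n) x (grid-0 n x) (ℕ.pred (2 ℕ.^ n))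
                          (grid-top n x (ℕ.≤-reflexive (sym (suc-pred-2^ n))))
    in j , ℕ.≤-trans (s≤s j≤) (ℕ.≤-reflexive (suc-pred-2^ n)) , rest

  -- A point of the j-th cell and its image both lie between the grid points j-1 and j+2. These are
  -- three meshes apart; the fourth makes the bound strict.
  dyadic-close : ∀ n h → Within (dyadic n) h → h ≈[ 4 ×ℚ ½^ n ] id₊
  dyadic-close n h w x = bracket (locate-grid n x)
    where
    c = ½^ n
    0≤c = ℚ.<⇒≤ (½^-pos n)
    rise : ∀ i → h · grid n i ⊑ grid n (suc i)
    rise i with i ℕ.<? 2 ℕ.^ n
    ... | yes i< = <⇒≤ (proj₂ (All.applyUpTo⁻ _ (2 ℕ.^ n) w i<))
    ... | no  i≮ = grid-top n (h · grid n i) (ℕ.m≤n⇒m≤1+n (ℕ.≮⇒≥ i≮))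
    width : ∀ i → suc (suc (suc i)) ×ℚ c ℚ.< i ×ℚ c ℚ.+ 4 ×ℚ c
    width i = lin< (½^-pos n)
      (solve 2 (λ c p → c :+ (c :+ (c :+ p)) :+ c
         := p :+ (c :+ (c :+ (c :+ (c :+ con 0ℚ)))) :+ con 0ℚ) refl c (i ×ℚ c))
    bracket : (∃[ j ] j ℕ.< 2 ℕ.^ n × grid n j ⊑ x × x ⊑ grid n (suc j)) →
              Close (4 ×ℚ c) (h ⟨$⟩ x) (id₊ ⟨$⟩ x)
    bracket (j , j< , j≤x , x≤) =
      -- For j = 0 the truncated predecessor gives the left end 0, below which there is no point.
      ℕ.pred j ×ℚ c , suc (suc j) ×ℚ c , thin j , (lower j j< j≤x , upper hx≤) ,
      (≤-trans (≤-trans (fromℚ-mono-≤ (×ℚ-monoˡ-≤ 0≤c (ℕ.pred[n]≤n {j})))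
         (≤-reflexive-fromℚ (sym (grid-val n (ℕ.<⇒≤ j<))))) j≤x ,
       upper (≤-trans x≤ (grid-mono n (ℕ.n≤1+n (suc j)))))
      where
      ≤-reflexive-fromℚ : ∀ {p q} → p ≡ q → fromℚ p ≤ fromℚ q
      ≤-reflexive-fromℚ eq = fromℚ-mono-≤ (ℚ.≤-reflexive eq)
      thin : ∀ j → suc (suc j) ×ℚ c ℚ.< ℕ.pred j ×ℚ c ℚ.+ 4 ×ℚ c
      thin zero    = ℚ.<-trans (×ℚ-monoˡ-< (½^-pos n) (ℕ.n<1+n 2)) (width 0)
      thin (suc i) = width i
      upper : ∀ {y} → y ≤ proj₁ (grid n (suc (suc j))) → y ≤ fromℚ (suc (suc j) ×ℚ c)
      upper y≤ = ≤-trans y≤ (fromℚ-mono-≤ (clamp-≤ (×ℚ-nonNeg (suc (suc j)) 0≤c)))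
      hx≤ : h · x ⊑ grid n (suc (suc j))
      hx≤ = ≤-trans (mono-≤ h x (grid n (suc j)) x≤) (rise (suc j))
      lower : ∀ j → j ℕ.< 2 ℕ.^ n → grid n j ⊑ x → fromℚ (ℕ.pred j ×ℚ c) ≤ proj₁ (h · x)
      lower zero    _  _  = proj₁ (proj₂ (h · x))
      lower (suc i) i< ≤x = ≤-trans (≤-reflexive-fromℚ (sym (grid-val n (ℕ.<⇒≤ (ℕ.<-trans (ℕ.n<1+n i) i<)))))
        (≤-trans (<⇒≤ (proj₁ (All.applyUpTo⁻ _ (2 ℕ.^ n) w (ℕ.<-trans (ℕ.n<1+n i) i<))))
          (mono-≤ h (grid n (suc i)) x ≤x))

  -- Continuous homomorphisms, tested at the identity

  member : ∀ X w → ⟨ proj₁ X , proj₂ X ⟩ (eval X w)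
  member X gen₁     = gen₁
  member X gen₂     = gen₂
  member X 1ʷ       = unit
  member X (v ∙ʷ w) = mult (member X v) (member X w)
  member X (w ⁻¹ʷ)  = inv (member X w)

  basic-dyadic : ∀ f as ε → U f as ε id₊ → ∃[ n ] ∀ h → Within (dyadic n) h → U f as ε h
  basic-dyadic f as ε id∈ =
    let δ , 0<δ , near = U-uniform {f} {id₊} {as} {ε} id∈
        n , ½^n< = ½^-archimedean (½*-pos (½*-pos 0<δ))
    in n , λ h w → near h λ x → close-≤ (4ε≤ δ n (ℚ.<⇒≤ ½^n<)) (dyadic-close n h w x)
    where
    4ε≤ : ∀ δ n → ½^ n ℚ.≤ ½ ℚ.* (½ ℚ.* δ) → 4 ×ℚ ½^ n ℚ.≤ δ
    4ε≤ δ n le = ℚ.≤-trans (×ℚ-monoʳ-≤ 4 le)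
      (ℚ.≤-reflexive (trans (double 2 (½ ℚ.* δ)) (trans (double 1 δ) (ℚ.+-identityʳ δ))))

  -- Only continuity at the identity is used. The statement is symmetric in form, so it serves both
  -- a similarity and its inverse.
  transfer : ∀ X Y (φ : Σ Homeo₊ ⟨ proj₁ X , proj₂ X ⟩ → Σ Homeo₊ ⟨ proj₁ Y , proj₂ Y ⟩) →
    Continuous (generatedSpace X) (generatedSpace Y) φ →
    (∀ w → proj₁ (φ (eval X w , member X w)) Hₛ.≈ eval Y w) →
    ∀ ps → Gaps ps →
    ∃[ n ] ∀ w → Within (dyadic n) (eval X w) → Within ps (eval Y w)
  transfer X Y φ φ-cont φ≈ ps gaps =
    let as , ε , 0<ε , inside = within-basic ps gaps
        φ1 = proj₁ (φ (id₊ , unit))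
        ((f , bs , β , _) , id∈ , ⊆U) = φ-cont (id₊ , as , fromℚ ε , fromℚ-mono-< 0<ε)
          (id₊ , unit)
          -- The image of the identity is the identity only up to `≃`, so its membership in the
          -- basic set is transported by `gap-close`.
          (All.universal (λ a → gap-close (id₊ ⟨$⟩ a) (φ1 ⟨$⟩ a) (id₊ ⟨$⟩ a) (fromℚ ε)
             (∣x-x∣<ε (id₊ ⟨$⟩ a) 0<ε)
             (close-≃ (proj₁ (proj₂ (gap (∣x-x∣<ε (id₊ ⟨$⟩ a) 0<ε)))) (φ≈ 1ʷ a))) as)
        n , near = basic-dyadic f bs β id∈
    in n , λ w w∈ → within-resp (proj₁ (φ (eval X w , member X w))) (eval Y w) ps (φ≈ w)
         (inside (proj₁ (φ (eval X w , member X w)))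
           (⊆U (eval X w , member X w) (near (eval X w) w∈)))

  -- Piecewise linear homeomorphisms

  module PiecewiseLinear where

    -- These properties let a rational map act term by term on Cauchy sequences; `modulus` is the
    -- form in which they are applied there.
    record Monotone-Lipschitz (φ : ℚ → ℚ) : Set where
      field
        mono : ∀ x y → x ℚ.≤ y → φ x ℚ.≤ φ y
        K    : ℚ
        0<K  : 0ℚ ℚ.< K
        lip  : ∀ x y → x ℚ.≤ y → φ y ℚ.≤ φ x ℚ.+ K ℚ.* (y ℚ.- x)

      modulus : ∀ ε → 0ℚ ℚ.< ε →
        ∃[ δ ] 0ℚ ℚ.< δ × (∀ x y → x ℚ.< y ℚ.+ δ → φ x ℚ.< φ y ℚ.+ ε)
      modulus ε 0<ε = r ℚ.* ε , 0<rε , bound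
        where
        r = proj₁ (reciprocal 0<K)
        0<rε : 0ℚ ℚ.< r ℚ.* ε
        0<rε = subst (ℚ._< r ℚ.* ε) (ℚ.*-zeroʳ r)
          (ℚ.*-monoʳ-<-pos r {{ℚ.positive (proj₁ (proj₂ (reciprocal 0<K)))}} 0<ε)
        Krε≡ε : K ℚ.* (r ℚ.* ε) ≡ ε
        Krε≡ε = trans (solve 3 (λ k r e → k :* (r :* e) := (r :* k) :* e) refl K r ε)
          (trans (cong (ℚ._* ε) (proj₂ (proj₂ (reciprocal 0<K)))) (ℚ.*-identityˡ ε))
        bound : ∀ x y → x ℚ.< y ℚ.+ r ℚ.* ε → φ x ℚ.< φ y ℚ.+ ε
        bound x y x<y+ with ℚ.≤-total x y
        ... | inj₁ x≤y = ℚ.≤-<-trans (mono x y x≤y) (p<p+q (φ y) 0<ε)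
        ... | inj₂ y≤x = ℚ.≤-<-trans (lip y x y≤x) (ℚ.+-monoʳ-< (φ y)
          (subst (K ℚ.* (x ℚ.- y) ℚ.<_) Krε≡ε (ℚ.*-monoʳ-<-pos K {{ℚ.positive 0<K}}
            (lin< x<y+ (solve 3 (λ x y d → x :- y :+ (y :+ d) := d :+ x) refl x y (r ℚ.* ε))))))

    open Monotone-Lipschitz

    record ℚ-Iso : Set where
      field
        to from  : ℚ → ℚ
        to-ml    : Monotone-Lipschitz to
        from-ml  : Monotone-Lipschitz from
        to∘from  : ∀ x → to (from x) ≡ x
        from∘to  : ∀ x → from (to x) ≡ x
        to-0     : to 0ℚ ≡ 0ℚ

      strict : ∀ {x y} → x ℚ.< y → to x ℚ.< to y
      strict {x} {y} x<y with to x ℚ.<? to y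
      ... | yes lt = lt
      ... | no  ≮  = contradiction (ℚ.<-≤-trans x<y
        (subst₂ ℚ._≤_ (from∘to y) (from∘to x) (mono from-ml (to y) (to x) (ℚ.≮⇒≥ ≮)))) (ℚ.<-irrefl refl)

    open ℚ-Iso

    id-ml : Monotone-Lipschitz (λ x → x)
    id-ml = record
      { mono = λ _ _ le → le
      ; K    = 1ℚ
      ; 0<K  = ℚ.positive⁻¹ 1ℚ
      ; lip  = λ x y _ → ℚ.≤-reflexive
          (solve 2 (λ x y → y := x :+ con 1ℚ :* (y :- x)) refl x y)
      }

    idℚ : ℚ-Iso
    idℚ = record
      { to = λ x → x ; from = λ x → x ; to-ml = id-ml ; from-ml = id-ml
      ; to∘from = λ _ → refl ; from∘to = λ _ → refl ; to-0 = refl }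

    ∘-ml : ∀ {φ ψ} → Monotone-Lipschitz φ → Monotone-Lipschitz ψ → Monotone-Lipschitz (λ x → φ (ψ x))
    ∘-ml {φ} {ψ} Φ Ψ = record
      { mono = λ x y le → mono Φ (ψ x) (ψ y) (mono Ψ x y le)
      ; K    = K Φ ℚ.* K Ψ
      ; 0<K  = subst (ℚ._< K Φ ℚ.* K Ψ) (ℚ.*-zeroʳ (K Φ)) (ℚ.*-monoʳ-<-pos (K Φ) {{ℚ.positive (0<K Φ)}} (0<K Ψ))
      ; lip  = λ x y le → ℚ.≤-trans (lip Φ (ψ x) (ψ y) (mono Ψ x y le))
          (ℚ.+-monoʳ-≤ (φ (ψ x)) (ℚ.≤-trans
            (ℚ.*-monoˡ-≤-nonNeg (K Φ) {{ℚ.nonNegative (ℚ.<⇒≤ (0<K Φ))}}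
              (lin≤ (lip Ψ x y le)
                (solve 3 (λ a b c → b :- a :+ (a :+ c) := c :+ b) refl (ψ x) (ψ y) (K Ψ ℚ.* (y ℚ.- x)))))
            (ℚ.≤-reflexive (sym (ℚ.*-assoc (K Φ) (K Ψ) (y ℚ.- x))))))
      }

    _∘ℚ_ : ℚ-Iso → ℚ-Iso → ℚ-Iso
    Φ ∘ℚ Ψ = record
      { to = λ x → to Φ (to Ψ x) ; from = λ x → from Ψ (from Φ x)
      ; to-ml = ∘-ml (to-ml Φ) (to-ml Ψ) ; from-ml = ∘-ml (from-ml Ψ) (from-ml Φ)
      ; to∘from = λ x → trans (cong (to Φ) (to∘from Ψ (from Φ x))) (to∘from Φ x)
      ; from∘to = λ x → trans (cong (from Ψ) (from∘to Φ (to Ψ x))) (from∘to Ψ x)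
      ; to-0 = trans (cong (to Φ) (to-0 Ψ)) (to-0 Φ) }

    -- Rational maps with prescribed values

    bend : ℚ → ℚ → ℚ → ℚ
    bend p s x with x ℚ.≤? p
    ... | yes _ = x
    ... | no  _ = p ℚ.+ s ℚ.* (x ℚ.- p)

    bend-≤ : ∀ p s {x} → x ℚ.≤ p → bend p s x ≡ x
    bend-≤ p s {x} x≤p with x ℚ.≤? p
    ... | yes _   = refl
    ... | no  x≰p = contradiction x≤p x≰p

    bend-> : ∀ p s {x} → p ℚ.< x → bend p s x ≡ p ℚ.+ s ℚ.* (x ℚ.- p)
    bend-> p s {x} p<x with x ℚ.≤? p
    ... | yes x≤p = contradiction (ℚ.<-≤-trans p<x x≤p) (ℚ.<-irrefl refl)
    ... | no  _   = refl

    bend-ml : ∀ p {s} → 0ℚ ℚ.< s → Monotone-Lipschitz (bend p s)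
    bend-ml p {s} 0<s = record
      -- The sum 1 + s bounds both slopes, 1 and s, without a case distinction.
      { mono = monotone ; K = 1ℚ ℚ.+ s ; 0<K = ℚ.+-mono-< (ℚ.positive⁻¹ 1ℚ) 0<s ; lip = lipschitz }
      where
      0≤s = ℚ.<⇒≤ 0<s
      monotone : ∀ x y → x ℚ.≤ y → bend p s x ℚ.≤ bend p s y
      monotone x y x≤y with x ℚ.≤? p | y ℚ.≤? p
      ... | yes _   | yes _   = x≤y
      ... | yes x≤p | no  y≰p = ℚ.≤-trans x≤p
        (lin≤ (0≤*0≤ 0≤s (p≤q⇒0≤q-p (ℚ.<⇒≤ (ℚ.≰⇒> y≰p))))
          (sym (ℚ.+-identityʳ (p ℚ.+ s ℚ.* (y ℚ.- p)))))
      ... | no  x≰p | yes y≤p = contradiction (ℚ.≤-trans x≤y y≤p) x≰p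
      ... | no  x≰p | no  y≰p = ℚ.+-monoʳ-≤ p (ℚ.*-monoˡ-≤-nonNeg s {{ℚ.nonNegative 0≤s}}
        (ℚ.+-monoˡ-≤ (ℚ.- p) x≤y))
      lipschitz : ∀ x y → x ℚ.≤ y → bend p s y ℚ.≤ bend p s x ℚ.+ (1ℚ ℚ.+ s) ℚ.* (y ℚ.- x)
      lipschitz x y x≤y with x ℚ.≤? p | y ℚ.≤? p
      ... | yes _   | yes _   = lin≤ (0≤*0≤ 0≤s (p≤q⇒0≤q-p x≤y))
        (solve 3 (λ x y s → y :+ s :* (y :- x)
                    := x :+ (con 1ℚ :+ s) :* (y :- x) :+ con 0ℚ) refl x y s)
      ... | yes x≤p | no  y≰p = lin≤
        (ℚ.+-mono-≤ (p≤q⇒0≤q-p (ℚ.<⇒≤ (ℚ.≰⇒> y≰p))) (0≤*0≤ 0≤s (p≤q⇒0≤q-p x≤p)))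
        (solve 4 (λ x y s p → p :+ s :* (y :- p) :+ (y :- p :+ s :* (p :- x))
                    := x :+ (con 1ℚ :+ s) :* (y :- x) :+ (con 0ℚ :+ con 0ℚ)) refl x y s p)
      ... | no  x≰p | yes y≤p = contradiction (ℚ.≤-trans x≤y y≤p) x≰p
      ... | no  x≰p | no  y≰p = lin≤ (p≤q⇒0≤q-p x≤y)
        (solve 4 (λ x y s p → p :+ s :* (y :- p) :+ (y :- x)
                    := p :+ s :* (x :- p) :+ (con 1ℚ :+ s) :* (y :- x) :+ con 0ℚ) refl x y s p)

    bend∘bend : ∀ p {s r} → 0ℚ ℚ.< s → r ℚ.* s ≡ 1ℚ → ∀ x → bend p r (bend p s x) ≡ x
    bend∘bend p {s} {r} 0<s rs≡1 x with x ℚ.≤? p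
    ... | yes x≤p = bend-≤ p r x≤p
    ... | no  x≰p = trans
      (bend-> p r {p ℚ.+ s ℚ.* (x ℚ.- p)} (lin< (0<*0< 0<s (p<q⇒0<q-p (ℚ.≰⇒> x≰p)))
        (sym (ℚ.+-identityʳ (p ℚ.+ s ℚ.* (x ℚ.- p))))))
      (trans (solve 4 (λ x s p r → p :+ r :* (p :+ s :* (x :- p) :- p) := p :+ (r :* s) :* (x :- p)) refl x s p r)
        (trans (cong (λ t → p ℚ.+ t ℚ.* (x ℚ.- p)) rs≡1)
          (solve 2 (λ x p → p :+ con 1ℚ :* (x :- p) := x) refl x p)))

    -- Bending after Φ at height `p` with slope (v - p) / (Φ x - p) corrects the value at `x` and
    -- leaves all values up to `p` alone.
    extend : ∀ Φ p x v → 0ℚ ℚ.≤ p → p ℚ.< to Φ x → p ℚ.< v →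
             ∃[ Ψ ] (∀ u → to Φ u ℚ.≤ p → to Ψ u ≡ to Φ u) × to Ψ x ≡ v
    extend Φ p x v 0≤p p<φx p<v =
      (record { to = bend p s ; from = bend p r ; to-ml = bend-ml p 0<s ; from-ml = bend-ml p 0<r
              ; to∘from = bend∘bend p 0<r (trans (ℚ.*-comm s r) rs≡1)
              ; from∘to = bend∘bend p 0<s rs≡1
              ; to-0 = bend-≤ p s 0≤p }) ∘ℚ Φ ,
      (λ u → bend-≤ p s) ,
      trans (bend-> p s p<φx)
        (trans (cong (p ℚ.+_) (trans (ℚ.*-assoc (v ℚ.- p) t (to Φ x ℚ.- p))
                  (trans (cong ((v ℚ.- p) ℚ.*_) ta≡1) (ℚ.*-identityʳ (v ℚ.- p)))))
          (solve 2 (λ p v → p :+ (v :- p) := v) refl p v))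
      where
      0<a = p<q⇒0<q-p p<φx
      0<b = p<q⇒0<q-p p<v
      t = proj₁ (reciprocal 0<a)
      ta≡1 = proj₂ (proj₂ (reciprocal 0<a))
      s = (v ℚ.- p) ℚ.* t
      0<s : 0ℚ ℚ.< s
      0<s = 0<*0< 0<b (proj₁ (proj₂ (reciprocal 0<a)))
      r = proj₁ (reciprocal 0<s)
      0<r = proj₁ (proj₂ (reciprocal 0<s))
      rs≡1 = proj₂ (proj₂ (reciprocal 0<s))

    ≤-suc-elim : ∀ {n} {P : ℕ → Set} → (∀ i → i ℕ.≤ n → P i) → P (suc n) →
                 ∀ i → i ℕ.≤ suc n → P i
    ≤-suc-elim {P = P} old new i i≤ with ℕ.m≤n⇒m<n∨m≡n i≤
    ... | inj₁ (s≤s i≤n) = old i i≤n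
    ... | inj₂ i≡        = subst P (sym i≡) new

    -- Each induction step bends above the last value `v n`, so the nodes treated before keep their
    -- values. The final component is carried along to verify this.
    interpolateℚ : (y v : ℕ → ℚ) → 0ℚ ℚ.≤ v 0 → y 0 ≡ v 0 → ∀ n →
      (∀ i → i ℕ.< n → y i ℚ.< y (suc i)) → (∀ i → i ℕ.< n → v i ℚ.< v (suc i)) →
      ∃[ Φ ] (∀ i → i ℕ.≤ n → to Φ (y i) ≡ v i) × (∀ u → u ℚ.≤ v 0 → to Φ u ≡ u) ×
             (∀ i → i ℕ.≤ n → v i ℚ.≤ v n)
    interpolateℚ y v 0≤v y₀≡v₀ zero y< v< =
      idℚ , (λ { zero z≤n → y₀≡v₀ }) , (λ _ _ → refl) , λ { zero z≤n → ℚ.≤-refl }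
    interpolateℚ y v 0≤v y₀≡v₀ (suc n) y< v< =
      let Φ , hits , fixes , v≤ = interpolateℚ y v 0≤v y₀≡v₀ n
            (λ i i<n → y< i (ℕ.m<n⇒m<1+n i<n)) (λ i i<n → v< i (ℕ.m<n⇒m<1+n i<n))
          Ψ , agrees , hit = extend Φ (v n) (y (suc n)) (v (suc n))
            (ℚ.≤-trans 0≤v (v≤ 0 z≤n))
            (subst (ℚ._< to Φ (y (suc n))) (hits n ℕ.≤-refl) (strict Φ (y< n ℕ.≤-refl)))
            (v< n ℕ.≤-refl)
      in Ψ ,
         ≤-suc-elim (λ i i≤n → trans
           (agrees (y i) (ℚ.≤-trans (ℚ.≤-reflexive (hits i i≤n)) (v≤ i i≤n))) (hits i i≤n)) hit ,
         (λ u u≤ → trans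
           (agrees u (ℚ.≤-trans (ℚ.≤-reflexive (fixes u u≤)) (ℚ.≤-trans u≤ (v≤ 0 z≤n)))) (fixes u u≤)) ,
         ≤-suc-elim (λ i i≤n → ℚ.≤-trans (v≤ i i≤n) (ℚ.<⇒≤ (v< n ℕ.≤-refl))) ℚ.≤-refl

    -- From rational maps to homeomorphisms of the interval

    liftℝ : ∀ {φ} → Monotone-Lipschitz φ → ℝ → ℝ
    liftℝ {φ} Φ x = mkℝ (λ n → φ (seq x n)) λ ε 0<ε →
      let δ , 0<δ , shift = modulus Φ ε 0<ε
          N , near = cauchy x δ 0<δ
      in N , λ m n N≤m N≤n → p<q+r∧q<p+r⇒∣p-q∣<r
           (shift (seq x m) (seq x n) (∣p-q∣<r⇒p<q+r (seq x m) (seq x n) (near m n N≤m N≤n)))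
           (shift (seq x n) (seq x m) (∣p-q∣<r⇒q<p+r (seq x m) (seq x n) (near m n N≤m N≤n)))

    liftℝ-mono : ∀ {φ} (Φ : Monotone-Lipschitz φ) {x y} → x ≤ y → liftℝ Φ x ≤ liftℝ Φ y
    liftℝ-mono Φ {x} {y} x≤y = mk≤ λ ε 0<ε →
      let δ , 0<δ , shift = modulus Φ ε 0<ε
          N , x<y+δ = at≤ x≤y δ 0<δ
      in N , λ n N≤n → shift (seq x n) (seq y n) (x<y+δ n N≤n)

    -- The preimage of an open interval is the open interval between the preimages of its ends.
    inverse-monotone⇒continuous : (to from : I → I) →
      (∀ x y → x ⊑ y → to x ⊑ to y) → (∀ x y → x ⊑ y → from x ⊑ from y) →
      (∀ x → proj₁ (to (from x)) ≃ proj₁ x) → (∀ x → proj₁ (from (to x)) ≃ proj₁ x) →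
      Continuous [0,1] [0,1] to
    inverse-monotone⇒continuous to from to-mono from-mono to∘from from∘to (a , b) x (a<tx , tx<b) =
      let a′ , a′<x , above = lower
          b′ , x<b′ , below = upper
      in (a′ , b′) , (a′<x , x<b′) , λ y (a′<y , y<b′) → above y a′<y , below y y<b′
      where
      lower : ∃[ a′ ] a′ < proj₁ x × (∀ y → a′ < proj₁ y → a < proj₁ (to y))
      lower with ≤-or-> 0ℝ a
      -- An end outside [0,1] imposes no condition and has no preimage; any number below 0 replaces
      -- it, and likewise 2 on the right.
      ... | inj₂ a<0 = fromℚ (ℚ.- 1ℚ) ,
        <-≤-trans (fromℚ-mono-< (ℚ.negative⁻¹ (ℚ.- 1ℚ))) (proj₁ (proj₂ x)) ,
        λ y _ → <-≤-trans a<0 (proj₁ (proj₂ (to y)))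
      ... | inj₁ 0≤a = proj₁ (from c) ,
        ≰⇒> (λ x≤fc → <⇒≱ a<tx (≤-trans (to-mono x (from c) x≤fc) (≤-reflexive (to∘from c)))) ,
        λ y fc<y → ≰⇒> λ ty≤a → <⇒≱ fc<y (≤-trans (≥-of-≃ (from∘to y)) (from-mono (to y) c ty≤a))
        where
        c : I
        c = a , 0≤a , <⇒≤ (<-≤-trans a<tx (proj₂ (proj₂ (to x))))
      upper : ∃[ b′ ] proj₁ x < b′ × (∀ y → proj₁ y < b′ → proj₁ (to y) < b)
      upper with ≤-or-> b 1ℝ
      ... | inj₂ 1<b = fromℚ (1ℚ ℚ.+ 1ℚ) ,
        ≤-<-trans (proj₂ (proj₂ x)) (fromℚ-mono-< (p<p+q 1ℚ (ℚ.positive⁻¹ 1ℚ))) ,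
        λ y _ → ≤-<-trans (proj₂ (proj₂ (to y))) 1<b
      ... | inj₁ b≤1 = proj₁ (from c) ,
        ≰⇒> (λ fc≤x → <⇒≱ tx<b (≤-trans (≥-of-≃ (to∘from c)) (to-mono (from c) x fc≤x))) ,
        λ y y<fc → ≰⇒> λ b≤ty → <⇒≱ y<fc (≤-trans (from-mono c (to y) b≤ty) (≤-reflexive (from∘to y)))
        where
        c : I
        c = b , <⇒≤ (≤-<-trans (proj₁ (proj₂ (to x))) tx<b) , b≤1

    liftI : ∀ {φ} → Monotone-Lipschitz φ → φ 0ℚ ≡ 0ℚ → φ 1ℚ ≡ 1ℚ → I → I
    liftI Φ φ0 φ1 (x , 0≤x , x≤1) = liftℝ Φ x ,
      ≤-trans (≤-reflexive (seq≡⇒≃ λ _ → sym φ0)) (liftℝ-mono Φ 0≤x) ,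
      ≤-trans (liftℝ-mono Φ x≤1) (≤-reflexive (seq≡⇒≃ λ _ → φ1))

    lift-homeo : (Φ : ℚ-Iso) → to Φ 1ℚ ≡ 1ℚ → Homeo₊
    lift-homeo Φ φ1 = record
      { homeomorphism = record
        { inverse = record
          { to        = F
          ; from      = G
          ; to-cong   = λ {x} {y} → F-cong x y
          ; from-cong = λ {x} {y} → G-cong x y
          ; inverse   = (λ {x} {y} y≃ → ℝₛ.trans (F-cong y (G x) y≃) (F∘G x))
                      , (λ {x} {y} y≃ → ℝₛ.trans (G-cong y (F x) y≃) (G∘F x))
          }
        ; to-continuous   = inverse-monotone⇒continuous F G F-mono G-mono F∘G G∘F
        ; from-continuous = inverse-monotone⇒continuous G F G-mono F-mono G∘F F∘G
        }
      ; monotone = F-mono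
      }
      where
      F G : I → I
      F = liftI (to-ml Φ) (to-0 Φ) φ1
      G = liftI (from-ml Φ) (trans (cong (from Φ) (sym (to-0 Φ))) (from∘to Φ 0ℚ))
                            (trans (cong (from Φ) (sym φ1)) (from∘to Φ 1ℚ))
      F-mono : ∀ x y → x ⊑ y → F x ⊑ F y
      F-mono _ _ = liftℝ-mono (to-ml Φ)
      G-mono : ∀ x y → x ⊑ y → G x ⊑ G y
      G-mono _ _ = liftℝ-mono (from-ml Φ)
      F-cong : ∀ x y → proj₁ x ≃ proj₁ y → proj₁ (F x) ≃ proj₁ (F y)
      F-cong x y eq = ≤-antisym (F-mono x y (≤-reflexive eq)) (F-mono y x (≥-of-≃ eq))
      G-cong : ∀ x y → proj₁ x ≃ proj₁ y → proj₁ (G x) ≃ proj₁ (G y)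
      G-cong x y eq = ≤-antisym (G-mono x y (≤-reflexive eq)) (G-mono y x (≥-of-≃ eq))
      F∘G : ∀ x → proj₁ (F (G x)) ≃ proj₁ x
      F∘G x = seq≡⇒≃ λ n → to∘from Φ (seq (proj₁ x) n)
      G∘F : ∀ x → proj₁ (G (F x)) ≃ proj₁ x
      G∘F x = seq≡⇒≃ λ n → from∘to Φ (seq (proj₁ x) n)

    clamp-comm : ∀ Φ → to Φ 1ℚ ≡ 1ℚ → ∀ q → to Φ (clamp q) ≡ clamp (to Φ q)
    clamp-comm Φ φ1 q =
      trans (ℚ.mono-≤-distrib-⊔ (mono (to-ml Φ) _ _) 0ℚ (q ℚ.⊓ 1ℚ))
        (cong₂ ℚ._⊔_ (to-0 Φ)
          (trans (ℚ.mono-≤-distrib-⊓ (mono (to-ml Φ) _ _) q 1ℚ) (cong (to Φ q ℚ.⊓_) φ1)))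

    lift-at : ∀ Φ φ1 q → lift-homeo Φ φ1 ⟨$⟩ ⟦ q ⟧ ≃ proj₁ ⟦ to Φ q ⟧
    lift-at Φ φ1 q =
      seq≡⇒≃ {lift-homeo Φ φ1 ⟨$⟩ ⟦ q ⟧} {proj₁ ⟦ to Φ q ⟧} λ _ → clamp-comm Φ φ1 q

    lift-hits : ∀ Φ φ1 p q → to Φ p ≡ q → lift-homeo Φ φ1 ⟨$⟩ ⟦ p ⟧ ≃ proj₁ ⟦ q ⟧
    lift-hits Φ φ1 p q refl = lift-at Φ φ1 p

    -- A rational point strictly between `x` and its image would be fixed, against monotonicity.
    fixes-rationals : ∀ f p → (∀ q → q ℚ.≤ p → f ⟨$⟩ ⟦ q ⟧ ≃ proj₁ ⟦ q ⟧) →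
                      ∀ x → x ⊑ ⟦ p ⟧ → f ⟨$⟩ x ≃ proj₁ x
    fixes-rationals f p fix x x≤p = ≤-antisym (≮⇒≥ λ x<fx → above x<fx) (≮⇒≥ λ fx<x → below fx<x)
      where
      fx≤p : f · x ⊑ ⟦ p ⟧
      fx≤p = ≤-trans (mono-≤ f x ⟦ p ⟧ x≤p) (≤-reflexive (fix p ℚ.≤-refl))
      small : ∀ q y → ⟦ q ⟧ ⊏ y → y ⊑ ⟦ p ⟧ → q ℚ.≤ p
      small q y q<y y≤p = ℚ.≮⇒≥ λ p<q →
        <⇒≱ q<y (≤-trans y≤p (⟦⟧-mono-≤ (ℚ.<⇒≤ p<q)))
      above : ¬ (x ⊏ f · x)
      above x<fx =
        let q , x<q , q<fx = ⊏-dense x (f · x) x<fx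
        in <⇒≱ q<fx (≤-trans (mono-≤ f x ⟦ q ⟧ (<⇒≤ x<q))
             (≤-reflexive (fix q (small q (f · x) q<fx fx≤p))))
      below : ¬ (f · x ⊏ x)
      below fx<x =
        let q , fx<q , q<x = ⊏-dense (f · x) x fx<x
        in <⇒≱ fx<q (≤-trans (≥-of-≃ (fix q (small q x q<x x≤p))) (mono-≤ f ⟦ q ⟧ x (<⇒≤ q<x)))

    interpolate : (y v : ℕ → ℚ) → 0ℚ ℚ.≤ v 0 → y 0 ≡ v 0 → ∀ n →
      (∀ i → i ℕ.< n → y i ℚ.< y (suc i)) → (∀ i → i ℕ.< n → v i ℚ.< v (suc i)) →
      y n ℚ.< 1ℚ → v n ℚ.< 1ℚ →
      ∃[ f ] (∀ i → i ℕ.≤ n → f ⟨$⟩ ⟦ y i ⟧ ≃ proj₁ ⟦ v i ⟧) ×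
             (∀ x → x ⊑ ⟦ v 0 ⟧ → f ⟨$⟩ x ≃ proj₁ x)
    interpolate y v 0≤v y₀≡v₀ n y< v< yₙ<1 vₙ<1 =
      lift-homeo Ψ hit ,
      (λ i i≤n → lift-hits Ψ hit (y i) (v i)
        (trans (agrees (y i) (ℚ.≤-trans (ℚ.≤-reflexive (hits i i≤n)) (v≤ i i≤n))) (hits i i≤n))) ,
      fixes-rationals (lift-homeo Ψ hit) (v 0) λ q q≤ → lift-hits Ψ hit q q
        (trans (agrees q (ℚ.≤-trans (ℚ.≤-reflexive (fixes q q≤)) (ℚ.≤-trans q≤ (v≤ 0 z≤n)))) (fixes q q≤))
      where
      step₁ = interpolateℚ y v 0≤v y₀≡v₀ n y< v<
      Φ = proj₁ step₁
      hits = proj₁ (proj₂ step₁)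
      fixes = proj₁ (proj₂ (proj₂ step₁))
      v≤ = proj₂ (proj₂ (proj₂ step₁))
      -- One more bend above the last value sends 1 to 1; this is why the last node and the last
      -- value must lie below 1.
      step₂ = extend Φ (v n) 1ℚ 1ℚ (ℚ.≤-trans 0≤v (v≤ 0 z≤n))
        (subst (ℚ._< to Φ 1ℚ) (hits n ℕ.≤-refl) (strict Φ yₙ<1)) vₙ<1
      Ψ = proj₁ step₂
      agrees = proj₁ (proj₂ step₂)
      hit = proj₂ (proj₂ step₂)

  open PiecewiseLinear using (interpolate)

  -- Homeomorphisms that are prescribed on blocks of nodes

  -- The i-th entry is the index of the cell that receives node o + i. The offset `o` is 1 for f and
  -- 0 for g, which makes the two systems of blocks interlock.
  blockwise : ℕ → (ℕ → ℕ) → ℕ → ℕ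
  blockwise o A zero    = o
  blockwise o A (suc i) = o ℕ.+ (A ⌊ i /2⌋ ℕ.+ A ⌊ i /2⌋)

  -- The grid of mesh 2⁻⁽ᵏ⁺¹⁾ whose first cell is cut into 2s + 1 cells.  Each
  -- cell is further cut into Q cells, whose endpoints serve as values of the
  -- homeomorphisms.

  module Nodes (k s : ℕ) where

    c = ½^ suc k
    K = s ℕ.+ 2 ℕ.^ k
    P = K ℕ.+ K
    Q = suc P
    R = suc (s ℕ.+ s) ℕ.* Q

    -- As `unit-fraction n` yields 1 / (n + 1), these are c / R and c / Q: the fine mesh inside the
    -- first cell and beyond it.
    α β : ℚ
    α = proj₁ (unit-fraction (P ℕ.+ (s ℕ.+ s) ℕ.* Q)) ℚ.* c
    β = proj₁ (unit-fraction P) ℚ.* c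

    0<α : 0ℚ ℚ.< α
    0<α = 0<*0< (proj₁ (proj₂ (unit-fraction (P ℕ.+ (s ℕ.+ s) ℕ.* Q)))) (½^-pos (suc k))

    0<β : 0ℚ ℚ.< β
    0<β = 0<*0< (proj₁ (proj₂ (unit-fraction P))) (½^-pos (suc k))

    R×α : R ×ℚ α ≡ c
    R×α = let q , _ , eq = unit-fraction (P ℕ.+ (s ℕ.+ s) ℕ.* Q) in
      trans (×ℚ-*-assoc R q c) (trans (cong (ℚ._* c) eq) (ℚ.*-identityˡ c))

    Q×β : Q ×ℚ β ≡ c
    Q×β = let q , _ , eq = unit-fraction P in
      trans (×ℚ-*-assoc Q q c) (trans (cong (ℚ._* c) eq) (ℚ.*-identityˡ c))

    -- The r-th point of the finest subdivision: the first `R` steps have length α, all later ones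
    -- β.
    Y : ℕ → ℚ
    Y r = (r ℕ.⊓ R) ×ℚ α ℚ.+ (r ℕ.∸ R) ×ℚ β

    Y-mono-< : ∀ {i j} → i ℕ.< j → Y i ℚ.< Y j
    Y-mono-< {i} {j} i<j with R ℕ.≤? i
    ... | yes R≤i = ℚ.+-mono-≤-<
      (×ℚ-monoˡ-≤ (ℚ.<⇒≤ 0<α) (ℕ.⊓-monoˡ-≤ R (ℕ.<⇒≤ i<j)))
      (×ℚ-monoˡ-< 0<β (ℕ.∸-monoˡ-< i<j R≤i))
    ... | no  R≰i = ℚ.+-mono-<-≤
      (×ℚ-monoˡ-< 0<α (ℕ.≤-<-trans (ℕ.m⊓n≤m i R) (ℕ.⊓-pres-m< i<j (ℕ.≰⇒> R≰i))))
      (×ℚ-monoˡ-≤ (ℚ.<⇒≤ 0<β) (ℕ.∸-monoˡ-≤ R (ℕ.<⇒≤ i<j)))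

    Y-mono-≤ : ∀ {i j} → i ℕ.≤ j → Y i ℚ.≤ Y j
    Y-mono-≤ {i} i≤j with ℕ.m≤n⇒m<n∨m≡n i≤j
    ... | inj₁ i<j  = ℚ.<⇒≤ (Y-mono-< i<j)
    ... | inj₂ refl = ℚ.≤-refl

    0≤Y : ∀ i → 0ℚ ℚ.≤ Y i
    0≤Y i = ℚ.≤-trans (ℚ.≤-reflexive (sym (ℚ.+-identityʳ 0ℚ)))
      (ℚ.+-mono-≤ (×ℚ-nonNeg (i ℕ.⊓ R) (ℚ.<⇒≤ 0<α)) (×ℚ-nonNeg (i ℕ.∸ R) (ℚ.<⇒≤ 0<β)))

    Y-coarse : ∀ j → Y ((suc (s ℕ.+ s) ℕ.+ j) ℕ.* Q) ≡ suc j ×ℚ c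
    Y-coarse j = trans (cong Y (ℕ.*-distribʳ-+ Q (suc (s ℕ.+ s)) j))
      (cong₂ ℚ._+_
        (trans (cong (_×ℚ α) (ℕ.m≥n⇒m⊓n≡n (ℕ.m≤m+n R (j ℕ.* Q)))) R×α)
        (trans (cong (_×ℚ β) (ℕ.m+n∸m≡n R (j ℕ.* Q)))
          (trans (sym (Mult.×-assocˡ β j Q)) (cong (j ×ℚ_) Q×β))))

    P≡ : P ≡ suc (s ℕ.+ s) ℕ.+ ℕ.pred (2 ℕ.^ suc k)
    P≡ = trans
      (solveℕ 2 (λ s m → (s ⊕ m) ⊕ (s ⊕ m) ⊜ (s ⊕ s) ⊕ (m ⊕ (m ⊕ κ 0))) refl s (2 ℕ.^ k))
      (trans (cong (s ℕ.+ s ℕ.+_) (sym (suc-pred-2^ (suc k))))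
        (ℕ.+-suc (s ℕ.+ s) (ℕ.pred (2 ℕ.^ suc k))))

    Y-top : Y (P ℕ.* Q) ≡ 1ℚ
    Y-top = trans (cong (λ p → Y (p ℕ.* Q)) P≡)
      (trans (Y-coarse (ℕ.pred (2 ℕ.^ suc k)))
        (trans (cong (_×ℚ c) (suc-pred-2^ (suc k))) (2^×½^ (suc k))))

    node : ℕ → I
    node j = ⟦ Y (j ℕ.* Q) ⟧

    node-mono : ∀ {i j} → i ℕ.≤ j → node i ⊑ node j
    node-mono i≤j = ⟦⟧-mono-≤ (Y-mono-≤ (ℕ.*-monoˡ-≤ Q i≤j))

    -- Cutting the first cell shifts the later grid indices by the even number 2s, so the parity
    -- that distinguishes the blocks of f from those of g is preserved.
    node-coarse : ∀ j → node (suc (s ℕ.+ s) ℕ.+ j) ≡ grid (suc k) (suc j)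
    node-coarse j = cong ⟦_⟧ (Y-coarse j)

    module Interpolation (o n : ℕ) (o+n≡ : suc (o ℕ.+ n) ≡ P) (N : ℕ → ℕ) (N0 : N 0 ≡ o)
      (N-mono : ∀ {i j} → i ℕ.≤ j → N i ℕ.≤ N j) (N< : ∀ i → N i ℕ.< P) where

      -- The summand `i` keeps the values strictly increasing where `N` is constant; since i < Q, it
      -- does not leave the cell `N i`.
      y v : ℕ → ℚ
      y i = Y ((o ℕ.+ i) ℕ.* Q)
      v i = Y (N i ℕ.* Q ℕ.+ i)

      n<Q : n ℕ.< Q
      n<Q = s≤s (ℕ.≤-trans (ℕ.m≤n⇒m≤1+n (ℕ.m≤n+m n o)) (ℕ.≤-reflexive o+n≡))

      index< : ∀ i → i ℕ.< Q → N i ℕ.* Q ℕ.+ i ℕ.< suc (N i) ℕ.* Q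
      index< i i<Q = ℕ.≤-trans (ℕ.+-monoʳ-< (N i ℕ.* Q) i<Q) (ℕ.≤-reflexive (ℕ.+-comm (N i ℕ.* Q) Q))

      y₀≡v₀ : y 0 ≡ v 0
      y₀≡v₀ = cong Y (trans (cong (ℕ._* Q) (trans (ℕ.+-identityʳ o) (sym N0))) (sym (ℕ.+-identityʳ (N 0 ℕ.* Q))))

      abstract

        interpolant : ∃[ f ] (∀ i → i ℕ.≤ n → f ⟨$⟩ ⟦ y i ⟧ ≃ proj₁ ⟦ v i ⟧) ×
                             (∀ x → x ⊑ ⟦ v 0 ⟧ → f ⟨$⟩ x ≃ proj₁ x)
        interpolant = interpolate y v (0≤Y (N 0 ℕ.* Q ℕ.+ 0)) y₀≡v₀ n
          (λ i _ → Y-mono-< (ℕ.*-monoˡ-< Q (ℕ.+-monoʳ-< o (ℕ.n<1+n i))))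
          (λ i _ → Y-mono-< (ℕ.+-mono-≤-< (ℕ.*-monoˡ-≤ Q (N-mono (ℕ.n≤1+n i))) (ℕ.n<1+n i)))
          (subst (y n ℚ.<_) Y-top (Y-mono-< (ℕ.*-monoˡ-< Q (ℕ.≤-reflexive o+n≡))))
          (subst (v n ℚ.<_) Y-top (Y-mono-< (ℕ.<-≤-trans (index< n n<Q) (ℕ.*-monoˡ-≤ Q (N< n)))))

      h : Homeo₊
      h = proj₁ interpolant

      h-node : ∀ i → o ℕ.+ i ℕ.< P →
               node (N i) ⊑ h · node (o ℕ.+ i) × h · node (o ℕ.+ i) ⊑ node (suc (N i))
      h-node i i< =
        ≤-trans (⟦⟧-mono-≤ (Y-mono-≤ (ℕ.m≤m+n (N i ℕ.* Q) i))) (≥-of-≃ (proj₁ (proj₂ interpolant) i i≤n)) ,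
        ≤-trans (≤-reflexive (proj₁ (proj₂ interpolant) i i≤n))
          (⟦⟧-mono-≤ (Y-mono-≤ (ℕ.<⇒≤ (index< i (ℕ.≤-<-trans i≤n n<Q)))))
        where
        i≤n : i ℕ.≤ n
        i≤n = ℕ.+-cancelˡ-≤ o i n (ℕ.s≤s⁻¹ (ℕ.≤-trans i< (ℕ.≤-reflexive (sym o+n≡))))

      h-fix : ∀ x → x ⊑ node o → h ⟨$⟩ x ≃ proj₁ x
      h-fix x x≤ = proj₂ (proj₂ interpolant) x (≤-trans x≤ (≤-reflexive′ (cong ⟦_⟧
        (trans (cong (λ i → Y (i ℕ.* Q)) (sym (ℕ.+-identityʳ o))) y₀≡v₀))))
        where
        ≤-reflexive′ : ∀ {a b : I} → a ≡ b → a ⊑ b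
        ≤-reflexive′ refl = ≤-refl

    module Blocks (o : ℕ) (o≤1 : o ℕ.≤ 1) (A : ℕ → ℕ)
      (A-mono : ∀ {i j} → i ℕ.≤ j → A i ℕ.≤ A j) (A< : ∀ i → A i ℕ.< K) where

      1<P : 1 ℕ.< P
      1<P = ℕ.+-mono-≤ {1} {K} {1} {K} 1≤K 1≤K
        where
        1≤K : 1 ℕ.≤ K
        1≤K = ℕ.≤-trans (ℕ.m^n>0 2 k) (ℕ.m≤n+m (2 ℕ.^ k) s)

      N< : ∀ i → blockwise o A i ℕ.< P
      N< zero    = ℕ.≤-<-trans o≤1 1<P
      N< (suc i) = ℕ.≤-trans (s≤s (ℕ.+-monoˡ-≤ (a ℕ.+ a) o≤1))
        (ℕ.≤-trans (ℕ.≤-reflexive (cong suc (sym (ℕ.+-suc a a)))) (ℕ.+-mono-≤ (A< ⌊ i /2⌋) (A< ⌊ i /2⌋)))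
        where a = A ⌊ i /2⌋

      N-mono : ∀ {i j} → i ℕ.≤ j → blockwise o A i ℕ.≤ blockwise o A j
      N-mono {zero}  {zero}  _ = ℕ.≤-refl
      N-mono {zero}  {suc j} _ = ℕ.m≤m+n o (A ⌊ j /2⌋ ℕ.+ A ⌊ j /2⌋)
      N-mono {suc i} {suc j} (s≤s i≤j) =
        let a≤ = A-mono (ℕ.⌊n/2⌋-mono i≤j) in ℕ.+-monoʳ-≤ o (ℕ.+-mono-≤ a≤ a≤)

      open Interpolation o (ℕ.pred P ℕ.∸ o)
        (trans (cong suc (ℕ.m+[n∸m]≡n (ℕ.≤-trans o≤1 (ℕ.<⇒≤pred 1<P))))
          (ℕ.suc-pred P {{ℕ.>-nonZero (ℕ.<-trans (ℕ.n<1+n 0) 1<P)}}))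
        (blockwise o A) refl N-mono N< public using (h; h-node; h-fix)

      -- The nodes o + 2i + 1 and o + 2i + 2 form the block of value o + 2 A i.
      h-block : ∀ i → suc (o ℕ.+ i) ℕ.< P → let N = o ℕ.+ (A ⌊ i /2⌋ ℕ.+ A ⌊ i /2⌋) in
                node N ⊑ h · node (suc (o ℕ.+ i)) × h · node (suc (o ℕ.+ i)) ⊑ node (suc N)
      h-block i i< = subst (λ j → node N ⊑ h · node j × h · node j ⊑ node (suc N))
        (ℕ.+-suc o i) (h-node (suc i) (subst (ℕ._< P) (sym (ℕ.+-suc o i)) i<))
        where N = o ℕ.+ (A ⌊ i /2⌋ ℕ.+ A ⌊ i /2⌋)

  -- Uniform continuity

  -- Two rationals chosen inside each gap bound it from below by their difference, so the minimum is
  -- a positive rational although the points are real.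
  min-gap : ∀ (x : ℕ → I) n → (∀ j → j ℕ.< n → x j ⊏ x (suc j)) →
    ∃[ η ] 0ℚ ℚ.< η × (∀ j → j ℕ.< n → ∀ r r′ → ⟦ r ⟧ ⊑ x j → x (suc j) ⊑ ⟦ r′ ⟧ →
      clamp r ℚ.+ η ℚ.< clamp r′)
  min-gap x zero    x< = 1ℚ , ℚ.positive⁻¹ 1ℚ , λ _ ()
  min-gap x (suc n) x< =
    let η , 0<η , wide = min-gap x n (λ j j<n → x< j (ℕ.m<n⇒m<1+n j<n))
        q , x<q , q<x′ = ⊏-dense (x n) (x (suc n)) (x< n ℕ.≤-refl)
        p , x<p , p<q = ⊏-dense (x n) ⟦ q ⟧ x<q
        θ = clamp q ℚ.- clamp p
        0<θ = p<q⇒0<q-p (fromℚ-cancel-< p<q)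
        wideₙ : ∀ r r′ → ⟦ r ⟧ ⊑ x n → x (suc n) ⊑ ⟦ r′ ⟧ → clamp r ℚ.+ (η ℚ.⊓ θ) ℚ.< clamp r′
        wideₙ = λ r r′ r≤x x′≤r′ → ℚ.≤-<-trans (ℚ.+-monoʳ-≤ (clamp r) (ℚ.p⊓q≤q η θ))
          (lin< (ℚ.+-mono-< (fromℚ-cancel-< (≤-<-trans r≤x x<p))
                            (fromℚ-cancel-< (<-≤-trans q<x′ x′≤r′)))
            (solve 4 (λ r p q s → r :+ (q :- p) :+ (p :+ s) := s :+ (r :+ q))
              refl (clamp r) (clamp p) (clamp q) (clamp r′)))
    in η ℚ.⊓ θ , 0<p⊓q 0<η 0<θ , λ j j<sn r r′ r≤ ≤r′ →
         case-last
           {λ j → ∀ r r′ → ⟦ r ⟧ ⊑ x j → x (suc j) ⊑ ⟦ r′ ⟧ → clamp r ℚ.+ (η ℚ.⊓ θ) ℚ.< clamp r′}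
           (λ j j<n r r′ r≤ ≤r′ →
             ℚ.≤-<-trans (ℚ.+-monoʳ-≤ (clamp r) (ℚ.p⊓q≤p η θ)) (wide j j<n r r′ r≤ ≤r′))
           wideₙ j j<sn r r′ r≤ ≤r′
    where
    case-last : ∀ {P : ℕ → Set} {n} → (∀ j → j ℕ.< n → P j) → P n → ∀ j → j ℕ.< suc n → P j
    case-last {P} old new j j<sn with ℕ.m≤n⇒m<n∨m≡n j<sn
    ... | inj₁ (s≤s j<n) = old j j<n
    ... | inj₂ j≡        = subst P (ℕ.suc-injective (sym j≡)) new

  -- The contrapositive form: a rise by ρ needs a domain longer than η. With twice the mesh below ρ,
  -- a whole grid cell fits between u and u + ρ, and the finitely many preimages of grid points
  -- under h are η apart.
  uniformly-continuous : ∀ h ρ → 0ℚ ℚ.< ρ → ∃[ η ] 0ℚ ℚ.< η × (∀ u r r′ →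
    0ℚ ℚ.≤ u → u ℚ.+ ρ ℚ.≤ 1ℚ → h · ⟦ r ⟧ ⊑ ⟦ u ⟧ → ⟦ u ℚ.+ ρ ⟧ ⊑ h · ⟦ r′ ⟧ →
    clamp r ℚ.+ η ℚ.< clamp r′)
  uniformly-continuous h ρ 0<ρ = η , 0<η , apart
    where
    m = proj₁ (½^-archimedean (½*-pos 0<ρ))
    d = ½^ m
    2d<ρ : d ℚ.+ d ℚ.< ρ
    2d<ρ = subst (d ℚ.+ d ℚ.<_) (½+½ ρ)
      (ℚ.+-mono-< (proj₂ (½^-archimedean (½*-pos 0<ρ))) (proj₂ (½^-archimedean (½*-pos 0<ρ))))
    gaps = min-gap (λ j → h ⁻¹₊ · grid m j) (2 ℕ.^ m)
      (λ j j< → mono-< (h ⁻¹₊) (grid m j) (grid m (suc j)) (grid-mono-< m (ℕ.n<1+n j) j<))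
    η = proj₁ gaps
    0<η = proj₁ (proj₂ gaps)
    apart : ∀ u r r′ → 0ℚ ℚ.≤ u → u ℚ.+ ρ ℚ.≤ 1ℚ → h · ⟦ r ⟧ ⊑ ⟦ u ⟧ →
            ⟦ u ℚ.+ ρ ⟧ ⊑ h · ⟦ r′ ⟧ → clamp r ℚ.+ η ℚ.< clamp r′
    apart u r r′ 0≤u u+ρ≤1 r≤u u+ρ≤r′ =
      let j , j<2^m , j≤u , u≤j+1 = locate-grid m ⟦ u ⟧
          jd≤u : j ×ℚ d ℚ.≤ u
          jd≤u = subst₂ ℚ._≤_ (grid-val m (ℕ.<⇒≤ j<2^m))
            (clamp-id 0≤u (ℚ.≤-trans (ℚ.<⇒≤ (p<p+q u 0<ρ)) u+ρ≤1)) (fromℚ-cancel-≤ j≤u)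
          [2+j]d≤u+ρ : suc (suc j) ×ℚ d ℚ.≤ u ℚ.+ ρ
          [2+j]d≤u+ρ = lin≤ (ℚ.+-mono-≤ jd≤u (ℚ.<⇒≤ 2d<ρ))
            (solve 4 (λ d j u p → d :+ (d :+ j) :+ (u :+ p) := u :+ p :+ (j :+ (d :+ d)))
              refl d (j ×ℚ d) u ρ)
          1+j<2^m : suc j ℕ.< 2 ℕ.^ m
          1+j<2^m = ℕ.≮⇒≥ λ 2^m<2+j → ℚ.<-irrefl refl (ℚ.≤-<-trans (ℚ.≤-trans [2+j]d≤u+ρ u+ρ≤1)
            (subst (ℚ._< suc (suc j) ×ℚ d) (2^×½^ m) (×ℚ-monoˡ-< (½^-pos m) 2^m<2+j)))
      in proj₂ (proj₂ gaps) (suc j) 1+j<2^m r r′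
           (≤⇒≤⁻¹ h (grid m (suc j)) ⟦ r ⟧ (≤-trans r≤u u≤j+1))
           (≤⇒⁻¹≤ h (grid m (suc (suc j))) ⟦ r′ ⟧ (≤-trans (⟦⟧-mono-≤ [2+j]d≤u+ρ) u+ρ≤r′))

  -- Step functions close to a homeomorphism

  top : I
  top = ⟦ 1ℚ ⟧

  ≤-top : ∀ x → x ⊑ top
  ≤-top x = proj₂ (proj₂ x)

  top-fixed : ∀ h → top ⊑ h · top
  top-fixed h = ≤-trans (≥-of-≃ (·-⁻¹ h top)) (mono-≤ h (h ⁻¹₊ · top) top (≤-top (h ⁻¹₊ · top)))

  greatest : (ℕ → Set) → ℕ → ℕ
  greatest P zero    = zero
  greatest P (suc n) with em {P (suc n)}
  ... | yes _ = suc n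
  ... | no  _ = greatest P n

  greatest-≤ : ∀ (P : ℕ → Set) n → greatest P n ℕ.≤ n
  greatest-≤ P zero    = z≤n
  greatest-≤ P (suc n) with em {P (suc n)}
  ... | yes _ = ℕ.≤-refl
  ... | no  _ = ℕ.m≤n⇒m≤1+n (greatest-≤ P n)

  greatest-holds : ∀ (P : ℕ → Set) n → P 0 → P (greatest P n)
  greatest-holds P zero    P0 = P0
  greatest-holds P (suc n) P0 with em {P (suc n)}
  ... | yes Psn = Psn
  ... | no  _   = greatest-holds P n P0

  greatest-upper : ∀ (P : ℕ → Set) n m → m ℕ.≤ n → P m → m ℕ.≤ greatest P n
  greatest-upper P zero    m m≤ Pm = m≤
  greatest-upper P (suc n) m m≤ Pm with em {P (suc n)}
  ... | yes _   = m≤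
  ... | no  ¬P  with ℕ.m≤n⇒m<n∨m≡n m≤
  ...   | inj₁ (s≤s m≤n) = greatest-upper P n m m≤n Pm
  ...   | inj₂ refl      = contradiction Pm ¬P

  Below : Homeo₊ → ℕ → ℕ → ℕ → Set
  Below h k i n = grid (suc k) (n ℕ.+ n) ⊑ h · grid (suc k) (suc i ℕ.+ suc i)

  -- The search stops at 2^k - 1 so that a level always names a block. Where the cap takes effect,
  -- the upper half of `levels-bracket` is a comparison with 1.
  levels : Homeo₊ → ℕ → ℕ → ℕ
  levels h k i = greatest (Below h k i) (ℕ.pred (2 ℕ.^ k))

  levels-< : ∀ h k i → levels h k i ℕ.< 2 ℕ.^ k
  levels-< h k i = ℕ.≤-trans (s≤s (greatest-≤ (Below h k i) (ℕ.pred (2 ℕ.^ k))))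
    (ℕ.≤-reflexive (suc-pred-2^ k))

  levels-mono : ∀ h k {i j} → i ℕ.≤ j → levels h k i ℕ.≤ levels h k j
  levels-mono h k {i} {j} i≤j =
    greatest-upper (Below h k j) n (levels h k i) (greatest-≤ (Below h k i) n)
      (≤-trans (greatest-holds (Below h k i) n (grid-0 (suc k) (h · e i)))
        (mono-≤ h (e i) (e j) (grid-mono (suc k) (ℕ.+-mono-≤ (s≤s i≤j) (s≤s i≤j)))))
    where
    n = ℕ.pred (2 ℕ.^ k)
    e : ℕ → I
    e i = grid (suc k) (suc i ℕ.+ suc i)

  Bracket : Homeo₊ → ℕ → ℕ → ℕ → Set
  Bracket h k a i = grid (suc k) (a ℕ.+ a) ⊑ h · grid (suc k) (suc i ℕ.+ suc i) ×
                    h · grid (suc k) (suc i ℕ.+ suc i) ⊑ grid (suc k) (suc a ℕ.+ suc a)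

  2^k+2^k : ∀ k → 2 ℕ.^ k ℕ.+ 2 ℕ.^ k ≡ 2 ℕ.^ suc k
  2^k+2^k k = cong (2 ℕ.^ k ℕ.+_) (sym (ℕ.+-identityʳ (2 ℕ.^ k)))

  levels-bracket : ∀ h k i → Bracket h k (levels h k i) i
  levels-bracket h k i =
    greatest-holds P n (grid-0 (suc k) (h · e)) , upper (ℕ.≤-<-connex (suc a) n)
    where
    e = grid (suc k) (suc i ℕ.+ suc i)
    P = Below h k i
    n = ℕ.pred (2 ℕ.^ k)
    a = levels h k i
    upper : suc a ℕ.≤ n ⊎ n ℕ.< suc a → h · e ⊑ grid (suc k) (suc a ℕ.+ suc a)
    upper (inj₁ a<n) = ≮⇒≥ λ lt → ℕ.<-irrefl refl (greatest-upper P n (suc a) a<n (<⇒≤ lt))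
    upper (inj₂ n≤a) = grid-top (suc k) (h · e)
      (ℕ.≤-trans (ℕ.≤-reflexive (sym (2^k+2^k k))) (ℕ.+-mono-≤ 2^k≤ 2^k≤))
      where
      2^k≤ : 2 ℕ.^ k ℕ.≤ suc a
      2^k≤ = ℕ.≤-trans (ℕ.≤-reflexive (sym (suc-pred-2^ k))) n≤a

  -- On a double cell both homeomorphisms lie between the level at its left end and one more than
  -- the level at its right end; uniform continuity of `h` bounds the difference of these levels.
  bracket-close : ∀ h δ → 0ℚ ℚ.< δ → ∃[ k₀ ] ∀ k → k₀ ℕ.≤ k → ∀ h′ →
    (∀ i → suc i ℕ.< 2 ℕ.^ k → Bracket h′ k (levels h k i) i) → h′ ≈[ δ ] h
  bracket-close h δ 0<δ = k₀ , close
    where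
    ρ = ½ ℚ.* δ
    0<ρ = ½*-pos 0<δ
    uc = uniformly-continuous h ρ 0<ρ
    η = proj₁ uc
    0<η = proj₁ (proj₂ uc)
    apart = proj₂ (proj₂ uc)
    arch = ½^-archimedean (0<p⊓q 0<η (½*-pos 0<ρ))
    k₀ = proj₁ arch

    close : ∀ k → k₀ ℕ.≤ k → ∀ h′ →
      (∀ i → suc i ℕ.< 2 ℕ.^ k → Bracket h′ k (levels h k i) i) → h′ ≈[ δ ] h
    close k k₀≤k h′ bracket x =
      at (locate (λ i → grid (suc k) (i ℕ.+ i)) x (grid-0 (suc k) x) (ℕ.pred (2 ℕ.^ k))
           (grid-top (suc k) x (ℕ.≤-reflexive (trans (sym (2^k+2^k k))
             (cong₂ ℕ._+_ (sym (suc-pred-2^ k)) (sym (suc-pred-2^ k)))))))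
      where
      c = ½^ suc k
      0<c = ½^-pos (suc k)
      0≤c = ℚ.<⇒≤ 0<c
      2c≡ : c ℚ.+ c ≡ ½^ k
      2c≡ = ½+½ (½^ k)
      2c< : c ℚ.+ c ℚ.< η ℚ.⊓ (½ ℚ.* ρ)
      2c< = subst (ℚ._< η ℚ.⊓ (½ ℚ.* ρ)) (sym 2c≡) (ℚ.≤-<-trans (½^-antitone k₀≤k) (proj₂ arch))
      A = levels h k
      g : ℕ → I
      g = grid (suc k)
      bracket′ : ∀ i → i ℕ.< 2 ℕ.^ k → Bracket h′ k (A i) i
      bracket′ i i< = by-cases (ℕ.m≤n⇒m<n∨m≡n i<)
        where
        e = g (suc i ℕ.+ suc i)
        top≤e : suc i ≡ 2 ℕ.^ k → top ⊑ e
        top≤e i+1≡ = grid-top (suc k) top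
          (ℕ.≤-reflexive (trans (sym (2^k+2^k k)) (cong₂ ℕ._+_ (sym i+1≡) (sym i+1≡))))
        by-cases : suc i ℕ.< 2 ℕ.^ k ⊎ suc i ≡ 2 ℕ.^ k → Bracket h′ k (A i) i
        by-cases (inj₁ i+1<) = bracket i i+1<
        -- At the right end 1, which both homeomorphisms fix, the bracket of `h′` follows from that
        -- of `h`.
        by-cases (inj₂ i+1≡) =
         ≤-trans (proj₁ (levels-bracket h k i)) (≤-trans (≤-top (h · e))
           (≤-trans (top-fixed h′) (mono-≤ h′ top e (top≤e i+1≡)))) ,
         ≤-trans (≤-top (h′ · e)) (≤-trans (top-fixed h)
           (≤-trans (mono-≤ h top e (top≤e i+1≡)) (proj₂ (levels-bracket h k i))))
      lo : ℕ → ℕ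
      lo zero    = 0
      lo (suc i) = A i
      lower : ∀ f → (∀ i → i ℕ.< 2 ℕ.^ k → Bracket f k (A i) i) → ∀ i → i ℕ.< 2 ℕ.^ k →
              g (lo i ℕ.+ lo i) ⊑ f · g (i ℕ.+ i)
      lower f b zero    _  = grid-0 (suc k) (f · g 0)
      lower f b (suc i) i< = proj₁ (b i (ℕ.<-trans (ℕ.n<1+n i) i<))
      lo-upper : ∀ i → h · g (i ℕ.+ i) ⊑ g (suc (lo i) ℕ.+ suc (lo i))
      lo-upper zero =
        ≤-trans (mono-≤ h (g 0) (h ⁻¹₊ · g 0) (grid-0 (suc k) (h ⁻¹₊ · g 0)))
          (≤-trans (≤-reflexive (·-⁻¹ h (g 0))) (grid-mono (suc k) {0} {2} z≤n))
      lo-upper (suc i) = proj₂ (levels-bracket h k i)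
      val≤ : ∀ {n x} → n ℕ.≤ 2 ℕ.^ suc k → g n ⊑ x → fromℚ (n ×ℚ c) ≤ proj₁ x
      val≤ {n} n≤ le = ≤-trans (fromℚ-mono-≤ (ℚ.≤-reflexive (sym (grid-val (suc k) n≤)))) le
      ≤val : ∀ {n x} → x ⊑ g n → proj₁ x ≤ fromℚ (n ×ℚ c)
      ≤val {n} le = ≤-trans le (fromℚ-mono-≤ (clamp-≤ (×ℚ-nonNeg n 0≤c)))
      lo≤ : ∀ i → lo i ℕ.+ lo i ℕ.≤ 2 ℕ.^ suc k
      lo≤ i = ℕ.≤-trans (ℕ.+-mono-≤ (lo≤′ i) (lo≤′ i)) (ℕ.≤-reflexive (2^k+2^k k))
        where
        lo≤′ : ∀ i → lo i ℕ.≤ 2 ℕ.^ k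
        lo≤′ zero    = z≤n
        lo≤′ (suc i) = ℕ.<⇒≤ (levels-< h k i)
      A+A≤ : ∀ i → A i ℕ.+ A i ℕ.≤ 2 ℕ.^ suc k
      A+A≤ i = ℕ.≤-trans
        (ℕ.+-mono-≤ (ℕ.<⇒≤ (levels-< h k i)) (ℕ.<⇒≤ (levels-< h k i))) (ℕ.≤-reflexive (2^k+2^k k))
      -- A larger rise of `h` over the i-th double cell would force that cell to be longer than η.
      thin : ∀ i → i ℕ.< 2 ℕ.^ k →
             (A i ℕ.+ A i) ×ℚ c ℚ.< (suc (lo i) ℕ.+ suc (lo i)) ×ℚ c ℚ.+ ρ
      thin i i< = ℚ.≰⇒> λ le → ℚ.<-asym 2c<η
        (lin< (apart u (r i) (r (suc i)) (×ℚ-nonNeg (suc (lo i) ℕ.+ suc (lo i)) 0≤c)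
                (ℚ.≤-trans le (grid-≤ (suc k) (A+A≤ i)))
                (lo-upper i)
                (≤-trans (⟦⟧-mono-≤ le) (proj₁ (levels-bracket h k i))))
          (trans (cong (η ℚ.+_) (trans (val (suc i) i<) (r-suc i)))
            (trans (solve 3 (λ e r c → e :+ (c :+ c :+ r) := c :+ c :+ (r :+ e)) refl η (r i) c)
              (cong (λ t → c ℚ.+ c ℚ.+ (t ℚ.+ η)) (sym (val i (ℕ.<⇒≤ i<)))))))
        where
        2c<η : c ℚ.+ c ℚ.< η
        2c<η = ℚ.<-≤-trans 2c< (ℚ.p⊓q≤p η (½ ℚ.* ρ))
        u = (suc (lo i) ℕ.+ suc (lo i)) ×ℚ c
        r : ℕ → ℚ
        r i = (i ℕ.+ i) ×ℚ c
        val : ∀ i → i ℕ.≤ 2 ℕ.^ k → clamp (r i) ≡ r i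
        val i i≤ = grid-val (suc k) (ℕ.≤-trans (ℕ.+-mono-≤ i≤ i≤) (ℕ.≤-reflexive (2^k+2^k k)))
        r-suc : ∀ i → r (suc i) ≡ c ℚ.+ c ℚ.+ r i
        r-suc i = trans (cong (λ n → suc n ×ℚ c) (ℕ.+-suc i i)) (sym (ℚ.+-assoc c c (r i)))
      at : (∃[ i ] i ℕ.≤ ℕ.pred (2 ℕ.^ k) × g (i ℕ.+ i) ⊑ x × x ⊑ g (suc i ℕ.+ suc i)) →
           Close δ (h′ ⟨$⟩ x) (h ⟨$⟩ x)
      at (i , i≤ , lo≤x , x≤hi) =
        (lo i ℕ.+ lo i) ×ℚ c , (suc (A i) ℕ.+ suc (A i)) ×ℚ c , width ,
        bounds h′ bracket′ , bounds h (λ i _ → levels-bracket h k i)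
        where
        i< : i ℕ.< 2 ℕ.^ k
        i< = ℕ.≤-trans (s≤s i≤) (ℕ.≤-reflexive (suc-pred-2^ k))
        bounds : ∀ f → (∀ i → i ℕ.< 2 ℕ.^ k → Bracket f k (A i) i) →
          fromℚ ((lo i ℕ.+ lo i) ×ℚ c) ≤ f ⟨$⟩ x × f ⟨$⟩ x ≤ fromℚ ((suc (A i) ℕ.+ suc (A i)) ×ℚ c)
        bounds f b =
          val≤ {lo i ℕ.+ lo i} {f · x} (lo≤ i) (≤-trans (lower f b i i<) (mono-≤ f (g (i ℕ.+ i)) x lo≤x)) ,
          ≤val {suc (A i) ℕ.+ suc (A i)} {f · x} (≤-trans (mono-≤ f x (g (suc i ℕ.+ suc i)) x≤hi) (proj₂ (b i i<)))
        two : ∀ n → (suc n ℕ.+ suc n) ×ℚ c ≡ c ℚ.+ c ℚ.+ (n ℕ.+ n) ×ℚ c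
        two n = trans (cong (λ m → suc m ×ℚ c) (ℕ.+-suc n n)) (sym (ℚ.+-assoc c c ((n ℕ.+ n) ×ℚ c)))
        2c<½ρ : c ℚ.+ c ℚ.< ½ ℚ.* ρ
        2c<½ρ = ℚ.<-≤-trans 2c< (ℚ.p⊓q≤q η (½ ℚ.* ρ))
        -- The rounding at the two ends costs less than ρ/2 each and the rise between them less than
        -- ρ, in total less than 2ρ = δ.
        width : (suc (A i) ℕ.+ suc (A i)) ×ℚ c ℚ.< (lo i ℕ.+ lo i) ×ℚ c ℚ.+ δ
        width = lin< (ℚ.+-mono-< (ℚ.+-mono-< 2c<½ρ 2c<½ρ) (thin i i<))
          (trans (cong₂ (λ a b → a ℚ.+ (½ ℚ.* ρ ℚ.+ ½ ℚ.* ρ ℚ.+ (b ℚ.+ ρ))) (two (A i)) (two (lo i)))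
            (trans (cong (λ e → c ℚ.+ c ℚ.+ a ℚ.+ (e ℚ.+ (c ℚ.+ c ℚ.+ b ℚ.+ ρ))) (½+½ ρ))
              (trans (solve 4 (λ c a b p → c :+ c :+ a :+ (p :+ (c :+ c :+ b :+ p))
                        := b :+ (p :+ p) :+ (c :+ c :+ (c :+ c) :+ a)) refl c a b ρ)
                (cong (λ e → b ℚ.+ e ℚ.+ (c ℚ.+ c ℚ.+ (c ℚ.+ c) ℚ.+ a)) (½+½ δ)))))
          where
          a = (A i ℕ.+ A i) ×ℚ c
          b = (lo i ℕ.+ lo i) ×ℚ c

  -- Alternating words

  Signs : Set
  Signs = List (Bool × Bool)

  power : Bool → Word → Word
  power true  w = w
  power false w = w ⁻¹ʷ

  -- The head of the list acts first.
  alternating : Signs → Word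
  alternating []            = 1ʷ
  alternating ((β , α) ∷ t) = alternating t ∙ʷ (power α gen₁ ∙ʷ power β gen₂)

  conjugate : Signs → Word
  conjugate t = alternating t ∙ʷ gen₁ ∙ʷ alternating t ⁻¹ʷ

  power-not : ∀ G b w x → proj₁ (eval G (power (not b) w) · x) ≃ proj₁ (eval G (power b w ⁻¹ʷ) · x)
  power-not G true  w x = ℝₛ.refl
  power-not G false w x = ℝₛ.refl

  ·-cong : ∀ h x y → proj₁ x ≃ proj₁ y → h ⟨$⟩ x ≃ h ⟨$⟩ y
  ·-cong h x y eq = Homeo₊.to-cong h {x} {y} eq

  alternating-++ : ∀ G t u x →
    eval G (alternating (t ++ u)) ⟨$⟩ x ≃ eval G (alternating u) ⟨$⟩ (eval G (alternating t) · x)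
  alternating-++ G []            u x = ℝₛ.refl
  alternating-++ G ((β , α) ∷ t) u x =
    alternating-++ G t u (eval G (power α gen₁) · eval G (power β gen₂) · x)

  conjugate-fixes : ∀ G t x → let y = eval G (alternating t ⁻¹ʷ) · x in
    proj₁ G ⟨$⟩ y ≃ proj₁ y → eval G (conjugate t) ⟨$⟩ x ≃ proj₁ x
  conjugate-fixes G t x fixed =
    ℝₛ.trans (·-cong (eval G (alternating t)) (proj₁ G · y) y fixed) (·-⁻¹ (eval G (alternating t)) x)
    where y = eval G (alternating t ⁻¹ʷ) · x

  -- The inverse of an alternating word begins with a power of f and ends with one of g. A letter g
  -- before it and f^σ after it shift the pairing by one letter, so each α is passed on to the
  -- neighbouring pair.
  backwards : Signs → Bool → Signs
  backwards []            σ = (true , σ) ∷ []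
  backwards ((β , α) ∷ t) σ = backwards t (not α) ∷ʳ (not β , σ)

  alternating-backwards : ∀ G t σ x →
    eval G (alternating (backwards t σ)) ⟨$⟩ x ≃
    eval G (power σ gen₁ ∙ʷ (alternating t ⁻¹ʷ ∙ʷ gen₂)) ⟨$⟩ x
  alternating-backwards G []            σ x = ℝₛ.refl
  alternating-backwards G ((β , α) ∷ t) σ x =
    ℝₛ.trans (alternating-++ G (backwards t (not α)) ((not β , σ) ∷ []) x)
      (·-cong (eval G (power σ gen₁)) _ _
        (ℝₛ.trans (·-cong (eval G (power (not β) gen₂)) _ _
            (ℝₛ.trans (alternating-backwards G t (not α) x) (power-not G α gen₁ z)))
          (power-not G β gen₂ (eval G (power α gen₁ ⁻¹ʷ) · z))))
    where z = eval G (alternating t ⁻¹ʷ ∙ʷ gen₂) · x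

  -- A conjugate acts by f^± first, whereas alternating words act by g^± first; this
  -- costs a factor g on the right.
  unfold : Signs → Signs
  unfold t = backwards t true ++ t

  alternating-unfold : ∀ G t x →
    eval G (alternating (unfold t)) ⟨$⟩ x ≃ eval G (conjugate t) ⟨$⟩ (proj₂ G · x)
  alternating-unfold G t x = ℝₛ.trans (alternating-++ G (backwards t true) t x)
    (·-cong (eval G (alternating t)) _ _ (alternating-backwards G t true x))

  length-backwards : ∀ t σ → length (backwards t σ) ≡ suc (length t)
  length-backwards []            σ = refl
  length-backwards ((β , α) ∷ t) σ =
    trans (List.length-++ (backwards t (not α)))
      (trans (ℕ.+-comm _ 1) (cong suc (length-backwards t (not α))))

  length-unfold : ∀ t → length (unfold t) ≡ suc (length t ℕ.+ length t)
  length-unfold t = trans (List.length-++ (backwards t true))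
    (cong (ℕ._+ length t) (length-backwards t true))

  -- The sign patterns of block sequences

  -- A sign records whether the i-th block lies below the cell assigned to it, hence whether the map
  -- or its inverse climbs there.
  signs : (A B : ℕ → ℕ) → ℕ → ℕ → Signs
  signs A B i zero    = []
  signs A B i (suc n) = ((i <ᵇ B i) , (i <ᵇ A i)) ∷ signs A B (suc i) n

  length-signs : ∀ A B i n → length (signs A B i n) ≡ n
  length-signs A B i zero    = refl
  length-signs A B i (suc n) = cong suc (length-signs A B (suc i) n)

  bit : Bool → ℕ
  bit σ = if σ then 1 else 0

  bit≤1 : ∀ σ → bit σ ℕ.≤ 1
  bit≤1 true  = ℕ.≤-refl
  bit≤1 false = z≤n

  -- The new levels are i or i + 1, so that the comparison of i with its level returns the
  -- prescribed bit. The old levels are shifted along both axes, which keeps their signs.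
  prepend : (Bool × Bool → Bool) → Signs → (ℕ → ℕ) → ℕ → ℕ
  prepend π []      A i       = A i
  prepend π (σ ∷ t) A zero    = bit (π σ)
  prepend π (σ ∷ t) A (suc i) = suc (prepend π t A i)

  prepend-shift : ∀ π t A i → prepend π t A (length t ℕ.+ i) ≡ length t ℕ.+ A i
  prepend-shift π []      A i = refl
  prepend-shift π (σ ∷ t) A i = cong suc (prepend-shift π t A i)

  prepend-near : ∀ π t A i → i ℕ.< length t →
                 i ℕ.≤ prepend π t A i × prepend π t A i ℕ.≤ suc i
  prepend-near π (σ ∷ t) A zero    _        = z≤n , bit≤1 (π σ)
  prepend-near π (σ ∷ t) A (suc i) (s≤s i<) =
    s≤s (proj₁ (prepend-near π t A i i<)) , s≤s (proj₂ (prepend-near π t A i i<))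

  prepend-mono : ∀ π t A → (∀ {i j} → i ℕ.≤ j → A i ℕ.≤ A j) →
                 ∀ {i j} → i ℕ.≤ j → prepend π t A i ℕ.≤ prepend π t A j
  prepend-mono π []      A mono i≤j = mono i≤j
  prepend-mono π (σ ∷ t) A mono {zero}  {zero}  _ = ℕ.≤-refl
  prepend-mono π (σ ∷ t) A mono {zero}  {suc j} _ = ℕ.≤-trans (bit≤1 (π σ)) (s≤s z≤n)
  prepend-mono π (σ ∷ t) A mono {suc i} {suc j} (s≤s i≤j) = s≤s (prepend-mono π t A mono i≤j)

  prepend-< : ∀ π t A {K} → 0 ℕ.< K → (∀ i → A i ℕ.< K) → ∀ i → prepend π t A i ℕ.< length t ℕ.+ K
  prepend-< π []      A 0<K A< i = A< i
  prepend-< π (σ ∷ t) A {K} 0<K A< zero =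
    s≤s (ℕ.≤-trans (bit≤1 (π σ)) (ℕ.≤-trans 0<K (ℕ.m≤n+m K (length t))))
  prepend-< π (σ ∷ t) A 0<K A< (suc i) = s≤s (prepend-< π t A 0<K A< i)

  signs-suc : ∀ σ t A B i n →
    signs (prepend proj₂ (σ ∷ t) A) (prepend proj₁ (σ ∷ t) B) (suc i) n ≡
    signs (prepend proj₂ t A) (prepend proj₁ t B) i n
  signs-suc σ t A B i zero    = refl
  signs-suc σ t A B i (suc n) = cong (_ ∷_) (signs-suc σ t A B (suc i) n)

  signs-prefix : ∀ t A B → signs (prepend proj₂ t A) (prepend proj₁ t B) 0 (length t) ≡ t
  signs-prefix []            A B = refl
  signs-prefix ((β , α) ∷ t) A B = cong₂ _∷_ (cong₂ _,_ (0<ᵇ β) (0<ᵇ α))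
    (trans (signs-suc (β , α) t A B 0 (length t)) (signs-prefix t A B))
    where
    0<ᵇ : ∀ σ → (0 <ᵇ bit σ) ≡ σ
    0<ᵇ true  = refl
    0<ᵇ false = refl

  -- Thus a climbing word computed before the insertion still climbs behind the inserted part.
  signs-suffix : ∀ t A B n →
    signs (prepend proj₂ t A) (prepend proj₁ t B) (length t) n ≡ signs A B 0 n
  signs-suffix []      A B n = refl
  signs-suffix (σ ∷ t) A B n =
    trans (signs-suc σ t A B (length t) n) (signs-suffix t A B n)

  -- Halves of natural numbers

  ⌊n+n/2⌋ : ∀ n → ⌊ n ℕ.+ n /2⌋ ≡ n
  ⌊n+n/2⌋ n = sym (ℕ.n≡⌊n+n/2⌋ n)

  ⌊1+n+n/2⌋ : ∀ n → ⌊ suc (n ℕ.+ n) /2⌋ ≡ n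
  ⌊1+n+n/2⌋ n = sym (ℕ.n≡⌈n+n/2⌉ n)

  ⌊n/2⌋+⌊n/2⌋≤n : ∀ n → ⌊ n /2⌋ ℕ.+ ⌊ n /2⌋ ℕ.≤ n
  ⌊n/2⌋+⌊n/2⌋≤n n = ℕ.≤-trans (ℕ.+-monoʳ-≤ ⌊ n /2⌋ (ℕ.⌊n/2⌋≤⌈n/2⌉ n))
    (ℕ.≤-reflexive (ℕ.⌊n/2⌋+⌈n/2⌉≡n n))

  n≤⌈n/2⌉+⌈n/2⌉ : ∀ n → n ℕ.≤ ⌈ n /2⌉ ℕ.+ ⌈ n /2⌉
  n≤⌈n/2⌉+⌈n/2⌉ n = ℕ.≤-trans (ℕ.≤-reflexive (sym (ℕ.⌊n/2⌋+⌈n/2⌉≡n n)))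
    (ℕ.+-monoˡ-≤ ⌈ n /2⌉ (ℕ.⌊n/2⌋≤⌈n/2⌉ n))

  n<s+s⇒⌊n/2⌋<s : ∀ n s → n ℕ.< s ℕ.+ s → ⌊ n /2⌋ ℕ.< s
  n<s+s⇒⌊n/2⌋<s n s n< = ℕ.≰⇒> λ s≤ →
    ℕ.<-irrefl refl (ℕ.<-≤-trans n< (ℕ.≤-trans (ℕ.+-mono-≤ s≤ s≤) (⌊n/2⌋+⌊n/2⌋≤n n)))

  -- Climbing along the nodes, and bounds on its speed

  module System (k s : ℕ) (A B : ℕ → ℕ)
    (A-mono : ∀ {i j} → i ℕ.≤ j → A i ℕ.≤ A j) (B-mono : ∀ {i j} → i ℕ.≤ j → B i ℕ.≤ B j)
    (A< : ∀ i → A i ℕ.< s ℕ.+ 2 ℕ.^ k) (B< : ∀ i → B i ℕ.< s ℕ.+ 2 ℕ.^ k) where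

    open Nodes k s public
    module F = Blocks 1 ℕ.≤-refl A A-mono A<
    module G = Blocks 0 z≤n B B-mono B<

    G₀ : Pair
    G₀ = F.h , G.h

    f-block : ∀ j {i} → ⌊ j /2⌋ ≡ i → suc (suc j) ℕ.< P →
      node (suc (A i ℕ.+ A i)) ⊑ F.h · node (suc (suc j)) ×
      F.h · node (suc (suc j)) ⊑ node (suc (suc (A i ℕ.+ A i)))
    f-block j refl j< = F.h-block j j<

    g-block : ∀ j {i} → ⌊ j /2⌋ ≡ i → suc j ℕ.< P →
      node (B i ℕ.+ B i) ⊑ G.h · node (suc j) × G.h · node (suc j) ⊑ node (suc (B i ℕ.+ B i))
    g-block j refl j< = G.h-block j j<

    2+2i≤ : ∀ {i a} → i ℕ.< a → suc (suc (i ℕ.+ i)) ℕ.≤ a ℕ.+ a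
    2+2i≤ {i} i<a = ℕ.≤-trans (ℕ.≤-reflexive (cong suc (sym (ℕ.+-suc i i)))) (ℕ.+-mono-≤ i<a i<a)

    -- The block 2i+2, 2i+3 is sent between the nodes 2a+1 and 2a+2 with a = `A i`. If i < a, its
    -- lower node is sent to 2i+3 or higher; otherwise its upper node is sent to 2i+2 or lower, and
    -- the inverse climbs.
    f-climb : ∀ i → suc (suc (suc (i ℕ.+ i))) ℕ.< P →
      node (suc (suc (suc (i ℕ.+ i)))) ⊑ eval G₀ (power (i <ᵇ A i) gen₁) · node (suc (suc (i ℕ.+ i)))
    f-climb i i< = by-sign (i <ᵇ A i) (ℕ.<ᵇ-reflects-< i (A i))
      where
      by-sign : ∀ σ → Reflects (i ℕ.< A i) σ →
        node (suc (suc (suc (i ℕ.+ i)))) ⊑ eval G₀ (power σ gen₁) · node (suc (suc (i ℕ.+ i)))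
      by-sign true (ofʸ i<A) = ≤-trans (node-mono (s≤s (2+2i≤ i<A)))
        (proj₁ (f-block (i ℕ.+ i) (⌊n+n/2⌋ i) (ℕ.<-trans (ℕ.n<1+n (suc (suc (i ℕ.+ i)))) i<)))
      by-sign false (ofⁿ i≮A) = ≤⇒≤⁻¹ F.h (node (suc (suc (i ℕ.+ i)))) (node (suc (suc (suc (i ℕ.+ i)))))
        (≤-trans (proj₂ (f-block (suc (i ℕ.+ i)) (⌊1+n+n/2⌋ i) i<))
          (node-mono (s≤s (s≤s (ℕ.+-mono-≤ (ℕ.≮⇒≥ i≮A) (ℕ.≮⇒≥ i≮A))))))

    g-climb : ∀ i → suc (suc (i ℕ.+ i)) ℕ.< P →
      node (suc (suc (i ℕ.+ i))) ⊑ eval G₀ (power (i <ᵇ B i) gen₂) · node (suc (i ℕ.+ i))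
    g-climb i i< = by-sign (i <ᵇ B i) (ℕ.<ᵇ-reflects-< i (B i))
      where
      by-sign : ∀ σ → Reflects (i ℕ.< B i) σ →
        node (suc (suc (i ℕ.+ i))) ⊑ eval G₀ (power σ gen₂) · node (suc (i ℕ.+ i))
      by-sign true (ofʸ i<B) = ≤-trans (node-mono (2+2i≤ i<B))
        (proj₁ (g-block (i ℕ.+ i) (⌊n+n/2⌋ i) (ℕ.<-trans (ℕ.n<1+n (suc (i ℕ.+ i))) i<)))
      by-sign false (ofⁿ i≮B) = ≤⇒≤⁻¹ G.h (node (suc (i ℕ.+ i))) (node (suc (suc (i ℕ.+ i))))
        (≤-trans (proj₂ (g-block (suc (i ℕ.+ i)) (⌊1+n+n/2⌋ i) i<))
          (node-mono (s≤s (ℕ.+-mono-≤ (ℕ.≮⇒≥ i≮B) (ℕ.≮⇒≥ i≮B)))))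

    climb : ∀ n i → i ℕ.+ n ℕ.< K →
      node (suc ((i ℕ.+ n) ℕ.+ (i ℕ.+ n))) ⊑ eval G₀ (alternating (signs A B i n)) · node (suc (i ℕ.+ i))
    climb zero    i i<K = node-mono (s≤s (ℕ.≤-reflexive (cong₂ ℕ._+_ (ℕ.+-identityʳ i) (ℕ.+-identityʳ i))))
    climb (suc n) i i+n<K = ≤-trans (node-mono (s≤s (ℕ.≤-reflexive (cong₂ ℕ._+_ (ℕ.+-suc i n) (ℕ.+-suc i n)))))
      (≤-trans (climb n (suc i) (subst (ℕ._< K) (ℕ.+-suc i n) i+n<K))
        (mono-≤ T (node (suc (suc i ℕ.+ suc i))) (f^ · g^ · node (suc (i ℕ.+ i)))
          (≤-trans (node-mono (ℕ.≤-reflexive (cong (λ m → suc (suc m)) (ℕ.+-suc i i))))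
            (≤-trans (f-climb i 3+2i<P)
              (mono-≤ f^ (node (suc (suc (i ℕ.+ i)))) (g^ · node (suc (i ℕ.+ i)))
                (g-climb i (ℕ.<-trans (ℕ.n<1+n (suc (suc (i ℕ.+ i)))) 3+2i<P)))))))
      where
      T = eval G₀ (alternating (signs A B (suc i) n))
      f^ = eval G₀ (power (i <ᵇ A i) gen₁)
      g^ = eval G₀ (power (i <ᵇ B i) gen₂)
      1+i<K : suc i ℕ.< K
      1+i<K = ℕ.≤-<-trans (ℕ.m≤m+n (suc i) n) (subst (ℕ._< K) (ℕ.+-suc i n) i+n<K)
      3+2i<P : suc (suc (suc (i ℕ.+ i))) ℕ.< P
      3+2i<P = ℕ.≤-trans (ℕ.≤-reflexive (cong (λ m → suc (suc m))
          (trans (cong suc (sym (ℕ.+-suc i i))) (sym (ℕ.+-suc i (suc i))))))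
        (ℕ.+-mono-≤ 1+i<K 1+i<K)

    module Slow (A-near : ∀ i → i ℕ.< s → i ℕ.≤ A i × A i ℕ.≤ suc i)
                (B-near : ∀ i → i ℕ.< s → i ℕ.≤ B i × B i ℕ.≤ suc i) where

      1+s+s<P : suc (s ℕ.+ s) ℕ.< P
      1+s+s<P = ℕ.≤-trans (ℕ.≤-reflexive (cong suc (sym (ℕ.+-suc s s))))
        (ℕ.+-mono-≤ s<K s<K)
        where
        s<K : s ℕ.< K
        s<K = ℕ.≤-trans (ℕ.≤-reflexive (ℕ.+-comm 1 s)) (ℕ.+-monoʳ-≤ s (ℕ.m^n>0 2 k))

      a+a≤2+j : ∀ {a} j → a ℕ.≤ suc ⌊ j /2⌋ → a ℕ.+ a ℕ.≤ suc (suc j)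
      a+a≤2+j j a≤ = ℕ.≤-trans (ℕ.+-mono-≤ a≤ a≤)
        (ℕ.≤-trans (ℕ.≤-reflexive (cong suc (ℕ.+-suc ⌊ j /2⌋ ⌊ j /2⌋))) (s≤s (s≤s (⌊n/2⌋+⌊n/2⌋≤n j))))

      s+s<P : s ℕ.+ s ℕ.< P
      s+s<P = ℕ.<-trans (ℕ.n<1+n (s ℕ.+ s)) 1+s+s<P

      1+j≤ : ∀ {a} j → suc ⌊ j /2⌋ ℕ.≤ a → suc j ℕ.≤ a ℕ.+ a
      1+j≤ j ≤a = ℕ.≤-trans (n≤⌈n/2⌉+⌈n/2⌉ (suc j)) (ℕ.+-mono-≤ ≤a ≤a)

      -- Among the first s blocks a level differs from its index by at most one, so neither the map
      -- nor its inverse raises a node by more than two places.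
      f-slow : ∀ σ j → suc (suc (suc (suc j))) ℕ.≤ s ℕ.+ s →
        eval G₀ (power σ gen₁) · node (suc (suc j)) ⊑ node (suc (suc (suc (suc j))))
      f-slow true  j j≤ = ≤-trans
        (proj₂ (f-block j refl (ℕ.<-trans (ℕ.≤-trans (ℕ.n≤1+n (suc (suc (suc j)))) j≤) s+s<P)))
        (node-mono (s≤s (s≤s (a+a≤2+j j (proj₂ (A-near ⌊ j /2⌋
          (n<s+s⇒⌊n/2⌋<s j s (ℕ.≤-trans (ℕ.m≤n+m (suc j) 3) j≤))))))))
      f-slow false j j≤ = ≤⇒⁻¹≤ F.h (node (suc (suc j))) (node (suc (suc (suc (suc j)))))
        (≤-trans (node-mono (s≤s (1+j≤ j (proj₁ (A-near (suc ⌊ j /2⌋)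
            (n<s+s⇒⌊n/2⌋<s (suc (suc j)) s (ℕ.≤-trans (ℕ.n≤1+n (suc (suc (suc j)))) j≤)))))))
          (proj₁ (f-block (suc (suc j)) refl (ℕ.≤-<-trans j≤ s+s<P))))

      g-slow : ∀ σ j → suc (suc (suc j)) ℕ.≤ s ℕ.+ s →
        eval G₀ (power σ gen₂) · node (suc j) ⊑ node (suc (suc (suc j)))
      g-slow true  j j≤ = ≤-trans
        (proj₂ (g-block j refl (ℕ.<-trans (ℕ.≤-trans (ℕ.n≤1+n (suc (suc j))) j≤) s+s<P)))
        (node-mono (s≤s (a+a≤2+j j (proj₂ (B-near ⌊ j /2⌋
          (n<s+s⇒⌊n/2⌋<s j s (ℕ.≤-trans (ℕ.m≤n+m (suc j) 2) j≤)))))))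
      g-slow false j j≤ = ≤⇒⁻¹≤ G.h (node (suc j)) (node (suc (suc (suc j))))
        (≤-trans (node-mono (1+j≤ j (proj₁ (B-near (suc ⌊ j /2⌋) (n<s+s⇒⌊n/2⌋<s (suc (suc j)) s j≤)))))
          (proj₁ (g-block (suc (suc j)) refl (ℕ.≤-<-trans j≤ s+s<P))))

      -- The factor 4 counts two places for each of the two letters of an entry.
      slow : ∀ t j → length t ℕ.* 4 ℕ.+ suc j ℕ.≤ s ℕ.+ s →
        eval G₀ (alternating t) · node (suc j) ⊑ node (length t ℕ.* 4 ℕ.+ suc j)
      slow []            j j≤ = ≤-refl
      slow ((β , α) ∷ t) j j≤ =
        ≤-trans (mono-≤ T (f^ · g^ · node (suc j)) (node (suc (4 ℕ.+ j)))
          (≤-trans (mono-≤ f^ (g^ · node (suc j)) (node (suc (suc (suc j))))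
              (g-slow β j (ℕ.≤-trans (ℕ.m≤n+m (3 ℕ.+ j) 2) 5+j≤)))
            (f-slow α (suc j) 5+j≤)))
          (≤-trans (slow t (4 ℕ.+ j) (ℕ.≤-trans (ℕ.≤-reflexive (shift (length t ℕ.* 4) j)) j≤))
            (node-mono (ℕ.≤-reflexive (shift (length t ℕ.* 4) j))))
        where
        T = eval G₀ (alternating t)
        f^ = eval G₀ (power α gen₁)
        g^ = eval G₀ (power β gen₂)
        shift : ∀ n j → n ℕ.+ suc (4 ℕ.+ j) ≡ 4 ℕ.+ (n ℕ.+ suc j)
        shift = solveℕ 2 (λ n j → n ⊕ (κ 5 ⊕ j) ⊜ κ 4 ⊕ (n ⊕ (κ 1 ⊕ j))) refl
        5+j≤ : 5 ℕ.+ j ℕ.≤ s ℕ.+ s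
        5+j≤ = ℕ.≤-trans (ℕ.+-monoʳ-≤ 4 (ℕ.m≤n+m (suc j) (length t ℕ.* 4))) j≤

  -- Perturbations

  2^k>0 : ∀ k → 0 ℕ.< 2 ℕ.^ k
  2^k>0 k = ℕ.m^n>0 2 k

  module Perturbation (f g : Homeo₊) (k : ℕ) (t : Signs) where

    s = length t
    A = prepend proj₂ t (levels f k)
    B = prepend proj₁ t (levels g k)

    open System k s A B
      (prepend-mono proj₂ t (levels f k) (levels-mono f k))
      (prepend-mono proj₁ t (levels g k) (levels-mono g k))
      (prepend-< proj₂ t (levels f k) (2^k>0 k) (levels-< f k))
      (prepend-< proj₁ t (levels g k) (2^k>0 k) (levels-< g k)) public
    open Slow (prepend-near proj₂ t (levels f k)) (prepend-near proj₁ t (levels g k)) public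

    node-even : ∀ a → node ((s ℕ.+ suc a) ℕ.+ (s ℕ.+ suc a)) ≡ grid (suc k) (suc a ℕ.+ suc a)
    node-even a = trans (cong node (solveℕ 2
        (λ s a → (s ⊕ (κ 1 ⊕ a)) ⊕ (s ⊕ (κ 1 ⊕ a)) ⊜ κ 1 ⊕ (s ⊕ s) ⊕ (a ⊕ (κ 1 ⊕ a))) refl s a))
      (node-coarse (a ℕ.+ suc a))

    ⊑-reflexive : ∀ {x y : I} → x ≡ y → x ⊑ y
    ⊑-reflexive refl = ≤-refl

    below-even : ∀ a → grid (suc k) (a ℕ.+ a) ⊑ node ((s ℕ.+ a) ℕ.+ (s ℕ.+ a))
    below-even zero    = grid-0 (suc k) (node ((s ℕ.+ 0) ℕ.+ (s ℕ.+ 0)))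
    below-even (suc a) = ⊑-reflexive (sym (node-even a))

    -- A bracket of the coarse grid spans two cells, so it absorbs the offset `o` that separates f
    -- from g.
    coarse : ∀ h i a o → o ℕ.≤ 1 →
      node (o ℕ.+ ((s ℕ.+ a) ℕ.+ (s ℕ.+ a))) ⊑ h · node ((s ℕ.+ suc i) ℕ.+ (s ℕ.+ suc i)) ×
      h · node ((s ℕ.+ suc i) ℕ.+ (s ℕ.+ suc i)) ⊑ node (suc (o ℕ.+ ((s ℕ.+ a) ℕ.+ (s ℕ.+ a)))) →
      Bracket h k a i
    coarse h i a o o≤1 (lower , upper) = subst
      (λ x → grid (suc k) (a ℕ.+ a) ⊑ h · x × h · x ⊑ grid (suc k) (suc a ℕ.+ suc a)) (node-even i)
      ( ≤-trans (below-even a) (≤-trans (node-mono (ℕ.m≤n+m _ o)) lower)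
      , ≤-trans upper (≤-trans (node-mono (ℕ.≤-trans
          (s≤s (ℕ.+-monoˡ-≤ ((s ℕ.+ a) ℕ.+ (s ℕ.+ a)) o≤1))
          (ℕ.≤-reflexive (solveℕ 2 (λ s a → κ 2 ⊕ ((s ⊕ a) ⊕ (s ⊕ a))
             ⊜ (s ⊕ (κ 1 ⊕ a)) ⊕ (s ⊕ (κ 1 ⊕ a))) refl s a))))
          (⊑-reflexive (node-even a))))

    index : ∀ i → suc (suc ((s ℕ.+ i) ℕ.+ (s ℕ.+ i))) ≡ (s ℕ.+ suc i) ℕ.+ (s ℕ.+ suc i)
    index i = solveℕ 2
      (λ s i → κ 2 ⊕ ((s ⊕ i) ⊕ (s ⊕ i)) ⊜ (s ⊕ (κ 1 ⊕ i)) ⊕ (s ⊕ (κ 1 ⊕ i)))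
      refl s i

    index< : ∀ i → suc i ℕ.< 2 ℕ.^ k → suc (suc ((s ℕ.+ i) ℕ.+ (s ℕ.+ i))) ℕ.< P
    index< i i< = subst (ℕ._< P) (sym (index i)) (ℕ.+-mono-< (ℕ.+-monoʳ-< s i<) (ℕ.+-monoʳ-< s i<))

    f-bracket : ∀ i → suc i ℕ.< 2 ℕ.^ k → Bracket F.h k (levels f k i) i
    f-bracket i i< = coarse F.h i (levels f k i) 1 ℕ.≤-refl (subst₂
      (λ a j → node (suc (a ℕ.+ a)) ⊑ F.h · node j × F.h · node j ⊑ node (suc (suc (a ℕ.+ a))))
      (prepend-shift proj₂ t (levels f k) i) (index i)
      (f-block ((s ℕ.+ i) ℕ.+ (s ℕ.+ i)) (⌊n+n/2⌋ (s ℕ.+ i)) (index< i i<)))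

    g-bracket : ∀ i → suc i ℕ.< 2 ℕ.^ k → Bracket G.h k (levels g k i) i
    g-bracket i i< = coarse G.h i (levels g k i) 0 z≤n (subst₂
      (λ a j → node (a ℕ.+ a) ⊑ G.h · node j × G.h · node j ⊑ node (suc (a ℕ.+ a)))
      (prepend-shift proj₁ t (levels g k) i) (index i)
      (g-block (suc ((s ℕ.+ i) ℕ.+ (s ℕ.+ i))) (⌊1+n+n/2⌋ (s ℕ.+ i)) (index< i i<)))

  within-open : ∀ ps w G → Within ps (eval G w) → OpenAt (λ G′ → Within ps (eval G′ w)) G
  within-open ps w G inside =
    openAt-All {A = λ (c , a) G′ → c ⊏ eval G′ w · a × eval G′ w · c ⊏ a} {G}
      (All.map (λ {(c , a)} (c< , <a) → openAt-∩ (eval-> w G a c c<) (eval-< w G c a <a)) inside)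

  mesh-top : ∀ k → let n = ℕ.pred (2 ℕ.^ k) in
             ½^ suc k ℚ.+ suc (n ℕ.+ n) ×ℚ ½^ suc k ≡ 1ℚ
  mesh-top k = trans (cong (_×ℚ ½^ suc k) (trans (cong suc (sym (ℕ.+-suc n n)))
    (trans (cong₂ ℕ._+_ (suc-pred-2^ k) (suc-pred-2^ k)) (2^k+2^k k)))) (2^×½^ (suc k))
    where n = ℕ.pred (2 ℕ.^ k)

  -- Perturbations with a long conjugate near the identity

  module Conjugates (f g : Homeo₊) (k : ℕ) where

    open Perturbation f g k [] public

    n = ℕ.pred (2 ℕ.^ k)
    t = signs A B 0 n
    T = eval G₀ (alternating t)
    V = eval G₀ (conjugate t)
    x₁ = grid (suc k) (suc (n ℕ.+ n))

    climbed : x₁ ⊑ T · node 1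
    climbed = subst (λ x → x ⊑ T · node 1) (node-coarse (n ℕ.+ n))
      (climb n 0 (ℕ.≤-reflexive (suc-pred-2^ k)))

    V-fix : ∀ x → x ⊑ x₁ → V ⟨$⟩ x ≃ proj₁ x
    V-fix x x≤ = conjugate-fixes G₀ t x (F.h-fix y y≤)
      where
      y = T ⁻¹₊ · x
      y≤ : y ⊑ node 1
      y≤ = ≤⇒⁻¹≤ T x (node 1) (≤-trans x≤ climbed)

    below-x₁ : ∀ m → m ℕ.≤ k → ∀ j → j ℕ.< 2 ℕ.^ m → grid m j ⊑ x₁
    below-x₁ m m≤k j j< = ⟦⟧-mono-≤ {j ×ℚ ½^ m} {suc (n ℕ.+ n) ×ℚ ½^ suc k} (lin≤
      (ℚ.+-mono-≤ (½^-antitone {m} {suc k} (ℕ.m≤n⇒m≤1+n m≤k)) (grid-≤ m j<))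
      (trans (cong (λ e → j ×ℚ ½^ m ℚ.+ (½^ m ℚ.+ e)) (sym (mesh-top k)))
        (solve 4 (λ j p c x → j :+ (p :+ (c :+ x)) := x :+ (c :+ (p :+ j)))
          refl (j ×ℚ ½^ m) (½^ m) (½^ suc k) (suc (n ℕ.+ n) ×ℚ ½^ suc k))))

    -- The left ends of the dyadic cells are at most 1 - 2^-m, hence below `x₁` and fixed by `V`. A
    -- fixed left end gives both conditions of its cell by strict monotonicity.
    inside : ∀ m → m ℕ.≤ k → Within (dyadic m) V
    inside m m≤k = All.applyUpTo⁺₁ _ (2 ℕ.^ m) λ {j} j< →
      ( ≤-<-trans (≥-of-≃ (V-fix (grid m j) (below-x₁ m m≤k j j<)))
          (mono-< V (grid m j) (grid m (suc j)) (grid-mono-< m (ℕ.n<1+n j) j<))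
      , ≤-<-trans (≤-reflexive (V-fix (grid m j) (below-x₁ m m≤k j j<))) (grid-mono-< m (ℕ.n<1+n j) j<))

    k≤n : k ℕ.≤ length t
    k≤n = ℕ.≤-trans (ℕ.s≤s⁻¹ (ℕ.≤-trans (n<2^n k) (ℕ.≤-reflexive (sym (suc-pred-2^ k)))))
      (ℕ.≤-reflexive (sym (length-signs A B 0 n)))

  FineMesh : Homeo₊ → ℚ → ℕ → Set
  FineMesh h δ k₀ = ∀ k → k₀ ℕ.≤ k → ∀ h′ →
    (∀ i → suc i ℕ.< 2 ℕ.^ k → Bracket h′ k (levels h k i) i) → h′ ≈[ δ ] h

  conjugate-small : ∀ m L f g δ → 0ℚ ℚ.< δ → ∃[ f′ ] ∃[ g′ ] f′ ≈[ δ ] f × g′ ≈[ δ ] g ×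
    (∃[ t ] L ℕ.≤ length t × Within (dyadic m) (eval (f′ , g′) (conjugate t)))
  conjugate-small m L f g δ 0<δ =
    at (proj₁ (bracket-close f δ 0<δ)) (proj₂ (bracket-close f δ 0<δ))
       (proj₁ (bracket-close g δ 0<δ)) (proj₂ (bracket-close g δ 0<δ))
    where
    Goal : Set
    Goal = ∃[ f′ ] ∃[ g′ ] f′ ≈[ δ ] f × g′ ≈[ δ ] g ×
      (∃[ t ] L ℕ.≤ length t × Within (dyadic m) (eval (f′ , g′) (conjugate t)))
    at : ∀ k₁ → FineMesh f δ k₁ → ∀ k₂ → FineMesh g δ k₂ → Goal
    at k₁ fine₁ k₂ fine₂ =
      C.F.h , C.G.h ,
      fine₁ k (ℕ.m≤m+n k₁ _) C.F.h C.f-bracket ,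
      fine₂ k (ℕ.≤-trans (ℕ.m≤m+n k₂ (L ℕ.+ m)) (ℕ.m≤n+m _ k₁)) C.G.h C.g-bracket ,
      C.t ,
      ℕ.≤-trans (ℕ.≤-trans (ℕ.m≤m+n L m) L+m≤k) C.k≤n ,
      C.inside m (ℕ.≤-trans (ℕ.m≤n+m m L) L+m≤k)
      where
      -- A sum in place of a maximum: fine enough for f, g and level `m`, and then also long enough
      -- for `L`.
      k = k₁ ℕ.+ (k₂ ℕ.+ (L ℕ.+ m))
      L+m≤k : L ℕ.+ m ℕ.≤ k
      L+m≤k = ℕ.≤-trans (ℕ.m≤n+m (L ℕ.+ m) k₂) (ℕ.m≤n+m _ k₁)
      module C = Conjugates f g k

  -- Perturbations with a word that moves ½ beyond ¾

  ¾ : ℚ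
  ¾ = ½ ℚ.+ ½ ℚ.* ½

  ½<¾ : ½ ℚ.< ¾
  ½<¾ = toWitness {a? = ½ ℚ.<? ¾} _

  module Escape (f g : Homeo₊) (k : ℕ) (2≤k : 2 ℕ.≤ k) where

    n = ℕ.pred (2 ℕ.^ k)
    -- Read off the original levels, since `u` is chosen only after τ.
    τ = signs (levels f k) (levels g k) 0 n

    escaping : Signs → Word
    escaping u = alternating τ ∙ʷ conjugate u ∙ʷ alternating τ ⁻¹ʷ

    module Chain (u : Signs) (τ<u : suc (length τ) ℕ.≤ length u) where

      open Perturbation f g k (unfold u) public

      T = eval G₀ (alternating τ)
      V = eval G₀ (conjugate u)
      x₀ = node (suc (s ℕ.+ s))

      -- By `length-unfold`, s = 2|u| + 1, so |u| > |τ| gives 2s ≥ 4|τ| + 6. The bound required is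
      -- four places for each entry of τ, starting from node 3.
      s+s≥ : length τ ℕ.* 4 ℕ.+ 3 ℕ.≤ s ℕ.+ s
      s+s≥ = ℕ.≤-trans (ℕ.m≤n+m _ 3) (ℕ.≤-trans (ℕ.≤-reflexive (solveℕ 1
          (λ m → κ 3 ⊕ (m ⊗ κ 4 ⊕ κ 3)
             ⊜ (κ 1 ⊕ ((κ 1 ⊕ m) ⊕ (κ 1 ⊕ m))) ⊕ (κ 1 ⊕ ((κ 1 ⊕ m) ⊕ (κ 1 ⊕ m)))) refl (length τ)))
        (ℕ.≤-trans (ℕ.+-mono-≤ (s≤s (ℕ.+-mono-≤ τ<u τ<u)) (s≤s (ℕ.+-mono-≤ τ<u τ<u)))
          (ℕ.≤-reflexive (cong₂ ℕ._+_ (sym (length-unfold u)) (sym (length-unfold u))))))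

      -- The unfolded word is the conjugate preceded by g. It climbs from node 1, and g moves node 1
      -- at most to node 3, so the conjugate alone climbs from node 3.
      x₀≤V : x₀ ⊑ V · node 3
      x₀≤V = ≤-trans
        (≤-trans (subst (λ t → x₀ ⊑ eval G₀ (alternating t) · node 1)
            (signs-prefix (unfold u) (levels f k) (levels g k)) (climb s 0 s<K))
          (≤-reflexive (alternating-unfold G₀ u (node 1))))
        (mono-≤ V (G.h · node 1) (node 3) (g-slow true 0 (ℕ.≤-trans (ℕ.m≤n+m 3 (length τ ℕ.* 4)) s+s≥)))
        where
        s<K : s ℕ.< K
        s<K = ℕ.≤-trans (ℕ.≤-reflexive (ℕ.+-comm 1 s)) (ℕ.+-monoʳ-≤ s (2^k>0 k))

      τ-slow : T · node 3 ⊑ ⟦ ½ ⟧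
      τ-slow = ≤-trans (slow τ 2 s+s≥)
        (≤-trans (node-mono (ℕ.m≤n⇒m≤1+n s+s≥))
          (≤-trans (⊑-reflexive (trans (cong node (sym (ℕ.+-identityʳ (suc (s ℕ.+ s))))) (node-coarse 0)))
            (⟦⟧-mono-≤ (ℚ.≤-trans (ℚ.≤-reflexive (ℚ.+-identityʳ (½^ suc k)))
              (½^-antitone {1} {suc k} (s≤s z≤n))))))

      end : grid (suc k) (suc (n ℕ.+ n)) ⊑ T · x₀
      end = subst (λ x → x ⊑ T · x₀)
        (trans (cong node (cong suc (solveℕ 2 (λ s n → (s ⊕ n) ⊕ (s ⊕ n) ⊜ (s ⊕ s) ⊕ (n ⊕ n)) refl s n)))
          (node-coarse (n ℕ.+ n)))
        (subst (λ t → node (suc ((s ℕ.+ n) ℕ.+ (s ℕ.+ n))) ⊑ eval G₀ (alternating t) · x₀)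
          (signs-suffix (unfold u) (levels f k) (levels g k) n)
          (climb n s (ℕ.+-monoʳ-< s (ℕ.≤-reflexive (suc-pred-2^ k)))))

      ¾<end : ⟦ ¾ ⟧ ⊏ grid (suc k) (suc (n ℕ.+ n))
      ¾<end = ⟦⟧-mono-< {¾} {suc (n ℕ.+ n) ×ℚ ½^ suc k} (toWitness {a? = 0ℚ ℚ.≤? ¾} _)
        -- For k ≥ 2 the mesh is at most 1/8, so the last grid point but one exceeds ¾.
        (lin< (ℚ.≤-<-trans (½^-antitone {3} {suc k} (s≤s 2≤k)) (toWitness {a? = ½^ 3 ℚ.<? (½ ℚ.* ½)} _))
          (trans (toWitness {a? = (¾ ℚ.+ ½ ℚ.* ½) ℚ.≟ 1ℚ} _)
            (trans (sym (mesh-top k)) (ℚ.+-comm (½^ suc k) (suc (n ℕ.+ n) ×ℚ ½^ suc k)))))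
        (lin≤ (ℚ.<⇒≤ (½^-pos (suc k)))
          (trans (ℚ.+-comm (suc (n ℕ.+ n) ×ℚ ½^ suc k) (½^ suc k))
            (trans (mesh-top k) (sym (ℚ.+-identityʳ 1ℚ)))))

      escapes : ⟦ ¾ ⟧ ⊏ eval G₀ (escaping u) · ⟦ ½ ⟧
      escapes = <-≤-trans ¾<end (≤-trans end
        (mono-≤ T x₀ (V · y) (≤-trans x₀≤V (mono-≤ V (node 3) y (≤⇒≤⁻¹ T ⟦ ½ ⟧ (node 3) τ-slow)))))
        where y = T ⁻¹₊ · ⟦ ½ ⟧

  -- Meagerness

  pullback : Homeo₊ → List (I × I) → List (I × I)
  pullback h = map λ (c , a) → h ⁻¹₊ · c , h ⁻¹₊ · a

  pullback-gaps : ∀ h ps → Gaps ps → Gaps (pullback h ps)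
  pullback-gaps h []             []         = []
  pullback-gaps h ((c , a) ∷ ps) (lt ∷ lts) = mono-< (h ⁻¹₊) c a lt ∷ pullback-gaps h ps lts

  within-pullback : ∀ h k ps → Within (pullback h ps) k → Within ps (h ∘₊ k ∘₊ h ⁻¹₊)
  within-pullback h k []             []              = []
  within-pullback h k ((c , a) ∷ ps) ((c< , <a) ∷ w) =
    (⁻¹<⇒< h c (k · h ⁻¹₊ · a) c< , <⁻¹⇒< h a (k · h ⁻¹₊ · c) <a) ∷ within-pullback h k ps w

  -- Transfer of neighbourhoods along a similarity

  module Similarity (G F : Pair) (similar : TopologicallySimilar G F) where

    open TopologicallySimilar similar
    open Homeomorphism homeomorphism 
      using (from; from-cong; strictlyInverseʳ; to-continuous; from-continuous)
    open IsGroupIsomorphism isGroupIsomorphism using (∙-homo; ε-homo; ⁻¹-homo)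

    to-eval : ∀ w → proj₁ (to (eval G w , member G w)) Hₛ.≈ eval F w
    to-eval gen₁     = extends₁
    to-eval gen₂     = extends₂
    to-eval 1ʷ       = ε-homo
    to-eval (v ∙ʷ w) =
      Hₛ.trans {proj₁ (to (eval G (v ∙ʷ w) , member G (v ∙ʷ w)))}
               {proj₁ (to (eval G v , member G v)) ∘₊ proj₁ (to (eval G w , member G w))}
               {eval F v ∘₊ eval F w}
        (∙-homo (eval G v , member G v) (eval G w , member G w))
        (Hₛ.∙-cong {proj₁ (to (eval G v , member G v))} {eval F v}
                   {proj₁ (to (eval G w , member G w))} {eval F w} (to-eval v) (to-eval w))
    to-eval (w ⁻¹ʷ)  =
      Hₛ.trans {proj₁ (to (eval G (w ⁻¹ʷ) , member G (w ⁻¹ʷ)))}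
               {proj₁ (to (eval G w , member G w)) ⁻¹₊} {eval F w ⁻¹₊}
        (⁻¹-homo (eval G w , member G w))
        (Hₛ.⁻¹-cong {proj₁ (to (eval G w , member G w))} {eval F w} (to-eval w))

    from-eval : ∀ w → proj₁ (from (eval F w , member F w)) Hₛ.≈ eval G w
    from-eval w =
      Hₛ.trans {proj₁ (from (eval F w , member F w))}
               {proj₁ (from (to (eval G w , member G w)))} {eval G w}
        (from-cong {eval F w , member F w} {to (eval G w , member G w)}
          (Hₛ.sym {proj₁ (to (eval G w , member G w))} {eval F w} (to-eval w)))
        (strictlyInverseʳ (eval G w , member G w))

    transfer-to : ∀ ps → Gaps ps →
      ∃[ n ] ∀ w → Within (dyadic n) (eval G w) → Within ps (eval F w)
    transfer-to = transfer G F to to-continuous to-eval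

    transfer-from : ∀ ps → Gaps ps →
      ∃[ n ] ∀ w → Within (dyadic n) (eval F w) → Within ps (eval G w)
    transfer-from = transfer F G from from-continuous from-eval

  -- The two cases

  module Main (F : Pair) where

    Far : Set
    Far = ∃[ ps ] ∃[ L ] Gaps ps × (∀ t → L ℕ.≤ length t → ¬ Within ps (eval F (conjugate t)))

    Accumulating : Set
    Accumulating = ∀ ps → Gaps ps → ∀ L →
      ∃[ t ] L ℕ.≤ length t × Within ps (eval F (conjugate t))

    ¬far⇒accumulating : ¬ Far → Accumulating
    ¬far⇒accumulating ¬far ps gaps L = by-cases em
      where
      by-cases : Dec (∃[ t ] L ℕ.≤ length t × Within ps (eval F (conjugate t))) →
                 ∃[ t ] L ℕ.≤ length t × Within ps (eval F (conjugate t))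
      by-cases (yes found) = found
      by-cases (no ¬found) =
        contradiction (ps , L , gaps , λ t L≤ w → ¬found (t , L≤ , w)) ¬far

    Avoids : ℕ → ℕ → Pred Pair 0ℓ
    Avoids L m G = ∀ t → L ℕ.≤ length t → ¬ Within (dyadic m) (eval G (conjugate t))

    avoids-nowhereDense : ∀ L m → Space.NowhereDense H² (Avoids L m)
    avoids-nowhereDense L m = nowhereDense (Avoids L m) λ f g δ 0<δ →
      let f′ , g′ , f′≈f , g′≈g , t , L≤t , inside = conjugate-small m L f g δ 0<δ
      in f′ , g′ , f′≈f , g′≈g ,
         openAt-map (λ G inside avoids → avoids t L≤t inside)
           (within-open (dyadic m) (conjugate t) (f′ , g′) inside)

    far-meager : Far → Space.Meager H² (SimilarityClass F)
    far-meager (ps , L , gaps , far) = Avoids L , avoids-nowhereDense L , λ G similar →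
      let m , inside = Similarity.transfer-to G F similar ps gaps
      in m , λ t L≤t w → far t L≤t (inside (conjugate t) w)

    Traps : ℕ → Pred Pair 0ℓ
    Traps n G = ∀ w → Within (dyadic n) (eval F w) → eval G w · ⟦ ½ ⟧ ⊑ ⟦ ¾ ⟧

    traps-nowhereDense : Accumulating → ∀ n → Space.NowhereDense H² (Traps n)
    traps-nowhereDense accumulating n = nowhereDense (Traps n) λ f g δ 0<δ →
      at f g δ (proj₁ (bracket-close f δ 0<δ)) (proj₂ (bracket-close f δ 0<δ))
        (proj₁ (bracket-close g δ 0<δ)) (proj₂ (bracket-close g δ 0<δ))
      where
      at : ∀ f g δ k₁ → FineMesh f δ k₁ → ∀ k₂ → FineMesh g δ k₂ → ∃[ f′ ] ∃[ g′ ]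
        f′ ≈[ δ ] f × g′ ≈[ δ ] g × OpenAt (λ G → ¬ Traps n G) (f′ , g′)
      at f g δ k₁ fine₁ k₂ fine₂ = C.F.h , C.G.h ,
          fine₁ k (ℕ.m≤m+n k₁ (k₂ ℕ.+ 2)) C.F.h C.f-bracket ,
          fine₂ k (ℕ.≤-trans (ℕ.m≤m+n k₂ 2) (ℕ.m≤n+m (k₂ ℕ.+ 2) k₁)) C.G.h C.g-bracket ,
          openAt-map (λ G escapes traps → <⇒≱ escapes (traps (E.escaping u) inside))
            (eval-> (E.escaping u) C.G₀ ⟦ ½ ⟧ ⟦ ¾ ⟧ C.escapes)
        where
        k = k₁ ℕ.+ (k₂ ℕ.+ 2)
        2≤k : 2 ℕ.≤ k
        2≤k = ℕ.≤-trans (ℕ.m≤n+m 2 k₂) (ℕ.m≤n+m (k₂ ℕ.+ 2) k₁)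
        module E = Escape f g k 2≤k
        T = eval F (alternating E.τ)
        -- Here τ is evaluated at `F`: conjugation by this value brings the pulled back
        -- neighbourhood to the n-th dyadic one, which is where `Traps n` applies.
        found = accumulating (pullback T (dyadic n)) (pullback-gaps T (dyadic n) (dyadic-gaps n))
                  (suc (length E.τ))
        u = proj₁ found
        inside : Within (dyadic n) (eval F (E.escaping u))
        inside = within-resp (T ∘₊ eval F (conjugate u) ∘₊ T ⁻¹₊) (eval F (E.escaping u)) (dyadic n)
          (λ _ → ℝₛ.refl) (within-pullback T (eval F (conjugate u)) (dyadic n) (proj₂ (proj₂ found)))
        module C = E.Chain u (proj₁ (proj₂ found))

    accumulating-meager : Accumulating → Space.Meager H² (SimilarityClass F)
    accumulating-meager accumulating = Traps , traps-nowhereDense accumulating , λ G similar →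
      -- The single gap from ½ to ¾ suffices: the second half of its condition says that ½ stays
      -- below ¾.
      let n , inside = Similarity.transfer-from G F similar ((⟦ ½ ⟧ , ⟦ ¾ ⟧) ∷ [])
            (⟦⟧-mono-< (toWitness {a? = 0ℚ ℚ.≤? ½} _) ½<¾ (toWitness {a? = ¾ ℚ.≤? 1ℚ} _) ∷ [])
      in n , λ w w∈ → <⇒≤ (proj₂ (All.head (inside w w∈)))

    meager : Dec Far → Space.Meager H² (SimilarityClass F)
    meager (yes far) = far-meager far
    meager (no ¬far) = accumulating-meager (¬far⇒accumulating ¬far)

theorem3p14 : ExcludedMiddle 0ℓ → (f : Homeo₊ × Homeo₊) → Space.Meager (H-space ×ₛ H-space) (SimilarityClass f)
theorem3p14 em f = Classical.Main.meager em f em
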